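{- Let $n$ and $k$ be two positive integers with $n\ge k\ge 4$. Then $${\rm ex}_{\mathcal{OP}}(n,P_k)=\max\{{\rm ex}'_{\mathcal{OP}}(n,P_k),\,{\rm ex}''_{\mathcal{OP}}(n,P_k)\}.$$
   Context: All graphs are finite, undirected and simple. $P_k$ denotes the path on $k$ vertices. A graph is $H$-free if it contains no (not necessarily induced) subgraph isomorphic to $H$. A graph is outerplanar if it can be embedded in the plane so that all vertices lie on the boundary of the outer face. - ${\rm ex}_{\mathcal{OP}}(n,P_k)$ is the maximum number of edges in a $P_k$-free outerplanar graph on $n$ vertices. - ${\rm ex}'_{\mathcal{OP}}(n,P_k)$ is the maximum number of edges in a connected $P_k$-free outerplanar graph on $n$ vertices. - ${\rm ex}''_{\mathcal{OP}}(n,P_k)$ is the maximum number of edges in a $P_k$-free outerplanar graph on $n$ vertices in which every connected component has at most $k-1$ vertices. -}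

module Defs where

open import Data.Empty using (⊥-elim)
open import Data.Fin using (Fin; toℕ) renaming (_<?_ to _<ᶠ?_)
import Data.Fin.Properties as Fin
open import Data.Fin.Subset using (Subset; _∈_; _∉_; ∣_∣; inside; outside)
open import Data.Fin.Subset.Properties using (_∈?_)
open import Data.List
  using (List; []; _∷_; length; filter; map; concatMap; allFin;
         cartesianProduct; cartesianProductWith; deduplicate)
open import Data.List.Extrema.Nat using (max; xs≤max; argmax-sel)
import Data.List.Membership.Propositional as List
open import Data.List.Membership.Propositional.Properties
  using (∈-allFin; ∈-cartesianProduct⁺; ∈-cartesianProductWith⁺; ∈-concatMap⁺;
         ∈-filter⁺; ∈-filter⁻; ∈-map⁺; ∈-map⁻)
import Data.List.Relation.Unary.All as All
open import Data.List.Relation.Unary.Any using (here; there; any?; satisfied)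
open import Data.Nat using (ℕ; zero; suc; _+_; _*_; _∸_; _≤_; _≤?_; z≤n)
import Data.Nat.Properties as ℕ
open import Data.Product using (∃; ∃-syntax; _×_; _,_; proj₁; proj₂)
import Data.Product.Properties as Product
open import Data.Sum using (_⊎_; inj₁; inj₂; swap)
open import Data.Vec using (Vec; []; _∷_; lookup; tabulate)
open import Data.Vec.Properties using (lookup∘tabulate; lookup⇒[]=; []=⇒lookup)
open import Function using (_∘_; Injective)
open import Level using (0ℓ)
open import Relation.Binary using (Rel; Decidable; DecidableEquality)
open import Relation.Binary.Construct.Closure.ReflexiveTransitive
  using (Star; ε; _◅_; _◅◅_)
open import Relation.Binary.PropositionalEquality
  using (_≡_; refl; sym; trans; cong; subst)
open import Relation.Nullary using (¬_; Dec; yes; no; does)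
open import Relation.Nullary.Decidable
  using (map′; ¬?; _×-dec_; _⊎-dec_; _→-dec_; recompute; dec-true)
import Relation.Unary as Pred

-- Reachability on a finite type is decidable (Warshall's algorithm):
-- Via zs x y holds if y is reachable from x with all intermediate points in zs.
module _ {A : Set} (_≟_ : DecidableEquality A) {R : Rel A 0ℓ} (R? : Decidable R) where

  private
    Via : List A → Rel A 0ℓ
    Via []       x y = x ≡ y ⊎ R x y
    Via (z ∷ zs) x y = Via zs x y ⊎ (Via zs x z × Via zs z y)

    via? : ∀ zs → Decidable (Via zs)
    via? []       x y = (x ≟ y) ⊎-dec R? x y
    via? (z ∷ zs) x y = via? zs x y ⊎-dec (via? zs x z ×-dec via? zs z y)

    direct : ∀ zs {x y} → x ≡ y ⊎ R x y → Via zs x y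
    direct []       p = p
    direct (z ∷ zs) p = inj₁ (direct zs p)

    toFirst : ∀ z zs {x} → Via (z ∷ zs) x z → Via zs x z
    toFirst z zs (inj₁ p)       = p
    toFirst z zs (inj₂ (p , _)) = p

    fromFirst : ∀ z zs {y} → Via (z ∷ zs) z y → Via zs z y
    fromFirst z zs (inj₁ p)       = p
    fromFirst z zs (inj₂ (_ , p)) = p

    join : ∀ {zs x y z} → z List.∈ zs → Via zs x z → Via zs z y → Via zs x y
    join {z ∷ zs} (here refl) p q = inj₂ (toFirst z zs p , fromFirst z zs q)
    join (there m) (inj₁ p)        (inj₁ q)        = inj₁ (join m p q)
    join (there m) (inj₁ p)        (inj₂ (q , q′)) = inj₂ (join m p q , q′)
    join (there m) (inj₂ (p , p′)) (inj₁ q)        = inj₂ (p , join m p′ q)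
    join (there m) (inj₂ (p , p′)) (inj₂ (q , q′)) = inj₂ (p , q′)

    via⇒star : ∀ zs {x y} → Via zs x y → Star R x y
    via⇒star []       (inj₁ refl)    = ε
    via⇒star []       (inj₂ r)       = r ◅ ε
    via⇒star (z ∷ zs) (inj₁ p)       = via⇒star zs p
    via⇒star (z ∷ zs) (inj₂ (p , q)) = via⇒star zs p ◅◅ via⇒star zs q

  star? : (zs : List A) → (∀ z → z List.∈ zs) → Decidable (Star R)
  star? zs total x y = map′ (via⇒star zs) star⇒via (via? zs x y)
    where
    star⇒via : ∀ {x y} → Star R x y → Via zs x y
    star⇒via ε        = direct zs (inj₁ refl)
    star⇒via (r ◅ rs) = join (total _) (direct zs (inj₂ r)) (star⇒via rs)

vectors : {A : Set} → List A → (n : ℕ) → List (Vec A n)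
vectors xs zero    = [] ∷ []
vectors xs (suc n) = cartesianProductWith _∷_ xs (vectors xs n)

∈-vectors : {A : Set} {xs : List A} → (∀ x → x List.∈ xs) →
            ∀ {n} (v : Vec A n) → v List.∈ vectors xs n
∈-vectors total []      = here refl
∈-vectors total (x ∷ v) = ∈-cartesianProductWith⁺ _∷_ (total x) (∈-vectors total v)

exists? : {A : Set} (xs : List A) → (∀ x → x List.∈ xs) →
          {P : A → Set} → Pred.Decidable P → Dec (∃ P)
exists? xs total P? =
  map′ satisfied (λ (x , p) → List.lose (total x) p) (any? P? xs)

-- The proofs of symmetry and irreflexivity are irrelevant, so that a graph is
-- determined by its neighbourhoods.
record Graph (n : ℕ) : Set where
  field
    neighbours   : Vec (Subset n) n
    .symmetric   : ∀ u v → v ∈ lookup neighbours u → u ∈ lookup neighbours v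
    .irreflexive : ∀ u → u ∉ lookup neighbours u

  N : Fin n → Subset n
  N = lookup neighbours

  Adj : Rel (Fin n) 0ℓ
  Adj u v = v ∈ N u

  adj? : Decidable Adj
  adj? u v = v ∈? N u

  Connected : Rel (Fin n) 0ℓ
  Connected = Star Adj

  connected? : Decidable Connected
  connected? = star? Fin._≟_ adj? (allFin n) ∈-allFin

  pairs : List (Fin n × Fin n)
  pairs = cartesianProduct (allFin n) (allFin n)

  size : ℕ
  size = length (filter (λ (u , v) → (u <ᶠ? v) ×-dec adj? u v) pairs)

  component : Fin n → List (Fin n)
  component u = filter (connected? u) (allFin n)

  componentCount : ℕ
  componentCount = length (deduplicate connected? (allFin n))

  isolatedCount : ℕ
  isolatedCount = length (filter (λ u → ∣ N u ∣ ℕ.≟ 0) (allFin n))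

  -- The dart (u , v) is the edge uv directed from u to v.
  darts : List (Fin n × Fin n)
  darts = filter (λ (u , v) → adj? u v) pairs

open Graph using (Adj; adj?; Connected; connected?; size; component)

adj-sym : ∀ {n} (G : Graph n) {u v} → Adj G u v → Adj G v u
adj-sym G@record { symmetric = s } {u} {v} p = recompute (adj? G v u) (s u v p)

adj-irrefl : ∀ {n} (G : Graph n) {u} → ¬ Adj G u u
adj-irrefl G@record { irreflexive = i } {u} = recompute (¬? (adj? G u u)) (i u)

IsConnected : ∀ {n} → Graph n → Set
IsConnected G = ∀ u v → Connected G u v

-- A (not necessarily induced) copy of H in G.
Contains : ∀ {m n} → Graph m → Graph n → Set
Contains {m} {n} H G =
  ∃[ f ] Injective {A = Fin m} {B = Fin n} _≡_ _≡_ f ×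
         (∀ i j → Adj H i j → Adj G (f i) (f j))

_-Free_ : ∀ {m n} → Graph m → Graph n → Set
H -Free G = ¬ Contains H G

private
  Consecutive : ∀ {k} → Rel (Fin k) 0ℓ
  Consecutive i j = toℕ j ≡ suc (toℕ i) ⊎ toℕ i ≡ suc (toℕ j)

  consecutive? : ∀ {k} → Decidable (Consecutive {k})
  consecutive? i j = (toℕ j ℕ.≟ suc (toℕ i)) ⊎-dec (toℕ i ℕ.≟ suc (toℕ j))

  row : ∀ {k} → Fin k → Subset k
  row i = tabulate (λ j → does (consecutive? i j))

  lookup-rows : ∀ {k} (i j : Fin k) →
                lookup (lookup (tabulate row) i) j ≡ does (consecutive? i j)
  lookup-rows i j = trans (cong (λ s → lookup s j) (lookup∘tabulate row i))
                          (lookup∘tabulate (λ j → does (consecutive? i j)) j)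

  ∈-rows⁻ : ∀ {k} (i j : Fin k) → j ∈ lookup (tabulate row) i → Consecutive i j
  ∈-rows⁻ i j m = invert (consecutive? i j) (trans (sym (lookup-rows i j)) ([]=⇒lookup m))
    where
    invert : ∀ {A : Set} (A? : Dec A) → does A? ≡ inside → A
    invert (yes a) _ = a

  ∈-rows⁺ : ∀ {k} (i j : Fin k) → Consecutive i j → j ∈ lookup (tabulate row) i
  ∈-rows⁺ i j c = lookup⇒[]= j _ (trans (lookup-rows i j) (dec-true (consecutive? i j) c))

  ¬consecutive-self : ∀ {k} (i : Fin k) → ¬ Consecutive i i
  ¬consecutive-self i (inj₁ p) = ℕ.1+n≢n (sym p)
  ¬consecutive-self i (inj₂ p) = ℕ.1+n≢n (sym p)

-- The path on k vertices 0, 1, …, k - 1.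
P : (k : ℕ) → Graph k
P k = record
  { neighbours  = tabulate row
  ; symmetric   = λ i j → ∈-rows⁺ j i ∘ swap ∘ ∈-rows⁻ i j
  ; irreflexive = λ i → ¬consecutive-self i ∘ ∈-rows⁻ i i
  }

P-adj⁻ : ∀ {k} (i j : Fin k) → Adj (P k) i j → toℕ j ≡ suc (toℕ i) ⊎ toℕ i ≡ suc (toℕ j)
P-adj⁻ = ∈-rows⁻

P-adj⁺ : ∀ {k} (i j : Fin k) → toℕ j ≡ suc (toℕ i) ⊎ toℕ i ≡ suc (toℕ j) → Adj (P k) i j
P-adj⁺ = ∈-rows⁺

-- Embeddings in the plane are described combinatorially, up to homeomorphism:
-- the drawing of the edges around each vertex is recorded by the cyclic order
-- in which they leave that vertex (a rotation system).  The entry v of the row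
-- of u is the neighbour of u following v in that order.
module Rotation {n : ℕ} (G : Graph n) (rotation : Vec (Vec (Fin n) n) n) where

  open Graph G using (darts; componentCount; isolatedCount; pairs)

  ρ : Fin n → Fin n → Fin n
  ρ u v = lookup (lookup rotation u) v

  -- ρ u permutes the neighbours of u in a single cycle.
  IsRotation : Set
  IsRotation =
    (∀ u v → Adj G u v → Adj G u (ρ u v)) ×
    (∀ u v w → Adj G u v → Adj G u w → Star (λ x y → ρ u x ≡ y) v w)

  -- The dart following a given one on the boundary walk of the face beside it.
  next : Fin n × Fin n → Fin n × Fin n
  next (u , v) = v , ρ v u

  SameFace : Rel (Fin n × Fin n) 0ℓ
  SameFace = Star (λ d e → next d ≡ e)

  sameFace? : Decidable SameFace
  sameFace? = star? _≟_ (λ d e → next d ≟ e) pairs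
                    (λ (u , v) → ∈-cartesianProduct⁺ (∈-allFin u) (∈-allFin v))
    where _≟_ = Product.≡-dec Fin._≟_ Fin._≟_

  -- Boundary walks.  An isolated vertex has no dart, but its drawing in the
  -- plane still has one face, which is bounded by the vertex alone.
  walkCount : ℕ
  walkCount = length (deduplicate sameFace? darts) + isolatedCount

  -- Euler's formula V - E + F = 2, summed over the components, each with its
  -- own boundary walks.  Every component satisfies V - E + F ≤ 2, with equality
  -- exactly when its rotation system is realised by a drawing in the plane, so
  -- the sum forces every component to be drawn in the plane.
  IsPlanar : Set
  IsPlanar = n + walkCount ≡ size G + 2 * componentCount

  -- Each component has a boundary walk that visits all its vertices.  Any face
  -- of a plane drawing of a component may be taken as the outer one, and the
  -- outer face of a drawing of G with the components side by side is bounded by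
  -- the outer boundary walks of all the components; conversely, if all vertices
  -- of G lie on the outer face then so do those of each component drawn alone.
  -- There is nothing to require of isolated vertices.
  AllOnOuterFace : Set
  AllOnOuterFace =
    ∀ u v → Adj G u v →
    ∃[ x ] Adj G u x ×
           (∀ w → Connected G u w → ∃[ y ] Adj G w y × SameFace (u , x) (w , y))

  isRotation? : Dec IsRotation
  isRotation? =
    Fin.all? (λ u → Fin.all? λ v → adj? G u v →-dec adj? G u (ρ u v))
    ×-dec
    Fin.all? (λ u → Fin.all? λ v → Fin.all? λ w →
      adj? G u v →-dec (adj? G u w →-dec
        star? Fin._≟_ (λ x y → ρ u x Fin.≟ y) (allFin n) ∈-allFin v w))

  isPlanar? : Dec IsPlanar
  isPlanar? = (n + walkCount) ℕ.≟ (size G + 2 * componentCount)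

  allOnOuterFace? : Dec AllOnOuterFace
  allOnOuterFace? = Fin.all? λ u → Fin.all? λ v → adj? G u v →-dec
    Fin.any? λ x → adj? G u x ×-dec
      Fin.all? λ w → connected? G u w →-dec
        Fin.any? λ y → adj? G w y ×-dec sameFace? (u , x) (w , y)

Outerplanar : ∀ {n} → Graph n → Set
Outerplanar {n} G = ∃[ rotation ] let open Rotation G rotation in
  IsRotation × IsPlanar × AllOnOuterFace

outerplanar? : ∀ {n} → Pred.Decidable (Outerplanar {n})
outerplanar? {n} G =
  exists? (vectors (vectors (allFin n) n) n) (∈-vectors (∈-vectors ∈-allFin))
    (λ rotation → let open Rotation G rotation in
      isRotation? ×-dec (isPlanar? ×-dec allOnOuterFace?))

isConnected? : ∀ {n} → Pred.Decidable (IsConnected {n})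
isConnected? G = Fin.all? λ u → Fin.all? λ v → connected? G u v

contains? : ∀ {m n} (H : Graph m) (G : Graph n) → Dec (Contains H G)
contains? {m} {n} H G =
  map′ (λ (f , inj , hom) → lookup f , (λ {i} {j} → inj i j) , hom) tabulated
    (exists? (vectors (allFin n) m) (∈-vectors ∈-allFin) λ f →
      Fin.all? (λ i → Fin.all? λ j →
        (lookup f i Fin.≟ lookup f j) →-dec (i Fin.≟ j))
      ×-dec
      Fin.all? (λ i → Fin.all? λ j →
        adj? H i j →-dec adj? G (lookup f i) (lookup f j)))
  where
  tabulated : Contains H G → ∃[ f ]
    (∀ i j → lookup f i ≡ lookup f j → i ≡ j) ×
    (∀ i j → Adj H i j → Adj G (lookup f i) (lookup f j))
  tabulated (f , inj , hom) = tabulate f , inj′ , hom′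
    where
    inj′ : ∀ i j → lookup (tabulate f) i ≡ lookup (tabulate f) j → i ≡ j
    inj′ i j e rewrite lookup∘tabulate f i | lookup∘tabulate f j = inj e
    hom′ : ∀ i j → Adj H i j → Adj G (lookup (tabulate f) i) (lookup (tabulate f) j)
    hom′ i j a rewrite lookup∘tabulate f i | lookup∘tabulate f j = hom i j a

private
  subsets : (n : ℕ) → List (Subset n)
  subsets = vectors (inside ∷ outside ∷ [])

  ∈-subsets : ∀ {n} (s : Subset n) → s List.∈ subsets n
  ∈-subsets = ∈-vectors λ where
    inside  → here refl
    outside → there (here refl)

  module _ {n : ℕ} (nbs : Vec (Subset n) n) where

    Symm Irr : Set
    Symm = ∀ u v → v ∈ lookup nbs u → u ∈ lookup nbs v
    Irr  = ∀ u → u ∉ lookup nbs u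

    symm? : Dec Symm
    symm? = Fin.all? λ u → Fin.all? λ v → (v ∈? lookup nbs u) →-dec (u ∈? lookup nbs v)

    irr? : Dec Irr
    irr? = Fin.all? λ u → ¬? (u ∈? lookup nbs u)

    fromNeighbours : List (Graph n)
    fromNeighbours with symm? | irr?
    ... | yes s | yes i = record { neighbours = nbs ; symmetric = s ; irreflexive = i } ∷ []
    ... | _     | _     = []

    ∈-fromNeighbours : .(s : Symm) .(i : Irr) →
      record { neighbours = nbs ; symmetric = s ; irreflexive = i } List.∈ fromNeighbours
    ∈-fromNeighbours s i with symm? | irr?
    ... | yes _ | yes _ = here refl
    ... | no ¬s | _     = ⊥-elim (recompute (no λ ()) (¬s s))
    ... | yes _ | no ¬i = ⊥-elim (recompute (no λ ()) (¬i i))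

allGraphs : (n : ℕ) → List (Graph n)
allGraphs n = concatMap fromNeighbours (vectors (subsets n) n)

∈-allGraphs : ∀ {n} (G : Graph n) → G List.∈ allGraphs n
∈-allGraphs record { neighbours = nbs ; symmetric = s ; irreflexive = i } =
  ∈-concatMap⁺ fromNeighbours
    (List.lose (∈-vectors ∈-subsets nbs) (∈-fromNeighbours nbs s i))

-- The maximum of size over the graphs on n vertices with a given property,
-- or 0 if there are none.
maxSize : ∀ {n} {Q : Graph n → Set} → Pred.Decidable Q → ℕ
maxSize {n} Q? = max 0 (map size (filter Q? (allGraphs n)))

size≤maxSize : ∀ {n} {Q : Graph n → Set} (Q? : Pred.Decidable Q) →
               ∀ G → Q G → size G ≤ maxSize Q?
size≤maxSize Q? G q =
  All.lookup (xs≤max 0 _) (∈-map⁺ size (∈-filter⁺ Q? (∈-allGraphs G) q))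

maxSize-attained : ∀ {n} {Q : Graph n → Set} (Q? : Pred.Decidable Q) →
                   ∃ Q → ∃[ G ] Q G × size G ≡ maxSize Q?
maxSize-attained {n} Q? (G , q) with argmax-sel (λ m → m) 0 (map size (filter Q? (allGraphs n)))
... | inj₁ max≡0 = G , q , ℕ.≤-antisym (size≤maxSize Q? G q)
                                      (subst (_≤ size G) (sym max≡0) z≤n)
... | inj₂ max∈  with ∈-map⁻ size max∈
...   | H , H∈ , max≡ = H , proj₂ (∈-filter⁻ Q? {xs = allGraphs n} H∈) , sym max≡

module _ {n : ℕ} (k : ℕ) where

  PathFreeOuterplanar : Graph n → Set
  PathFreeOuterplanar G = P k -Free G × Outerplanar G

  SmallComponents : Graph n → Set
  SmallComponents G = ∀ u → length (component G u) ≤ k ∸ 1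

  pathFreeOuterplanar? : Pred.Decidable PathFreeOuterplanar
  pathFreeOuterplanar? G = ¬? (contains? (P k) G) ×-dec outerplanar? G

  smallComponents? : Pred.Decidable SmallComponents
  smallComponents? G = Fin.all? λ u → length (component G u) ≤? k ∸ 1

ex : ℕ → ℕ → ℕ
ex n k = maxSize {n} {PathFreeOuterplanar k} (pathFreeOuterplanar? k)

ex′ : ℕ → ℕ → ℕ
ex′ n k = maxSize {n} {λ G → PathFreeOuterplanar k G × IsConnected G}
  (λ G → pathFreeOuterplanar? k G ×-dec isConnected? G)

ex″ : ℕ → ℕ → ℕ
ex″ n k = maxSize {n} {λ G → PathFreeOuterplanar k G × SmallComponents k G}
  (λ G → pathFreeOuterplanar? k G ×-dec smallComponents? k G)

-- Let G be a P_k-free outerplanar graph with a component of at least k vertices,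
-- and write k = 2 + d + e with d ≤ e ≤ d + 1.  The outer walk of a component with a
-- vertices, of length l, satisfies l ≥ a when a < k.  When a ≥ k the walk is not a
-- simple cycle, and removing simple cycles from it one at a time, while two cycles
-- through a common vertex cannot both be long, gives (d + 1) a ≤ d l + e + 1.
-- All other faces have length at least 3, so Euler's formula bounds the number of
-- edges of G in terms of the lengths l, hence in terms of n.  For k ≠ 5 some
-- connected graph has at least that many edges, namely a fan whose rim is broken
-- into one path with e vertices and paths with d vertices.  For k = 5 this holds
-- for disjoint copies of K₄ minus an edge, the last of which may be incomplete.
module Submission where

open import Defs
open import Data.Empty using (⊥-elim)
open import Data.Fin using (Fin; zero; suc; toℕ; fromℕ<)
import Data.Fin as Fin using (_<_; inject≤)
import Data.Fin.Properties as Fin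
import Data.Fin.Subset as Subset
import Data.Fin.Subset.Properties as Subset
open import Data.List
  using (List; []; _∷_; [_]; _++_; length; map; filter; concatMap; lookup; allFin; deduplicate; applyUpTo; upTo)
open import Data.List.Membership.Propositional using (_∈_; _∉_)
open import Data.List.Membership.Propositional.Properties
  using (∈-++⁺ˡ; ∈-++⁺ʳ; ∈-++⁻; ∈-∃++; ∈-filter⁺; ∈-filter⁻; ∈-map⁺; ∈-map⁻; ∈-allFin; ∈-lookup;
         ∈-length; ∈-concat⁺′; ∈-concat⁻′; ∈-cartesianProduct⁺; ∈-applyUpTo⁺; ∈-applyUpTo⁻; ∈-upTo⁺; ∈-upTo⁻)
open import Data.List.Extrema.Nat using (max≤v⁺)
import Data.List as List using (tabulate)
import Data.List.Properties as List
open import Data.Nat.ListAction using (sum)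
open import Data.List.Relation.Binary.Permutation.Propositional
  using (_↭_; ↭-refl; ↭-sym; ↭-trans; ↭-reflexive; ↭⇒↭ₛ)
open import Data.List.Relation.Binary.Permutation.Propositional.Properties
  using (∈-resp-↭; ↭-length; ++-comm)
import Data.List.Relation.Binary.Permutation.Setoid.Properties as PermSetoid
open import Data.List.Relation.Unary.All as All using (All; []; _∷_)
import Data.List.Relation.Unary.All.Properties as All
open import Data.List.Relation.Unary.AllPairs as AllPairs using (AllPairs; []; _∷_)
import Data.List.Relation.Unary.AllPairs.Properties as AllPairs
open import Data.List.Relation.Unary.Any using (here; there)
open import Data.List.Relation.Unary.Linked as Linked using (Linked; []; [-]; _∷_)
open import Data.List.Relation.Unary.Unique.Propositional using (Unique)
import Data.List.Relation.Unary.Unique.Propositional.Properties as Unique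
open import Data.Nat
  using (ℕ; zero; suc; pred; _+_; _*_; _∸_; _/_; _≤_; _<_; _≥_; _⊔_; z≤n; s≤s; _≤?_; _<?_; NonZero; >-nonZero)
import Data.Nat.DivMod as ℕ
import Data.Nat.Properties as ℕ
open import Data.Nat.Tactic.RingSolver using (solve-∀)
open import Data.Product using (Σ; ∃-syntax; ∃₂; _×_; _,_; proj₁; proj₂)
import Data.Product as Product using (swap)
import Data.Product.Properties as Product
open import Data.Bool using (if_then_else_)
open import Data.Vec as Vec using (Vec; tabulate)
import Data.Vec.Properties as Vec
open import Data.Sum using (_⊎_; inj₁; inj₂)
open import Function using (_∘_; id; Injective)
open import Level using (0ℓ)
open import Relation.Binary using (Rel; Decidable; DecidableEquality; tri<; tri≈; tri>)
open import Relation.Binary.Construct.Closure.ReflexiveTransitive using (Star; ε; _◅_; _◅◅_)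
open import Relation.Binary.PropositionalEquality
  using (_≡_; _≢_; refl; sym; trans; cong; cong₂; subst; subst₂; setoid; module ≡-Reasoning)
open import Relation.Nullary using (¬_; Dec; yes; no; does; contradiction)
open import Relation.Nullary.Decidable using (decidable-stable; map′; dec-true; dec-false; ¬?; _×-dec_; _⊎-dec_)
import Relation.Unary as Pred

-- The walk inequality is tight for the fans of the overview: a path with `d` vertices lengthens the
-- outer walk by `d + 1`, the one with `e` vertices by `e + 1`. So the bound from Euler's formula
-- exceeds the size of the fan, whose last path may be incomplete, by less than one edge, and
-- integrality does the rest. This leaves no slack: a large component must save exactly
-- `3 d - (e + 1)` in the sum over the components, and no other component may lose anything. A
-- component with `a < k` vertices and `a ≤ l` loses nothing if `a ≤ 3 d`. For `a = 1 + d + e` and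
-- `k ≥ 4` this fails exactly when `k = 5`, where K₄ minus an edge violates the inequality; hence
-- the different competitor and weights there.
--
-- The obstacle in the walk inequality is that a removed cycle may meet the rest of the walk in many
-- vertices. Each such vertex adds to the length but not to the number of vertices visited, and
-- thereby pays for up to `d` vertices met only on the removed cycle.

open Graph using (Adj; adj?; Connected; connected?; size; component)

-- Lists without repetitions

module _ {A : Set} where

  unique-++⁻ˡ : ∀ (xs : List A) {ys} → Unique (xs ++ ys) → Unique xs
  unique-++⁻ˡ []       _       = []
  unique-++⁻ˡ (x ∷ xs) (p ∷ u) = All.++⁻ˡ xs p ∷ unique-++⁻ˡ xs u

  unique-++⁻ʳ : ∀ (xs : List A) {ys} → Unique (xs ++ ys) → Unique ys
  unique-++⁻ʳ []       u       = u
  unique-++⁻ʳ (x ∷ xs) (_ ∷ u) = unique-++⁻ʳ xs u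

  unique-++-disjoint : ∀ (xs : List A) {ys x} → Unique (xs ++ ys) → x ∈ xs → ¬ x ∈ ys
  unique-++-disjoint (x ∷ xs) (p ∷ u) (here refl) m = All.lookup (All.++⁻ʳ xs p) m refl
  unique-++-disjoint (x ∷ xs) (p ∷ u) (there m)   = unique-++-disjoint xs u m

  unique-∷⁺ : ∀ {x : A} {xs} → x ∉ xs → Unique xs → Unique (x ∷ xs)
  unique-∷⁺ x∉ u = All.tabulate (λ { m refl → x∉ m }) ∷ u

  unique-∷⁻ : ∀ {x : A} {xs} → Unique (x ∷ xs) → x ∉ xs
  unique-∷⁻ (p ∷ _) m = All.lookup p m refl

  unique-resp-↭ : ∀ {xs ys : List A} → xs ↭ ys → Unique xs → Unique ys
  unique-resp-↭ p = PermSetoid.Unique-resp-↭ (setoid A) (↭⇒↭ₛ p)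

  ∈-++-∷⁻ : ∀ (as : List A) {b bs x} → x ∈ as ++ b ∷ bs → x ≢ b → x ∈ as ++ bs
  ∈-++-∷⁻ as m x≢b with ∈-++⁻ as m
  ... | inj₁ m′          = ∈-++⁺ˡ m′
  ... | inj₂ (here refl) = contradiction refl x≢b
  ... | inj₂ (there m′)  = ∈-++⁺ʳ as m′

  unique-length-≤ : ∀ {xs ys : List A} → Unique xs → (∀ {x} → x ∈ xs → x ∈ ys) →
                    length xs ≤ length ys
  unique-length-≤ []                      _   = z≤n
  unique-length-≤ {x ∷ xs} (x∉ ∷ u) sub with ∈-∃++ (sub (here refl))
  ... | as , bs , refl = subst (suc (length xs) ≤_) (sym (List.length-++-sucʳ as x bs))
    (s≤s (unique-length-≤ u λ m → ∈-++-∷⁻ as (sub (there m)) λ { refl → All.lookup x∉ m refl }))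

  module _ {P : A → Set} (P? : Pred.Decidable P) where

    length-filter-¬ : ∀ xs → length (filter P? xs) + length (filter (¬? ∘ P?) xs) ≡ length xs
    length-filter-¬ []       = refl
    length-filter-¬ (x ∷ xs) with P? x
    ... | yes _ = cong suc (length-filter-¬ xs)
    ... | no  _ = trans (ℕ.+-suc _ _) (cong suc (length-filter-¬ xs))

    filter-prefix : ∀ xs → All P xs ⊎ ∃[ as ] ∃[ b ] ∃[ bs ] xs ≡ as ++ b ∷ bs × All P as × ¬ P b
    filter-prefix []       = inj₁ []
    filter-prefix (x ∷ xs) with P? x | filter-prefix xs
    ... | no ¬p | _                                  = inj₂ ([] , x , xs , refl , [] , ¬p)
    ... | yes p | inj₁ ps                            = inj₁ (p ∷ ps)
    ... | yes p | inj₂ (as , b , bs , refl , ps , q) = inj₂ (x ∷ as , b , bs , refl , p ∷ ps , q)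

  module _ (_≟_ : DecidableEquality A) where

    open import Data.List.Membership.DecPropositional _≟_ using (_∈?_)
    open import Data.List.Relation.Unary.Unique.DecPropositional _≟_ using (unique?)

    -- Descending as long as the tail still has a repetition ends at the last element that occurs
    -- again. Nothing after it recurs, so the stretch up to its second occurrence is free of
    -- repetitions; in a closed walk it is a simple cycle.
    firstRepeat : ∀ {xs : List A} → ¬ Unique xs →
      ∃[ as ] ∃[ x ] ∃[ zs ] ∃[ bs ] xs ≡ as ++ x ∷ zs ++ x ∷ bs × Unique (x ∷ zs)
    firstRepeat {[]}     ¬u = contradiction [] ¬u
    firstRepeat {x ∷ xs} ¬u with unique? xs
    ... | no ¬u′ with firstRepeat ¬u′
    ...   | as , y , zs , bs , refl , u = x ∷ as , y , zs , bs , refl , u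
    firstRepeat {x ∷ xs} ¬u | yes u with x ∈? xs
    ...   | no x∉  = contradiction (unique-∷⁺ x∉ u) ¬u
    ...   | yes x∈ with ∈-∃++ x∈
    ...     | zs , bs , refl = [] , x , zs , bs , refl ,
              unique-∷⁺ (λ m → unique-++-disjoint zs u m (here refl)) (unique-++⁻ˡ zs u)

-- Walks

module Walks {A : Set} (_≟_ : DecidableEquality A)
             {R : Rel A 0ℓ} (R-sym : ∀ {x y} → R x y → R y x) (R-irrefl : ∀ {x} → ¬ R x x) where

  open import Data.List.Membership.DecPropositional _≟_ using (_∈?_)
  open import Data.List.Relation.Unary.Unique.DecPropositional _≟_ using (unique?)

  infixr 5 _∷_

  -- The list consists of the intermediate vertices only.
  data Walk : A → List A → A → Set where
    edge : ∀ {x y} → R x y → Walk x [] y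
    _∷_  : ∀ {x z y us} → R x z → Walk z us y → Walk x (z ∷ us) y

  infixr 5 _⊕_

  _⊕_ : ∀ {x us y vs z} → Walk x us y → Walk y vs z → Walk x (us ++ y ∷ vs) z
  edge r  ⊕ q = r ∷ q
  (r ∷ p) ⊕ q = r ∷ (p ⊕ q)

  split : ∀ {x z} us {y vs} → Walk x (us ++ y ∷ vs) z → Walk x us y × Walk y vs z
  split []       (r ∷ q) = edge r , q
  split (u ∷ us) (r ∷ w) with split us w
  ... | p , q = r ∷ p , q

  linked-⊕ : ∀ {x us y vs} → Walk x us y → Linked R (y ∷ vs) → Linked R (x ∷ us ++ y ∷ vs)
  linked-⊕ (edge r) l = r ∷ l
  linked-⊕ (r ∷ p)  l = r ∷ linked-⊕ p l

  linked : ∀ {x us y} → Walk x us y → Linked R (x ∷ us)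
  linked (edge r) = [-]
  linked (r ∷ p)  = r ∷ linked p

  rotate : ∀ {c cs x} → Walk c cs c → x ∈ c ∷ cs → ∃[ t ] Walk x t x × x ∷ t ↭ c ∷ cs
  rotate {cs = cs} p (here refl) = cs , p , ↭-refl
  rotate {c} {x = x} p (there m) with ∈-∃++ m
  ... | as , bs , refl with split as p
  ...   | q , r = bs ++ c ∷ as , r ⊕ q ,
    ++-comm (x ∷ bs) (c ∷ as)

  -- What remains after cutting out the cycle at `c` is closed up and based at `c`, the vertex it
  -- shares with the cycle. Up to permutation the visits are split between the two, which suffices
  -- for counting lengths and vertices. An edge traversed back and forth counts as a cycle.
  popCycle : ∀ {x us} → Walk x us x → ¬ Unique (x ∷ us) →
    ∃[ c ] ∃[ cs ] ∃[ rest ] Walk c cs c × Unique (c ∷ cs) × Walk c rest c ×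
      x ∷ us ↭ (c ∷ cs) ++ c ∷ rest
  popCycle w ¬u with firstRepeat _≟_ ¬u
  ... | [] , c , cs , bs , refl , u with split cs w
  ...   | p , q = c , cs , bs , p , u , q , ↭-refl
  popCycle w ¬u | x ∷ as , c , cs , bs , refl , u with split as w
  ...   | a , p with split cs p
  ...     | p₁ , p₂ = c , cs , bs ++ x ∷ as , p₁ , u , p₂ ⊕ a ,
    ↭-trans (++-comm (x ∷ as) (c ∷ cs ++ c ∷ bs))
            (↭-reflexive (cong (c ∷_) (List.++-assoc cs (c ∷ bs) (x ∷ as))))

  -- A walk to the set C contains a simple path that ends where it first meets C.
  approach : ∀ C {x us y} → y ∈ C → Walk x us y →
             x ∈ C ⊎ ∃₂ λ vs z → z ∈ C × Walk x vs z × Unique (x ∷ vs) × All (_∉ C) (x ∷ vs) ×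
                                 (∀ {v} → v ∈ vs → v ∈ us)
  approach C {x} y∈C w with x ∈? C
  ... | yes x∈C = inj₁ x∈C
  approach C y∈C (edge r) | no x∉C = inj₂ ([] , _ , y∈C , edge r , [] ∷ [] , x∉C ∷ [] , λ ())
  approach C {x} y∈C (_∷_ {z = z} r w) | no x∉C with approach C y∈C w
  ... | inj₁ z∈C = inj₂ ([] , z , z∈C , edge r , [] ∷ [] , x∉C ∷ [] , λ ())
  ... | inj₂ (vs , z′ , z′∈C , w′ , u , ∉C , sub) with x ∈? (z ∷ vs)
  ...   | no x∉ = inj₂ (z ∷ vs , z′ , z′∈C , r ∷ w′ , unique-∷⁺ x∉ u , x∉C ∷ ∉C ,
                        λ { (here e) → here e ; (there m) → there (sub m) })
  ...   | yes (here refl) = contradiction r R-irrefl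
  -- The simple path found from `z` returns to `x`: the loop is dropped and only the part after that
  -- visit is kept.
  ...   | yes (there m) with ∈-∃++ m
  ...     | as , bs , refl = inj₂ (bs , z′ , z′∈C , proj₂ (split as w′) ,
              unique-++⁻ʳ (z ∷ as) u , All.++⁻ʳ (z ∷ as) ∉C ,
              λ m′ → there (sub (∈-++⁺ʳ as (there m′))))

  -- A simple path from x followed by a tour of the simple cycle c ∷ cs.
  lasso : ∀ {x us c cs} → Walk c cs c → Unique (c ∷ cs) → x ≡ c ⊎ Walk x us c →
    ∃[ l ] Linked R (x ∷ l) × Unique (x ∷ l) × length (c ∷ cs) ≤ length (x ∷ l) ×
      (∀ {v} → v ∈ x ∷ l → v ≡ x ⊎ v ∈ us ⊎ v ∈ c ∷ cs)
  lasso {c = c} {cs} p u (inj₁ refl) = cs , linked p , u , ℕ.≤-refl , λ m → inj₂ (inj₂ m)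
  lasso {x} {c = c} {cs} p u (inj₂ w) with approach (c ∷ cs) (here refl) w
  ... | inj₁ x∈ with rotate p x∈
  ...   | t , q , pm = t , linked q , unique-resp-↭ (↭-sym pm) u , ℕ.≤-reflexive (sym (↭-length pm)) ,
                       λ m → inj₂ (inj₂ (∈-resp-↭ pm m))
  lasso {x} {c = c} {cs} p u (inj₂ w) | inj₂ (vs , z , z∈ , w′ , u′ , ∉C , sub) with rotate p z∈
  ...   | t , q , pm = vs ++ z ∷ t , linked-⊕ w′ (linked q) ,
          Unique.++⁺ u′ (unique-resp-↭ (↭-sym pm) u)
            (λ { (m , m′) → All.lookup ∉C m (∈-resp-↭ pm m′) }) ,
          subst (_≤ suc (length (vs ++ z ∷ t))) (↭-length pm) (ℕ.m≤n⇒m≤1+n (List.length-++-≤ʳ (z ∷ t) {vs})) ,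
          located
    where
    located : ∀ {v} → v ∈ x ∷ vs ++ z ∷ t → v ≡ x ⊎ v ∈ _ ⊎ v ∈ c ∷ cs
    located (here e)  = inj₁ e
    located (there m) with ∈-++⁻ vs m
    ... | inj₁ m′ = inj₂ (inj₁ (sub m′))
    ... | inj₂ m′ = inj₂ (inj₂ (∈-resp-↭ pm m′))

-- If every simple cycle in a graph has length at most q + 1, a closed walk of
-- length ℓ visits at most (q ℓ + q + 1) / (q + 1) vertices.  When no path has more
-- than d + e + 1 vertices, a closed walk that is not a simple cycle satisfies such a
-- bound with q = d: two cycles through a common vertex cannot both be longer.
module PathFree
  {A : Set} (_≟_ : DecidableEquality A)
  {R : Rel A 0ℓ} (R-sym : ∀ {x y} → R x y → R y x) (R-irrefl : ∀ {x} → ¬ R x x)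
  (d e : ℕ) (e≤1+d : e ≤ suc d)
  (short : ∀ {xs} → Linked R xs → Unique xs → length xs ≤ suc (d + e))
  where

  open import Data.List.Membership.DecPropositional _≟_ using (_∈?_)
  open import Data.List.Relation.Unary.Unique.DecPropositional _≟_ using (unique?)
  open Walks _≟_ {R = R} (λ {x} {y} → R-sym {x} {y}) (λ {x} → R-irrefl {x})

  private
    infix 4 _⊆_
    _⊆_ : List A → List A → Set
    xs ⊆ ys = ∀ {x} → x ∈ xs → x ∈ ys

    old new : List A → List A → List A
    old S = filter (_∈? S)
    new S = filter (¬? ∘ (_∈? S))

    -- A vertex missing from the rest must lie on the popped cycle. The vertex `c` belongs to both
    -- and is counted with the rest, so only `cs` can supply new vertices.
    visited-bound : ∀ {V c cs rest us} → Unique V → V ⊆ us → us ↭ (c ∷ cs) ++ c ∷ rest →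
      length V ≤ length (old (c ∷ rest) V) + length (new (c ∷ rest) cs)
    visited-bound {V} {c} {cs} {rest} uV V⊆ pm = begin
      length V                                                    ≡⟨ sym (length-filter-¬ (_∈? S) V) ⟩
      length (old S V) + length (new S V)                         ≤⟨ ℕ.+-monoʳ-≤ _ (unique-length-≤ (Unique.filter⁺ _ uV) new⊆) ⟩
      length (old S V) + length (new S cs)                        ∎
      where
      open ℕ.≤-Reasoning
      S = c ∷ rest
      new⊆ : new S V ⊆ new S cs
      new⊆ m with ∈-filter⁻ (¬? ∘ (_∈? S)) {xs = V} m
      ... | m′ , ∉S with ∈-++⁻ (c ∷ cs) (∈-resp-↭ pm (V⊆ m′))
      ...   | inj₁ (here refl) = contradiction (here refl) ∉S
      ...   | inj₁ (there m″)  = ∈-filter⁺ (¬? ∘ (_∈? S)) m″ ∉S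
      ...   | inj₂ m″          = contradiction m″ ∉S

    old⊆ : ∀ S V → old S V ⊆ S
    old⊆ S V m = proj₂ (∈-filter⁻ (_∈? S) {xs = V} m)

    popped-length : ∀ {x : A} {us c cs rest} → x ∷ us ↭ (c ∷ cs) ++ c ∷ rest →
                    suc (length us) ≡ suc (length cs) + suc (length rest)
    popped-length {cs = cs} pm = trans (↭-length pm) (cong suc (List.length-++ cs))

    rest-shorter : ∀ {x : A} {us c cs rest m} → x ∷ us ↭ (c ∷ cs) ++ c ∷ rest →
                   length us < suc m → length rest < m
    rest-shorter {us = us} {cs = cs} {rest = rest} {m} pm (s≤s us≤m) = ℕ.≤-trans (begin
      suc (length rest)                     ≤⟨ ℕ.m≤n+m _ (length cs) ⟩
      length cs + suc (length rest)         ≡⟨ sym (ℕ.suc-injective (popped-length pm)) ⟩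
      length us                             ∎) us≤m
      where open ℕ.≤-Reasoning

    rest⊆ : ∀ {us S : List A} {c cs rest} → us ↭ (c ∷ cs) ++ c ∷ rest → us ⊆ S → c ∷ rest ⊆ S
    rest⊆ {c = c} {cs} pm us⊆ m = us⊆ (∈-resp-↭ (↭-sym pm) (∈-++⁺ʳ (c ∷ cs) m))

  -- Induction by popping cycles. A simple cycle has at most `q + 1` vertices and no more than its
  -- length. A popped cycle adds `n ≤ length cs ≤ q` new vertices, and `n + q n` is at most `q`
  -- times the length of the cycle. The set `S` confines the hypothesis to cycles on the vertices of
  -- the given walk, the only ones for which a bound will be known.
  shortCycles : ∀ q S →
    (∀ {c cs} → Walk c cs c → Unique (c ∷ cs) → c ∷ cs ⊆ S → length cs ≤ q) →
    ∀ m {x us} → length us < m → Walk x us x → x ∷ us ⊆ S →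
    ∀ {V} → Unique V → V ⊆ x ∷ us →
    suc q * length V ≤ q * suc (length us) + suc q
  shortCycles q S cyc (suc m) {x} {us} us<m w us⊆ {V} uV V⊆ with unique? (x ∷ us)
  ... | yes u = subst (suc q * v ≤_) (ℕ.+-comm (suc q) (q * l))
                  (ℕ.+-mono-≤ (ℕ.≤-trans v≤l (s≤s (cyc w u us⊆))) (ℕ.*-monoʳ-≤ q v≤l))
    where
    v = length V
    l = suc (length us)
    v≤l : v ≤ l
    v≤l = unique-length-≤ uV V⊆
  ... | no ¬u with popCycle w ¬u
  ...   | c , cs , rest , p , u , w′ , pm = begin
    suc q * length V                                         ≤⟨ ℕ.*-monoʳ-≤ (suc q) V≤ ⟩
    suc q * (v′ + n)                                         ≡⟨ ℕ.*-distribˡ-+ (suc q) v′ n ⟩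
    suc q * v′ + (n + q * n)                                 ≤⟨ ℕ.+-mono-≤ ih (ℕ.+-mono-≤ n≤q (ℕ.*-monoʳ-≤ q n≤)) ⟩
    (q * suc (length rest) + suc q) + (q + q * length cs)    ≡⟨ rearrange q (length rest) (length cs) ⟩
    q * (suc (length cs) + suc (length rest)) + suc q        ≡⟨ cong (λ l → q * l + suc q) (sym (popped-length pm)) ⟩
    q * suc (length us) + suc q                              ∎
    where
    open ℕ.≤-Reasoning
    v′ = length (old (c ∷ rest) V)
    n  = length (new (c ∷ rest) cs)
    V≤ : length V ≤ v′ + n
    V≤ = visited-bound uV V⊆ pm
    ih : suc q * v′ ≤ q * suc (length rest) + suc q
    ih = shortCycles q S cyc m (rest-shorter pm us<m) w′ (rest⊆ pm us⊆) (Unique.filter⁺ _ uV) (old⊆ _ V)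
    n≤ : n ≤ length cs
    n≤ = List.length-filter _ cs
    n≤q : n ≤ q
    n≤q = ℕ.≤-trans n≤ (cyc p u (λ z → us⊆ (∈-resp-↭ (↭-sym pm) (∈-++⁺ˡ z))))
    rearrange : ∀ q r c → (q * suc r + suc q) + (q + q * c) ≡ q * (suc c + suc r) + suc q
    rearrange = solve-∀

  -- A path leaving the simple cycle c ∷ rest extends a tour of that cycle.
  newRun≤ : ∀ {q c rest w r} → Walk c rest c → Unique (c ∷ rest) → q + suc (length rest) ≡ suc (d + e) →
    w ∈ c ∷ rest → Linked R (w ∷ r) → Unique r → All (_∉ c ∷ rest) r → length r ≤ q
  newRun≤ {q} {c} {rest} {w} {r} p u q≡ w∈ l ur new with rotate p w∈
  ... | t , p′ , pm = ℕ.+-cancelʳ-≤ (suc (length rest)) (length r) q (begin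
    length r + suc (length rest)     ≡⟨ cong (length r +_) (sym (↭-length pm)) ⟩
    length r + suc (length t)        ≡⟨ swap (length r) (length t) ⟩
    length t + suc (length r)        ≡⟨ sym (List.length-++ t) ⟩
    length (t ++ w ∷ r)              ≤⟨ short (Linked.tail (linked-⊕ p′ l)) distinct ⟩
    suc (d + e)                      ≡⟨ sym q≡ ⟩
    q + suc (length rest)            ∎)
    where
    open ℕ.≤-Reasoning
    swap : ∀ r t → r + suc t ≡ t + suc r
    swap = solve-∀
    ut : Unique (w ∷ t)
    ut = unique-resp-↭ (↭-sym pm) u
    distinct : Unique (t ++ w ∷ r)
    distinct = Unique.++⁺ (AllPairs.tail ut)
      (unique-∷⁺ (λ m → All.lookup new m w∈) ur)
      λ { (m , here refl) → unique-∷⁻ ut m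
        ; (m , there m′)  → All.lookup new m′ (∈-resp-↭ pm (there m)) }

  -- The vertices of `zs` on the cycle cut it into runs of new vertices, one more than there are
  -- cuts. Each run leaves the cycle at the vertex before it, so `newRun≤` limits it to `q`
  -- vertices.
  newRuns≤ : ∀ {q c rest} → Walk c rest c → Unique (c ∷ rest) → q + suc (length rest) ≡ suc (d + e) →
    ∀ m {zs w y} → length zs < m → w ∈ c ∷ rest → Walk w zs y → Unique zs →
    length (new (c ∷ rest) zs) ≤ q * suc (length (old (c ∷ rest) zs))
  newRuns≤ {q} {c} {rest} p u q≡ (suc m) {zs} {w} (s≤s zs≤m) w∈ wk uz
    with filter-prefix (¬? ∘ (_∈? (c ∷ rest))) zs
  ... | inj₁ all-new = begin
    length (new (c ∷ rest) zs)              ≤⟨ List.length-filter _ zs ⟩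
    length zs                               ≤⟨ newRun≤ p u q≡ w∈ (linked wk) uz all-new ⟩
    q                                       ≤⟨ ℕ.m≤m*n q (suc (length (old (c ∷ rest) zs))) ⟩
    q * suc (length (old (c ∷ rest) zs))    ∎
    where open ℕ.≤-Reasoning
  ... | inj₂ (as , b , bs , refl , as-new , ¬b-new) = begin
    length (new S (as ++ b ∷ bs))                      ≡⟨ cong length (List.filter-++ _ as (b ∷ bs)) ⟩
    length (new S as ++ new S (b ∷ bs))                ≡⟨ List.length-++ (new S as) ⟩
    length (new S as) + length (new S (b ∷ bs))        ≡⟨ cong (λ l → length (new S as) + length l) (List.filter-reject _ {xs = bs} ¬b-new) ⟩
    length (new S as) + length (new S bs)              ≤⟨ ℕ.+-mono-≤ first
                                                            (newRuns≤ p u q≡ m (ℕ.≤-trans shorter zs≤m) b∈ (proj₂ w′) (unique-++⁻ʳ (as ++ [ b ]) uz′)) ⟩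
    q + q * suc (length (old S bs))                    ≡⟨ sym (ℕ.*-suc q _) ⟩
    q * suc (suc (length (old S bs)))                  ≤⟨ ℕ.*-monoʳ-≤ q (s≤s more) ⟩
    q * suc (length (old S (as ++ b ∷ bs)))            ∎
    where
    open ℕ.≤-Reasoning
    S = c ∷ rest
    b∈ : b ∈ S
    b∈ = decidable-stable (b ∈? S) ¬b-new
    w′ = split as wk
    uz′ : Unique ((as ++ [ b ]) ++ bs)
    uz′ = subst Unique (sym (List.++-assoc as [ b ] bs)) uz
    shorter : suc (length bs) ≤ length (as ++ b ∷ bs)
    shorter = List.length-++-≤ʳ (b ∷ bs) {as}
    first : length (new S as) ≤ q
    first = ℕ.≤-trans (List.length-filter _ as)
              (newRun≤ p u q≡ w∈ (linked (proj₁ w′)) (unique-++⁻ˡ as uz) as-new)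
    more : suc (length (old S bs)) ≤ length (old S (as ++ b ∷ bs))
    more = begin
      suc (length (old S bs))                   ≡⟨ cong length (sym (List.filter-accept (_∈? S) {xs = bs} b∈)) ⟩
      length (old S (b ∷ bs))                   ≤⟨ List.length-++-≤ʳ _ {old S as} ⟩
      length (old S as ++ old S (b ∷ bs))       ≡⟨ cong length (sym (List.filter-++ (_∈? S) as (b ∷ bs))) ⟩
      length (old S (as ++ b ∷ bs))             ∎

  -- If the popped cycle c ∷ cs only meets the rest of the walk in c, then cs can
  -- be prepended to a lasso around any simple cycle in the rest.
  cycle-in-rest≤ : ∀ {c cs rest} → Walk c cs c → Unique (c ∷ cs) → Walk c rest c →
    (∀ {x} → x ∈ cs → x ∉ c ∷ rest) →
    ∀ {y ys} → Walk y ys y → Unique (y ∷ ys) → y ∷ ys ⊆ c ∷ rest →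
    length cs + suc (length ys) ≤ suc (d + e)
  cycle-in-rest≤ {c} {cs} {rest} p u w fresh {y} {ys} p′ u′ ys⊆ = begin
    length cs + suc (length ys)       ≤⟨ ℕ.+-monoʳ-≤ (length cs) (proj₁ (proj₂ (proj₂ (proj₂ la)))) ⟩
    length cs + suc (length l)        ≡⟨ sym (List.length-++ cs) ⟩
    length (cs ++ c ∷ l)              ≤⟨ short (Linked.tail (linked-⊕ p (proj₁ (proj₂ la)))) distinct ⟩
    suc (d + e)                       ∎
    where
    open ℕ.≤-Reasoning
    access : y ∈ c ∷ rest → ∃[ us ] (c ≡ y ⊎ Walk c us y) × us ⊆ c ∷ rest
    access (here refl) = [] , inj₁ refl , λ ()
    access (there m) with ∈-∃++ m
    ... | as , bs , refl = as , inj₂ (proj₁ (split as w)) , λ m′ → there (∈-++⁺ˡ m′)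
    ac = access (ys⊆ (here refl))
    la = lasso p′ u′ (proj₁ (proj₂ ac))
    l  = proj₁ la
    l⊆ : c ∷ l ⊆ c ∷ rest
    l⊆ m with proj₂ (proj₂ (proj₂ (proj₂ la))) m
    ... | inj₁ refl      = here refl
    ... | inj₂ (inj₁ m′) = proj₂ (proj₂ ac) m′
    ... | inj₂ (inj₂ m′) = ys⊆ m′
    distinct : Unique (cs ++ c ∷ l)
    distinct = Unique.++⁺ (AllPairs.tail u) (proj₁ (proj₂ (proj₂ la))) λ { (m , m′) → fresh m (l⊆ m′) }

  -- Induction by popping a cycle `c ∷ cs`, of which `s` vertices other than `c` occur in the rest
  -- and `n` do not. For `s = 0` the cycle and the rest share only `c`, and long paths run from one
  -- into the other. For `s > 0` the shared vertices pay for the new ones. The rest may be a simple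
  -- cycle, to which the induction hypothesis does not apply.
  closedWalk≤ : ∀ m {x us} → length us < m → Walk x us x → ¬ Unique (x ∷ us) →
    ∀ {V} → Unique V → V ⊆ x ∷ us →
    suc d * length V ≤ d * suc (length us) + suc e
  closedWalk≤ (suc m) {x} {us} us<m wk ¬u {V} uV V⊆ with popCycle wk ¬u
  ... | c , cs , rest , p , u , w , pm = begin
    suc d * length V                                  ≤⟨ ℕ.*-monoʳ-≤ (suc d) (visited-bound uV V⊆ pm) ⟩
    suc d * (v + n)                                   ≤⟨ core (s ℕ.≟ 0) (unique? S) ⟩
    d * (suc (s + n) + l) + suc e                     ≡⟨ cong (λ k → d * (suc k + l) + suc e) (length-filter-¬ (_∈? S) cs) ⟩
    d * (suc (length cs) + l) + suc e                 ≡⟨ cong (λ k → d * k + suc e) (sym (popped-length pm)) ⟩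
    d * suc (length us) + suc e                       ∎
    where
    open ℕ.≤-Reasoning
    S = c ∷ rest
    l = suc (length rest)
    s = length (old S cs)
    n = length (new S cs)
    v = length (old S V)
    uV′ : Unique (old S V)
    uV′ = Unique.filter⁺ _ uV
    v≤l : v ≤ l
    v≤l = unique-length-≤ uV′ (old⊆ S V)
    s+n≤ : s + n ≤ d + e
    s+n≤ = subst (_≤ d + e) (sym (length-filter-¬ (_∈? S) cs)) (ℕ.≤-pred (short (linked p) u))
    -- A simple cycle has at most `d + e ≤ 2 d + 1` vertices besides `c`, and one of them is old.
    n≤2d : s ≢ 0 → n ≤ d * 2
    n≤2d s≢0 = ℕ.≤-pred (begin
      suc n            ≤⟨ ℕ.+-monoˡ-≤ n (ℕ.n≢0⇒n>0 s≢0) ⟩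
      s + n            ≤⟨ s+n≤ ⟩
      d + e            ≤⟨ ℕ.+-monoʳ-≤ d e≤1+d ⟩
      d + suc d        ≡⟨ double d ⟩
      suc (d * 2)      ∎)
      where
      double : ∀ d → d + suc d ≡ suc (d * 2)
      double = solve-∀
    ih : ¬ Unique S → suc d * v ≤ d * l + suc e
    ih ¬u′ = closedWalk≤ m (rest-shorter pm us<m) w ¬u′ uV′ (old⊆ S V)

    -- The room left by the popped cycle: when it shares only `c` with the rest, every simple cycle
    -- in the rest has at most `q + 1` vertices.
    q = d + e ∸ n
    q+n : q + n ≡ d + e
    q+n = ℕ.m∸n+n≡m (ℕ.≤-trans (ℕ.m≤n+m n s) s+n≤)

    module _ (s≡0 : s ≡ 0) where
      fresh : ∀ {y} → y ∈ cs → y ∉ S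
      fresh y∈ y∈S = ℕ.n≮0 (subst (0 <_) s≡0 (∈-length (∈-filter⁺ (_∈? S) y∈ y∈S)))
      cs≡n : length cs ≡ n
      cs≡n = trans (sym (length-filter-¬ (_∈? S) cs)) (cong (_+ n) s≡0)
      cyc : ∀ {y ys} → Walk y ys y → Unique (y ∷ ys) → y ∷ ys ⊆ S → length ys ≤ q
      cyc {y} {ys} p′ u′ ys⊆ = ℕ.+-cancelʳ-≤ (suc n) (length ys) q (begin
        length ys + suc n             ≡⟨ ℕ.+-comm (length ys) (suc n) ⟩
        suc n + length ys             ≡⟨ sym (ℕ.+-suc n (length ys)) ⟩
        n + suc (length ys)           ≡⟨ cong (_+ suc (length ys)) (sym cs≡n) ⟩
        length cs + suc (length ys)   ≤⟨ cycle-in-rest≤ p u w fresh p′ u′ ys⊆ ⟩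
        suc (d + e)                   ≡⟨ cong suc (sym q+n) ⟩
        suc (q + n)                   ≡⟨ sym (ℕ.+-suc q n) ⟩
        q + suc n                     ∎)

      -- If `q ≤ d`, all cycles of the rest are short, and adding `d - q` times `v ≤ l` raises the
      -- factor from `q` to `d`. If `q > d`, then `e ≤ d + 1 ≤ q`, so the induction hypothesis is
      -- strong enough; a simple rest has `v ≤ q + 1` directly.
      bound : Dec (Unique S) → suc d * v ≤ d * l + suc q
      bound du with q ≤? d
      ... | yes q≤d = subst (λ d → suc d * v ≤ d * l + suc q) (ℕ.m+[n∸m]≡n q≤d) (begin
              suc (q + t) * v                 ≡⟨ rearrange t v q ⟩
              suc q * v + t * v               ≤⟨ ℕ.+-mono-≤ (shortCycles q S cyc l ℕ.≤-refl w id uV′ (old⊆ S V))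
                                                             (ℕ.*-monoʳ-≤ t v≤l) ⟩
              (q * l + suc q) + t * l         ≡⟨ rearrange′ t l q ⟩
              (q + t) * l + suc q             ∎)
        where
        t = d ∸ q
        rearrange : ∀ t v q → suc (q + t) * v ≡ suc q * v + t * v
        rearrange = solve-∀
        rearrange′ : ∀ t l q → (q * l + suc q) + t * l ≡ (q + t) * l + suc q
        rearrange′ = solve-∀
      bound (yes u′) | no q≰d = subst (_≤ d * l + suc q) (ℕ.+-comm (d * v) v)
        (ℕ.+-mono-≤ (ℕ.*-monoʳ-≤ d v≤l) (ℕ.≤-trans v≤l (s≤s (cyc w u′ id))))
      bound (no ¬u′) | no q≰d = ℕ.≤-trans (ih ¬u′)
        (ℕ.+-monoʳ-≤ (d * l) (s≤s (ℕ.≤-trans e≤1+d (ℕ.≰⇒> q≰d))))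

    core : Dec (s ≡ 0) → Dec (Unique S) → suc d * (v + n) ≤ d * (suc (s + n) + l) + suc e
    core (yes s≡0) du = begin
      suc d * (v + n)                      ≡⟨ ℕ.*-distribˡ-+ (suc d) v n ⟩
      suc d * v + suc d * n                ≤⟨ ℕ.+-monoˡ-≤ (suc d * n) (bound s≡0 du) ⟩
      (d * l + suc q) + suc d * n          ≡⟨ rearrange d l q n ⟩
      d * (n + l) + suc (q + n)            ≡⟨ cong (λ k → d * (n + l) + suc k) q+n ⟩
      d * (n + l) + suc (d + e)            ≡⟨ rearrange′ d (n + l) e ⟩
      d * suc (n + l) + suc e              ≡⟨ cong (λ s → d * (suc (s + n) + l) + suc e) (sym s≡0) ⟩
      d * (suc (s + n) + l) + suc e        ∎
      where
      rearrange : ∀ d l q n → (d * l + suc q) + suc d * n ≡ d * (n + l) + suc (q + n)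
      rearrange = solve-∀
      rearrange′ : ∀ d k e → d * k + suc (d + e) ≡ d * suc k + suc e
      rearrange′ = solve-∀
    core (no s≢0) (no ¬u′) = begin
      suc d * (v + n)                      ≡⟨ ℕ.*-distribˡ-+ (suc d) v n ⟩
      suc d * v + (n + d * n)              ≤⟨ ℕ.+-mono-≤ (ih ¬u′) (ℕ.+-monoˡ-≤ (d * n) n≤) ⟩
      (d * l + suc e) + (d * suc s + d * n) ≡⟨ rearrange d l e s n ⟩
      d * (suc (s + n) + l) + suc e        ∎
      where
      -- With at least one shared vertex, `n ≤ 2 d ≤ d (s + 1)`, which is what `c` and the `s`
      -- shared vertices contribute to the right-hand side by their repeated visits.
      n≤ : n ≤ d * suc s
      n≤ = ℕ.≤-trans (n≤2d s≢0) (ℕ.*-monoʳ-≤ d (s≤s (ℕ.n≢0⇒n>0 s≢0)))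
      rearrange : ∀ d l e s n → (d * l + suc e) + (d * suc s + d * n) ≡ d * (suc (s + n) + l) + suc e
      rearrange = solve-∀
    core (no s≢0) (yes u′) = begin
      suc d * (v + n)                              ≤⟨ ℕ.*-monoʳ-≤ (suc d) (ℕ.+-monoˡ-≤ n v≤l) ⟩
      suc d * (l + n)                              ≡⟨ rearrange d l n ⟩
      d * (l + n) + (n + l)                        ≤⟨ ℕ.+-monoʳ-≤ (d * (l + n)) (ℕ.+-monoˡ-≤ l n≤) ⟩
      d * (l + n) + ((d * s + r) + l)              ≡⟨ cong (d * (l + n) +_) (trans (ℕ.+-assoc (d * s) r l) (cong (d * s +_) r+l)) ⟩
      d * (l + n) + (d * s + suc (d + e))          ≡⟨ rearrange′ d l n s e ⟩
      d * (suc (s + n) + l) + suc e                ∎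
      where
      -- A tour of the simple rest leaves `r` vertices for a path departing from it. If `r ≤ d`, the
      -- at most `s + 1` runs of new vertices have at most `r` vertices each; otherwise
      -- `2 d ≤ d s + r` because `s > 0`.
      r = suc (d + e) ∸ l
      r+l : r + l ≡ suc (d + e)
      r+l = ℕ.m∸n+n≡m (short (linked w) u′)
      double : ∀ d → d * 2 ≡ d * 1 + d
      double = solve-∀
      n≤ : n ≤ d * s + r
      n≤ with r ≤? d
      ... | yes r≤d = begin
        n             ≤⟨ newRuns≤ w u′ r+l (suc (length cs)) ℕ.≤-refl (here refl) p (AllPairs.tail u) ⟩
        r * suc s     ≡⟨ trans (ℕ.*-suc r s) (ℕ.+-comm r (r * s)) ⟩
        r * s + r     ≤⟨ ℕ.+-monoˡ-≤ r (ℕ.*-monoˡ-≤ s r≤d) ⟩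
        d * s + r     ∎
      ... | no  r≰d = begin
        n             ≤⟨ n≤2d s≢0 ⟩
        d * 2         ≡⟨ double d ⟩
        d * 1 + d     ≤⟨ ℕ.+-mono-≤ (ℕ.*-monoʳ-≤ d (ℕ.n≢0⇒n>0 s≢0)) (ℕ.<⇒≤ (ℕ.≰⇒> r≰d)) ⟩
        d * s + r     ∎
      rearrange : ∀ d l n → suc d * (l + n) ≡ d * (l + n) + (n + l)
      rearrange = solve-∀
      rearrange′ : ∀ d l n s e → d * (l + n) + (d * s + suc (d + e)) ≡ d * (suc (s + n) + l) + suc e
      rearrange′ = solve-∀

-- Orbits

module _ {A : Set} (f : A → A) where

  iter : ℕ → A → A
  iter zero    x = x
  iter (suc i) x = f (iter i x)

  iter-+ : ∀ i j x → iter (i + j) x ≡ iter i (iter j x)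
  iter-+ zero    j x = refl
  iter-+ (suc i) j x = cong f (iter-+ i j x)

  iter-* : ∀ i j {x} → iter j x ≡ x → iter (i * j) x ≡ x
  iter-* zero    j     _  = refl
  iter-* (suc i) j {x} eq = trans (iter-+ j (i * j) x) (trans (cong (iter j) (iter-* i j eq)) eq)

  Orbit : Rel A 0ℓ
  Orbit = Star (λ x y → f x ≡ y)

  orbit-iter : ∀ i x → Orbit x (iter i x)
  orbit-iter zero    x = ε
  orbit-iter (suc i) x = orbit-iter i x ◅◅ (refl ◅ ε)

  orbit⇒iter : ∀ {x y} → Orbit x y → ∃[ i ] iter i x ≡ y
  orbit⇒iter ε = 0 , refl
  orbit⇒iter {x} (refl ◅ s) with orbit⇒iter s
  ... | i , refl = i + 1 , iter-+ i 1 x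

  -- Both preimages are the point of the orbit of f x one step before it closes up.
  cyclic⇒injective : ∀ {x y} → Orbit (f x) x → Orbit (f y) y → f x ≡ f y → x ≡ y
  cyclic⇒injective {x} {y} sx sy eq with orbit⇒iter sx | orbit⇒iter sy
  ... | i , ix | j , jy = begin
    x                            ≡⟨ sym ix ⟩
    iter i c                     ≡⟨ cong (iter i) (sym (iter-* j (suc i) (cong f ix))) ⟩
    iter i (iter (j * suc i) c)  ≡⟨ sym (iter-+ i (j * suc i) c) ⟩
    iter (i + j * suc i) c       ≡⟨ cong (λ k → iter k c) (exchange i j) ⟩
    iter (j + i * suc j) c       ≡⟨ iter-+ j (i * suc j) c ⟩
    iter j (iter (i * suc j) c)  ≡⟨ cong (iter j) (iter-* i (suc j) (trans (cong f (trans (cong (iter j) eq) jy)) (sym eq))) ⟩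
    iter j c                     ≡⟨ trans (cong (iter j) eq) jy ⟩
    y                            ∎
    where
    open ≡-Reasoning
    c = f x
    exchange : ∀ i j → i + j * suc i ≡ j + i * suc j
    exchange = solve-∀

module Orbits {A : Set} (_≟_ : DecidableEquality A) (f : A → A) (xs : List A)
  (closed : ∀ {x} → x ∈ xs → f x ∈ xs)
  (injective : ∀ {x y} → x ∈ xs → y ∈ xs → f x ≡ f y → x ≡ y) where

  iter-∈ : ∀ i {x} → x ∈ xs → iter f i x ∈ xs
  iter-∈ zero    x∈ = x∈
  iter-∈ (suc i) x∈ = closed (iter-∈ i x∈)

  private
    Distinct : ℕ → A → Set
    Distinct m x = ∀ {i j} → i < j → j < suc m → iter f i x ≢ iter f j x

    -- By injectivity, a coincidence between two later iterates can be moved one step back, so the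
    -- earliest coincidence is a return to `x` itself. With `m = length xs` the first alternative
    -- contradicts the pigeonhole principle.
    search : ∀ m {x} → x ∈ xs → Distinct m x ⊎ ∃[ p ] iter f (suc p) x ≡ x × Distinct p x
    search zero    x∈ = inj₁ λ { {j = zero} () _ ; {j = suc j} _ (s≤s ()) }
    search (suc m) {x} x∈ with search m x∈
    ... | inj₂ r = inj₂ r
    ... | inj₁ D with iter f (suc m) x ≟ x
    ...   | yes eq = inj₂ (m , eq , D)
    ...   | no ≢x  = inj₁ D′
      where
      D′ : Distinct (suc m) x
      D′ {i} {j} i<j (s≤s j≤) eq with ℕ.m≤n⇒m<n∨m≡n j≤
      ... | inj₁ j<m = D i<j j<m eq
      D′ {zero}  {j} i<j (s≤s j≤) eq | inj₂ refl = ≢x (sym eq)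
      D′ {suc i} {j} (s≤s i<j) (s≤s j≤) eq | inj₂ refl =
        D i<j ℕ.≤-refl (injective (iter-∈ i x∈) (iter-∈ m x∈) eq)

    distinct⇒unique : ∀ {p x} → Distinct p x → Unique (applyUpTo (λ i → iter f i x) (suc p))
    distinct⇒unique {x = x} D = AllPairs.applyUpTo⁺₁ (λ i → iter f i x) _ λ i<j j< → D i<j j<

    applyUpTo⊆ : ∀ m {x y} → x ∈ xs → y ∈ applyUpTo (λ i → iter f i x) m → y ∈ xs
    applyUpTo⊆ m {x} x∈ y∈ with ∈-applyUpTo⁻ (λ i → iter f i x) y∈
    ... | i , _ , refl = iter-∈ i x∈

    period : ∀ {x} → x ∈ xs → ∃[ p ] iter f (suc p) x ≡ x × Distinct p x
    period {x} x∈ with search (length xs) x∈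
    ... | inj₂ r = r
    ... | inj₁ D = contradiction
      (subst (_≤ length xs) (List.length-applyUpTo (λ i → iter f i x) (suc (length xs)))
        (unique-length-≤ (distinct⇒unique D) (applyUpTo⊆ _ x∈)))
      ℕ.1+n≰n

  periodLength : ∀ {x} → x ∈ xs → ℕ
  periodLength x∈ = suc (proj₁ (period x∈))

  iter-period : ∀ {x} (x∈ : x ∈ xs) → iter f (periodLength x∈) x ≡ x
  iter-period x∈ = proj₁ (proj₂ (period x∈))

  orbit : ∀ {x} → x ∈ xs → List A
  orbit {x} x∈ = applyUpTo (λ i → iter f i x) (periodLength x∈)

  orbit-unique : ∀ {x} (x∈ : x ∈ xs) → Unique (orbit x∈)
  orbit-unique x∈ = distinct⇒unique (proj₂ (proj₂ (period x∈)))

  orbit⊆ : ∀ {x y} (x∈ : x ∈ xs) → y ∈ orbit x∈ → y ∈ xs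
  orbit⊆ x∈ = applyUpTo⊆ _ x∈

  orbit-shape : ∀ {x} (x∈ : x ∈ xs) →
    ∃[ p ] orbit x∈ ≡ applyUpTo (λ i → iter f i x) (suc p) × iter f (suc p) x ≡ x
  orbit-shape x∈ = _ , refl , iter-period x∈

  orbit-length : ∀ {x} (x∈ : x ∈ xs) → ∃[ p ] length (orbit x∈) ≡ suc p × iter f (suc p) x ≡ x
  orbit-length {x} x∈ with orbit-shape x∈
  ... | p , eq , per = p , trans (cong length eq) (List.length-applyUpTo (λ i → iter f i x) (suc p)) , per

  ∈-orbit⁻ : ∀ {x y} (x∈ : x ∈ xs) → y ∈ orbit x∈ → Orbit f x y
  ∈-orbit⁻ {x} x∈ y∈ with ∈-applyUpTo⁻ (λ i → iter f i x) y∈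
  ... | i , _ , refl = orbit-iter f i x

  private
    orbit-return : ∀ {x y} (x∈ : x ∈ xs) → y ∈ orbit x∈ → Orbit f y x
    orbit-return {x} x∈ y∈ with ∈-applyUpTo⁻ (λ i → iter f i x) y∈
    ... | i , i<p , refl = subst (Orbit f (iter f i x)) back (orbit-iter f k (iter f i x))
      where
      k = periodLength x∈ ∸ i
      back : iter f k (iter f i x) ≡ x
      back = trans (sym (iter-+ f k i x))
        (trans (cong (λ m → iter f m x) (ℕ.m∸n+n≡m (ℕ.<⇒≤ i<p))) (iter-period x∈))

    orbit-step : ∀ {x y} (x∈ : x ∈ xs) → y ∈ orbit x∈ → f y ∈ orbit x∈
    orbit-step {x} x∈ y∈ with ∈-applyUpTo⁻ (λ i → iter f i x) y∈
    ... | i , i<p , refl with ℕ.m≤n⇒m<n∨m≡n i<p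
    ...   | inj₁ i+1<p = ∈-applyUpTo⁺ (λ i → iter f i x) i+1<p
    ...   | inj₂ refl  = subst (_∈ orbit x∈) (sym (iter-period x∈)) (here refl)

    orbit-steps : ∀ {x y z} (x∈ : x ∈ xs) → y ∈ orbit x∈ → Orbit f y z → z ∈ orbit x∈
    orbit-steps x∈ y∈ ε          = y∈
    orbit-steps x∈ y∈ (refl ◅ s) = orbit-steps x∈ (orbit-step x∈ y∈) s

  ∈-orbit⁺ : ∀ {x y} (x∈ : x ∈ xs) → Orbit f x y → y ∈ orbit x∈
  ∈-orbit⁺ x∈ = orbit-steps x∈ (here refl)

  orbit-sym : ∀ {x y} → x ∈ xs → Orbit f x y → Orbit f y x
  orbit-sym x∈ s = orbit-return x∈ (∈-orbit⁺ x∈ s)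

-- Representatives

module _ {A : Set} where

  -- No `y` is related to two members of `xs`, so deleting the partner of one leaves those of the
  -- others available. This compares lists of representatives, whose members are merely related and
  -- not equal.
  matching-length-≤ : ∀ {B : Set} (T : A → B → Set) {xs ys} →
    AllPairs (λ x x′ → ∀ y → T x y → ¬ T x′ y) xs → (∀ {x} → x ∈ xs → ∃[ y ] y ∈ ys × T x y) →
    length xs ≤ length ys
  matching-length-≤ T {[]}     _            _ = z≤n
  matching-length-≤ T {x ∷ xs} (x# ∷ apart) match with match (here refl)
  ... | y , y∈ , t with ∈-∃++ y∈
  ...   | as , bs , refl = subst (suc (length xs) ≤_) (sym (List.length-++-sucʳ as y bs))
    (s≤s (matching-length-≤ T apart match′))
    where
    match′ : ∀ {x′} → x′ ∈ xs → ∃[ y′ ] y′ ∈ as ++ bs × T x′ y′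
    match′ m with match (there m)
    ... | y′ , y′∈ , t′ = y′ , ∈-++-∷⁻ as y′∈ (λ { refl → All.lookup x# m _ t t′ }) , t′

  module _ {R : Rel A 0ℓ} (R? : Decidable R) where

    deduplicate-⊆ : ∀ xs {x} → x ∈ deduplicate R? xs → x ∈ xs
    deduplicate-⊆ (x ∷ xs) (here e)  = here e
    deduplicate-⊆ (x ∷ xs) (there m) =
      there (deduplicate-⊆ xs (proj₁ (∈-filter⁻ (¬? ∘ R? x) {xs = deduplicate R? xs} m)))

    deduplicate-apart : ∀ xs → AllPairs (λ x y → ¬ R x y) (deduplicate R? xs)
    deduplicate-apart []       = []
    deduplicate-apart (x ∷ xs) = All.all-filter (¬? ∘ R? x) (deduplicate R? xs)
                               ∷ AllPairs.filter⁺ (¬? ∘ R? x) (deduplicate-apart xs)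

    deduplicate-represents : (∀ {x} → R x x) → (∀ {x y z} → R x y → R y z → R x z) →
      ∀ xs {x} → x ∈ xs → ∃[ y ] y ∈ deduplicate R? xs × R y x
    deduplicate-represents r t (x ∷ xs) (here refl) = x , here refl , r
    deduplicate-represents r t (x ∷ xs) (there m) with deduplicate-represents r t xs m
    ... | y , y∈ , Ryx with R? x y
    ...   | yes Rxy = x , here refl , t Rxy Ryx
    ...   | no ¬Rxy = y , there (∈-filter⁺ (¬? ∘ R? x) y∈ ¬Rxy) , Ryx

  AllPairs-map-∈ : ∀ {P Q : Rel A 0ℓ} {xs} → (∀ {x y} → x ∈ xs → y ∈ xs → P x y → Q x y) →
                   AllPairs P xs → AllPairs Q xs
  AllPairs-map-∈ imp []       = []
  AllPairs-map-∈ imp (p ∷ ps) = All.tabulate (λ m → imp (here refl) (there m) (All.lookup p m))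
                              ∷ AllPairs-map-∈ (λ m m′ → imp (there m) (there m′)) ps

  length-concatMap : ∀ {B : Set} (f : A → List B) xs → length (concatMap f xs) ≡ sum (map (length ∘ f) xs)
  length-concatMap f []       = refl
  length-concatMap f (x ∷ xs) = trans (List.length-++ (f x)) (cong (length (f x) +_) (length-concatMap f xs))

  ∈-concatMap⁺ : ∀ {B : Set} (f : A → List B) {xs x y} → x ∈ xs → y ∈ f x → y ∈ concatMap f xs
  ∈-concatMap⁺ f m m′ = ∈-concat⁺′ m′ (∈-map⁺ f m)

  ∈-concatMap⁻ : ∀ {B : Set} (f : A → List B) xs {y} → y ∈ concatMap f xs → ∃[ x ] x ∈ xs × y ∈ f x
  ∈-concatMap⁻ f xs m with ∈-concat⁻′ (map f xs) m
  ... | _ , y∈ , m′ with ∈-map⁻ f m′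
  ...   | x , x∈ , refl = x , x∈ , y∈

  concatMap-unique : ∀ {B : Set} (f : A → List B) {xs} → (∀ {x} → x ∈ xs → Unique (f x)) →
    AllPairs (λ x x′ → ∀ y → y ∈ f x → ¬ y ∈ f x′) xs → Unique (concatMap f xs)
  concatMap-unique f {[]}     u _ = []
  concatMap-unique f {x ∷ xs} u (x# ∷ apart) =
    Unique.++⁺ (u (here refl)) (concatMap-unique f (u ∘ there) apart)
      λ { (m , m′) → let (x′ , x′∈ , y∈) = ∈-concatMap⁻ f xs m′ in All.lookup x# x′∈ _ m y∈ }

-- Faces of an outerplanar graph

noNeighbours⇒∣∣≡0 : ∀ {n} (s : Subset.Subset n) → (∀ v → ¬ v Subset.∈ s) → Subset.∣ s ∣ ≡ 0
noNeighbours⇒∣∣≡0 {n} s none =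
  trans (cong Subset.∣_∣ (Subset.Empty-unique λ { (v , v∈) → none v v∈ })) (Subset.∣⊥∣≡0 n)

∣∣≡0⇒noNeighbours : ∀ {n} (s : Subset.Subset n) → Subset.∣ s ∣ ≡ 0 → ∀ v → ¬ v Subset.∈ s
∣∣≡0⇒noNeighbours s eq v v∈ = ℕ.n≮0 (subst (Subset.∣ s Subset.- v ∣ <_) eq (Subset.x∈p⇒∣p-x∣<∣p∣ v∈))

module _ {n : ℕ} (G : Graph n) where

  connected-sym : ∀ {u v} → Connected G u v → Connected G v u
  connected-sym ε       = ε
  connected-sym (r ◅ s) = connected-sym s ◅◅ (adj-sym G r ◅ ε)

  ∈-pairs : ∀ u v → (u , v) ∈ Graph.pairs G
  ∈-pairs u v = ∈-cartesianProduct⁺ (∈-allFin u) (∈-allFin v)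

  pairs-unique : Unique (Graph.pairs G)
  pairs-unique = Unique.cartesianProduct⁺ (Unique.allFin⁺ n) (Unique.allFin⁺ n)

  private
    dart? : Pred.Decidable (λ ((u , v) : Fin n × Fin n) → Adj G u v)
    dart? (u , v) = adj? G u v

    forward? : Pred.Decidable (λ ((u , v) : Fin n × Fin n) → u Fin.< v × Adj G u v)
    forward? (u , v) = (u Fin.<? v) ×-dec adj? G u v

  ∈-darts⁺ : ∀ {u v} → Adj G u v → (u , v) ∈ Graph.darts G
  ∈-darts⁺ {u} {v} a = ∈-filter⁺ dart? (∈-pairs u v) a

  ∈-darts⁻ : ∀ {u v} → (u , v) ∈ Graph.darts G → Adj G u v
  ∈-darts⁻ m = proj₂ (∈-filter⁻ dart? {xs = Graph.pairs G} m)

  darts-unique : Unique (Graph.darts G)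
  darts-unique = Unique.filter⁺ dart? pairs-unique

  darts≤2size : length (Graph.darts G) ≤ size G + size G
  darts≤2size = begin
    length (Graph.darts G)                   ≤⟨ unique-length-≤ darts-unique covered ⟩
    length (fs ++ map Product.swap fs)       ≡⟨ List.length-++ fs ⟩
    length fs + length (map Product.swap fs) ≡⟨ cong (length fs +_) (List.length-map Product.swap fs) ⟩
    size G + size G                          ∎
    where
    open ℕ.≤-Reasoning
    fs = filter forward? (Graph.pairs G)
    covered : ∀ {x} → x ∈ Graph.darts G → x ∈ fs ++ map Product.swap fs
    covered {u , v} m with Fin.<-cmp u v | ∈-darts⁻ m
    ... | tri< u<v _ _  | a = ∈-++⁺ˡ (∈-filter⁺ forward? (∈-pairs u v) (u<v , a))
    ... | tri≈ _ refl _ | a = contradiction a (adj-irrefl G)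
    ... | tri> _ _ v<u  | a = ∈-++⁺ʳ fs (∈-map⁺ Product.swap
                                (∈-filter⁺ forward? (∈-pairs v u) (v<u , adj-sym G a)))

module Faces {n : ℕ} (G : Graph n) (rotation : Vec (Vec (Fin n) n) n)
             (isRotation : Rotation.IsRotation G rotation) where

  open Graph G using (darts; N)
  open Rotation G rotation using (ρ; next; SameFace; sameFace?; IsPlanar; AllOnOuterFace)

  next-closed : ∀ {x} → x ∈ darts → next x ∈ darts
  next-closed {u , v} m = ∈-darts⁺ G (proj₁ isRotation v u (adj-sym G (∈-darts⁻ G m)))

  -- That `ρ v` runs through the neighbours of `v` in a single cycle provides the way back from
  -- `ρ v w` to `w` which `cyclic⇒injective` asks for.
  next-injective : ∀ {x y} → x ∈ darts → y ∈ darts → next x ≡ next y → x ≡ y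
  next-injective {u , v} {u′ , v′} m m′ eq with Product.,-injective eq
  ... | refl , eq′ = cong (_, v) (cyclic⇒injective (ρ v) (back u a) (back u′ a′) eq′)
    where
    a = adj-sym G (∈-darts⁻ G m)
    a′ = adj-sym G (∈-darts⁻ G m′)
    back : ∀ w → Adj G v w → Orbit (ρ v) (ρ v w) w
    back w a = proj₂ isRotation v (ρ v w) w (proj₁ isRotation v w a) a

  open Orbits (Product.≡-dec Fin._≟_ Fin._≟_) next darts next-closed next-injective public

  face : ∀ {u v} → Adj G u v → List (Fin n × Fin n)
  face a = orbit (∈-darts⁺ G a)

  sameFace⇒connected : ∀ {u v w z} → Adj G u v → SameFace (u , v) (w , z) → Connected G u w
  sameFace⇒connected a ε          = ε
  sameFace⇒connected a (refl ◅ s) =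
    a ◅ sameFace⇒connected (proj₁ isRotation _ _ (adj-sym G a)) s

  private
    fixed⇒leaf : ∀ {u v} → Adj G u v → ρ u v ≡ v → ∀ {w} → Adj G u w → w ≡ v
    fixed⇒leaf {u} {v} a fix b = stays (proj₂ isRotation u _ _ a b)
      where
      stays : ∀ {w} → Orbit (ρ u) v w → w ≡ v
      stays ε       = refl
      stays (e ◅ s) with trans (sym e) fix
      ... | refl = stays s

    twoVertices : ∀ {u v} → ρ v u ≡ u → ρ u v ≡ v → Adj G u v →
                  ∀ {w} → Connected G u w → w ≡ u ⊎ w ≡ v
    twoVertices eu ev a ε = inj₁ refl
    twoVertices eu ev a (b ◅ s) with fixed⇒leaf a ev b
    ... | refl with twoVertices ev eu (adj-sym G a) s
    ...   | inj₁ e = inj₂ e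
    ...   | inj₂ e = inj₁ e

  module Outer (isPlanar : IsPlanar) (outerFace : AllOnOuterFace) where

    -- Two vertices of one component may be assigned different faces here, as on a cycle, where both
    -- faces meet all vertices. The sums below therefore run over one representative per component.
    -- An isolated vertex has the empty walk, and `isolatedCount` accounts for its face.
    outer : Fin n → List (Fin n × Fin n)
    outer r with Subset.nonempty? (N r)
    ... | no  _       = []
    ... | yes (v , a) = face (proj₁ (proj₂ (outerFace r v a)))

    outer-spec : ∀ {r v} → Adj G r v → ∃[ x ] Σ (Adj G r x) λ a → outer r ≡ face a ×
                 (∀ w → Connected G r w → ∃[ y ] Adj G w y × SameFace (r , x) (w , y))
    outer-spec {r} {v} b with Subset.nonempty? (N r)
    ... | no  none    = contradiction (v , b) none
    ... | yes (v , a) with outerFace r v a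
    ...   | x , a′ , all = x , a′ , refl , all

    outer-nonisolated : ∀ {r x} → x ∈ outer r → ∃[ v ] Adj G r v
    outer-nonisolated {r} m with Subset.nonempty? (N r)
    ... | yes va = va
    outer-nonisolated {r} () | no _

    outer-unique : ∀ r → Unique (outer r)
    outer-unique r with Subset.nonempty? (N r)
    ... | no  _       = []
    ... | yes (v , a) = orbit-unique _

    outer-closed : ∀ {r x y} → x ∈ outer r → SameFace x y → y ∈ outer r
    outer-closed {r} m s with outer-nonisolated m
    ... | v , b with outer-spec b
    ...   | x , a , eq , _ rewrite eq = ∈-orbit⁺ _ (∈-orbit⁻ _ m ◅◅ s)

    outer-sameFace : ∀ {r x y} → x ∈ outer r → y ∈ outer r → SameFace x y
    outer-sameFace {r} m m′ with outer-nonisolated m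
    ... | v , b with outer-spec b
    ...   | x , a , eq , _ rewrite eq =
      orbit-sym (∈-darts⁺ G a) (∈-orbit⁻ _ m) ◅◅ ∈-orbit⁻ _ m′

    outer⊆darts : ∀ {r x} → x ∈ outer r → x ∈ darts
    outer⊆darts {r} m with outer-nonisolated m
    ... | v , b with outer-spec b
    ...   | x , a , eq , _ rewrite eq = orbit⊆ _ m

    outer-connected : ∀ {r u v} → (u , v) ∈ outer r → Connected G r u
    outer-connected {r} m with outer-nonisolated m
    ... | _ , b with outer-spec b
    ...   | x , a , eq , _ rewrite eq = sameFace⇒connected a (∈-orbit⁻ _ m)

    -- A face of length 1 would be a loop. In a face of length 2 both ends are fixed by their
    -- rotations and are thus leaves, so the component is a single edge, whose only face is the
    -- outer one.
    innerFace≥3 : ∀ {r u v} (a : Adj G u v) → Connected G r u → (u , v) ∉ outer r →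
                  3 ≤ length (face a)
    innerFace≥3 {r} {u} {v} a c ∉outer with orbit-length (∈-darts⁺ G a)
    ... | 0 , _ , per = contradiction (subst (Adj G u) (proj₁ (Product.,-injective per)) a) (adj-irrefl G)
    ... | suc (suc p) , len , _ = subst (3 ≤_) (sym len) (s≤s (s≤s (s≤s z≤n)))
    ... | 1 , _ , per = contradiction onOuter ∉outer
      where
      ev : ρ v u ≡ u
      ev = proj₁ (Product.,-injective per)
      eu : ρ u v ≡ v
      eu = trans (cong (λ w → ρ w v) (sym ev)) (proj₂ (Product.,-injective per))
      onOuter : (u , v) ∈ outer r
      onOuter with twoVertices ev eu a (connected-sym G c)
      onOuter | inj₁ refl with outer-spec a
      ... | x , a′ , eq , _ with fixed⇒leaf a eu a′
      ...   | refl = subst ((u , v) ∈_) (sym eq) (here refl)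
      onOuter | inj₂ refl with outer-spec (adj-sym G a)
      ... | x , a′ , eq , _ with fixed⇒leaf (adj-sym G a) ev a′
      ...   | refl = subst ((u , v) ∈_) (sym eq) (∈-orbit⁺ _ (cong (u ,_) eu ◅ ε))

-- Euler's formula

3*≤sum : ∀ {A : Set} (f : A → ℕ) xs → (∀ {x} → x ∈ xs → 3 ≤ f x) → 3 * length xs ≤ sum (map f xs)
3*≤sum f []       _ = z≤n
3*≤sum f (x ∷ xs) h = subst (_≤ f x + sum (map f xs)) (sym (ℕ.*-suc 3 (length xs)))
  (ℕ.+-mono-≤ (h (here refl)) (3*≤sum f xs (h ∘ there)))

sum-map-mono : ∀ {A : Set} (f g : A → ℕ) xs → (∀ {x} → x ∈ xs → f x ≤ g x) →
               sum (map f xs) ≤ sum (map g xs)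
sum-map-mono f g []       _ = z≤n
sum-map-mono f g (x ∷ xs) h = ℕ.+-mono-≤ (h (here refl)) (sum-map-mono f g xs (h ∘ there))

sum-map-gap : ∀ {A : Set} (f g : A → ℕ) δ xs {s} → s ∈ xs → (∀ {x} → x ∈ xs → f x ≤ g x) →
              f s + δ ≤ g s → sum (map f xs) + δ ≤ sum (map g xs)
sum-map-gap f g δ (x ∷ xs) (here refl) h gap = begin
  (f x + sum (map f xs)) + δ  ≡⟨ rearrange (f x) (sum (map f xs)) δ ⟩
  (f x + δ) + sum (map f xs)  ≤⟨ ℕ.+-mono-≤ gap (sum-map-mono f g xs (h ∘ there)) ⟩
  g x + sum (map g xs)        ∎
  where
  open ℕ.≤-Reasoning
  rearrange : ∀ a b c → (a + b) + c ≡ (a + c) + b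
  rearrange = solve-∀
sum-map-gap f g δ (x ∷ xs) (there m) h gap =
  subst (_≤ g x + sum (map g xs)) (sym (ℕ.+-assoc (f x) (sum (map f xs)) δ))
    (ℕ.+-mono-≤ (h (here refl)) (sum-map-gap f g δ xs m (h ∘ there) gap))

sum-map-* : ∀ {A : Set} c (f : A → ℕ) xs → sum (map (λ x → c * f x) xs) ≡ c * sum (map f xs)
sum-map-* c f []       = sym (ℕ.*-zeroʳ c)
sum-map-* c f (x ∷ xs) = trans (cong (c * f x +_) (sum-map-* c f xs)) (sym (ℕ.*-distribˡ-+ c (f x) _))

sum-map-affine : ∀ {A : Set} a b (f : A → ℕ) xs →
                 sum (map (λ x → a + b * f x) xs) ≡ a * length xs + b * sum (map f xs)
sum-map-affine a b f []       = sym (cong₂ _+_ (ℕ.*-zeroʳ a) (ℕ.*-zeroʳ b))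
sum-map-affine a b f (x ∷ xs) = trans (cong (a + b * f x +_) (sum-map-affine a b f xs))
  (rearrange a b (f x) (length xs) (sum (map f xs)))
  where
  rearrange : ∀ a b x l s → (a + b * x) + (a * l + b * s) ≡ a * suc l + b * (x + s)
  rearrange = solve-∀

module Euler {n : ℕ} (G : Graph n) (rotation : Vec (Vec (Fin n) n) n)
             (isRotation : Rotation.IsRotation G rotation)
             (isPlanar : Rotation.IsPlanar G rotation)
             (outerFace : Rotation.AllOnOuterFace G rotation) where

  open Graph G using (darts; N; isolatedCount)
  open Rotation G rotation using (next; SameFace; sameFace?)
  open Faces G rotation isRotation
  open Outer isPlanar outerFace
  open import Data.List.Membership.DecPropositional (Product.≡-dec (Fin._≟_ {n}) (Fin._≟_ {n})) using (_∈?_)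

  reps : List (Fin n)
  reps = deduplicate (connected? G) (allFin n)

  representative : ∀ u → ∃[ r ] r ∈ reps × Connected G r u
  representative u = deduplicate-represents (connected? G) ε _◅◅_ (allFin n) (∈-allFin u)

  private
    Dart : Set
    Dart = Fin n × Fin n

    faces outers innerFaces outerFaces : List Dart
    faces      = deduplicate sameFace? darts
    outers     = concatMap outer reps
    innerFaces = filter (¬? ∘ (_∈? outers)) faces
    outerFaces = filter (_∈? outers) faces

    boundary : Dart → List Dart
    boundary (u , v) with adj? G u v
    ... | yes a = face a
    ... | no  _ = []

    boundary-sameFace : ∀ {x y} → y ∈ boundary x → SameFace x y
    boundary-sameFace {u , v} m with adj? G u v
    ... | yes a = ∈-orbit⁻ (∈-darts⁺ G a) m
    boundary-sameFace {u , v} () | no _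

    boundary⊆darts : ∀ {x y} → y ∈ boundary x → y ∈ darts
    boundary⊆darts {u , v} m with adj? G u v
    ... | yes a = orbit⊆ (∈-darts⁺ G a) m
    boundary⊆darts {u , v} () | no _

    boundary-unique : ∀ x → Unique (boundary x)
    boundary-unique (u , v) with adj? G u v
    ... | yes a = orbit-unique (∈-darts⁺ G a)
    ... | no  _ = []

    innerFace : ∀ {x} → x ∈ innerFaces → x ∈ darts × x ∉ outers
    innerFace m with ∈-filter⁻ (¬? ∘ (_∈? outers)) {xs = faces} m
    ... | m′ , ∉ = deduplicate-⊆ sameFace? darts m′ , ∉

    boundary≥3 : ∀ {x} → x ∈ innerFaces → 3 ≤ length (boundary x)
    boundary≥3 {u , v} m with innerFace m
    ... | x∈ , ∉ with adj? G u v | representative u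
    ...   | yes a | r , r∈ , c = innerFace≥3 a c (∉ ∘ ∈-concatMap⁺ outer r∈)
    ...   | no ¬a | _          = contradiction (∈-darts⁻ G x∈) ¬a

    outers-unique : Unique outers
    outers-unique = concatMap-unique outer (λ {r} _ → outer-unique r)
      (AllPairs.map (λ {r} {r′} ¬c y m m′ → ¬c (outer-connected {r} m ◅◅ connected-sym G (outer-connected {r′} m′)))
        (deduplicate-apart (connected? G) (allFin n)))

    boundaries-unique : Unique (concatMap boundary innerFaces)
    boundaries-unique = concatMap-unique boundary (λ {x} _ → boundary-unique x)
      (AllPairs-map-∈ (λ x∈ y∈ ¬s _ m m′ → ¬s (boundary-sameFace m ◅◅
            orbit-sym (proj₁ (innerFace y∈)) (boundary-sameFace m′)))
        (AllPairs.filter⁺ _ (deduplicate-apart sameFace? darts)))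

    walks : List Dart
    walks = outers ++ concatMap boundary innerFaces

    walks-unique : Unique walks
    walks-unique = Unique.++⁺ outers-unique boundaries-unique λ { (m , m′) → apart m m′ }
      where
      apart : ∀ {x} → x ∈ outers → x ∉ concatMap boundary innerFaces
      apart m m′ with ∈-concatMap⁻ outer reps m | ∈-concatMap⁻ boundary innerFaces m′
      ... | r , r∈ , mr | y , y∈ , my = proj₂ (innerFace y∈)
        (∈-concatMap⁺ outer r∈ (outer-closed {r} mr (orbit-sym (proj₁ (innerFace y∈)) (boundary-sameFace my))))

    walks⊆darts : ∀ {x} → x ∈ walks → x ∈ darts
    walks⊆darts m with ∈-++⁻ outers m
    ... | inj₁ m′ with ∈-concatMap⁻ outer reps m′
    ...   | r , _ , mr = outer⊆darts {r} mr
    walks⊆darts m | inj₂ m′ with ∈-concatMap⁻ boundary innerFaces m′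
    ... | y , _ , my = boundary⊆darts {y} my

    -- The outer walks and the boundaries of the inner faces are pairwise disjoint sets of darts,
    -- and every edge has two darts.
    darts≥ : sum (map (length ∘ outer) reps) + 3 * length innerFaces ≤ size G + size G
    darts≥ = begin
      sum (map (length ∘ outer) reps) + 3 * length innerFaces
        ≤⟨ ℕ.+-monoʳ-≤ _ (3*≤sum (length ∘ boundary) innerFaces boundary≥3) ⟩
      sum (map (length ∘ outer) reps) + sum (map (length ∘ boundary) innerFaces)
        ≡⟨ cong₂ _+_ (sym (length-concatMap outer reps)) (sym (length-concatMap boundary innerFaces)) ⟩
      length outers + length (concatMap boundary innerFaces)
        ≡⟨ sym (List.length-++ outers) ⟩
      length walks
        ≤⟨ unique-length-≤ walks-unique walks⊆darts ⟩
      length darts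
        ≤⟨ darts≤2size G ⟩
      size G + size G ∎
      where open ℕ.≤-Reasoning

    isolated? : Pred.Decidable (λ u → Subset.∣ N u ∣ ≡ 0)
    isolated? u = Subset.∣ N u ∣ ℕ.≟ 0

    isolated≤ : isolatedCount ≤ length (filter isolated? reps)
    isolated≤ = unique-length-≤ (Unique.filter⁺ isolated? (Unique.allFin⁺ n)) isRep
      where
      isRep : ∀ {u} → u ∈ filter isolated? (allFin n) → u ∈ filter isolated? reps
      isRep {u} m with proj₂ (∈-filter⁻ isolated? {xs = allFin n} m) | representative u
      ... | iso | r , r∈ , c with connected-sym G c
      ...   | ε     = ∈-filter⁺ isolated? r∈ iso
      ...   | a ◅ _ = contradiction a (∣∣≡0⇒noNeighbours (N u) iso _)

    -- Face representatives on the outer walk of the same component would lie on the same face, so a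
    -- component accounts for at most one of them.
    outerFaces≤ : length outerFaces ≤ length (filter (¬? ∘ isolated?) reps)
    outerFaces≤ = matching-length-≤ (λ x r → x ∈ outer r)
      (AllPairs.map (λ ¬s r m m′ → ¬s (outer-sameFace {r} m m′))
        (AllPairs.filter⁺ _ (deduplicate-apart sameFace? darts)))
      match
      where
      match : ∀ {x} → x ∈ outerFaces → ∃[ r ] r ∈ filter (¬? ∘ isolated?) reps × x ∈ outer r
      match m with ∈-concatMap⁻ outer reps (proj₂ (∈-filter⁻ (_∈? outers) {xs = faces} m))
      ... | r , r∈ , mr with outer-nonisolated {r} mr
      ...   | v , a = r , ∈-filter⁺ (¬? ∘ isolated?) r∈ (λ eq → ∣∣≡0⇒noNeighbours (N r) eq v a) , mr

  -- Three times Euler's formula. The inner faces are eliminated by `S + 3 m ≤ 2 E`; outer faces and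
  -- isolated vertices together number at most one per component.
  outerLengths-bound : sum (map (length ∘ outer) reps) + size G + 3 * length reps ≤ 3 * n
  outerLengths-bound = ℕ.+-cancelʳ-≤ (3 * w) _ _ (begin
    (S + E + 3 * c) + 3 * w                    ≡⟨ cong (λ f → (S + E + 3 * c) + 3 * (f + i)) (sym (length-filter-¬ (_∈? outers) faces)) ⟩
    (S + E + 3 * c) + 3 * ((o + m) + i)        ≡⟨ rearrange₁ S E c o m i ⟩
    (S + 3 * m) + 3 * (i + o) + (E + 3 * c)    ≤⟨ ℕ.+-monoˡ-≤ (E + 3 * c) (ℕ.+-mono-≤ darts≥ (ℕ.*-monoʳ-≤ 3 i+o≤c)) ⟩
    (E + E) + 3 * c + (E + 3 * c)              ≡⟨ rearrange₂ E c ⟩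
    3 * (E + 2 * c)                            ≡⟨ cong (3 *_) (sym isPlanar) ⟩
    3 * (n + w)                                ≡⟨ ℕ.*-distribˡ-+ 3 n w ⟩
    3 * n + 3 * w                              ∎)
    where
    open ℕ.≤-Reasoning
    S = sum (map (length ∘ outer) reps)
    E = size G
    c = length reps
    o = length outerFaces
    m = length innerFaces
    i = isolatedCount
    w = length faces + i
    i+o≤c : i + o ≤ c
    i+o≤c = ℕ.≤-trans (ℕ.+-mono-≤ isolated≤ outerFaces≤) (ℕ.≤-reflexive (length-filter-¬ isolated? reps))
    rearrange₁ : ∀ S E c o m i → (S + E + 3 * c) + 3 * ((o + m) + i) ≡ (S + 3 * m) + 3 * (i + o) + (E + 3 * c)
    rearrange₁ = solve-∀
    rearrange₂ : ∀ E c → (E + E) + 3 * c + (E + 3 * c) ≡ 3 * (E + 2 * c)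
    rearrange₂ = solve-∀

  components-cover : n ≤ sum (map (length ∘ component G) reps)
  components-cover = begin
    n                                          ≡⟨ sym (List.length-tabulate id) ⟩
    length (allFin n)                          ≤⟨ unique-length-≤ (Unique.allFin⁺ n) covered ⟩
    length (concatMap (component G) reps)      ≡⟨ length-concatMap (component G) reps ⟩
    sum (map (length ∘ component G) reps)      ∎
    where
    open ℕ.≤-Reasoning
    covered : ∀ {u} → u ∈ allFin n → u ∈ concatMap (component G) reps
    covered {u} _ with representative u
    ... | r , r∈ , c = ∈-concatMap⁺ (component G) r∈ (∈-filter⁺ (connected? G r) (∈-allFin u) c)

  -- Euler's formula turns a linear bound on the number of vertices of each
  -- component in terms of its outer walk into a bound on the number of edges.
  size-bound : ∀ A C δ {s} → s ∈ reps →
    (∀ {r} → r ∈ reps → A * length (component G r) ≤ 3 * C + C * length (outer r)) →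
    A * length (component G s) + δ ≤ 3 * C + C * length (outer s) →
    C * size G + (A * n + δ) ≤ C * (3 * n)
  size-bound A C δ s∈ bound gap = begin
    C * E + (A * n + δ)                                ≤⟨ ℕ.+-monoʳ-≤ (C * E) (ℕ.+-monoˡ-≤ δ (ℕ.*-monoʳ-≤ A components-cover)) ⟩
    C * E + (A * sum (map a reps) + δ)                 ≡⟨ cong (λ s → C * E + (s + δ)) (sym (sum-map-* A a reps)) ⟩
    C * E + (sum (map (λ r → A * a r) reps) + δ)       ≤⟨ ℕ.+-monoʳ-≤ (C * E) (sum-map-gap _ _ δ reps s∈ bound gap) ⟩
    C * E + sum (map (λ r → 3 * C + C * l r) reps)     ≡⟨ cong (C * E +_) (sum-map-affine (3 * C) C l reps) ⟩
    C * E + (3 * C * c + C * S)                        ≡⟨ rearrange C E c S ⟩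
    C * (S + E + 3 * c)                                ≤⟨ ℕ.*-monoʳ-≤ C outerLengths-bound ⟩
    C * (3 * n)                                        ∎
    where
    open ℕ.≤-Reasoning
    a l : Fin n → ℕ
    a = length ∘ component G
    l = length ∘ outer
    E = size G
    c = length reps
    S = sum (map l reps)
    rearrange : ∀ C E c S → C * E + (3 * C * c + C * S) ≡ C * (S + E + 3 * c)
    rearrange = solve-∀

  open Walks (Fin._≟_ {n}) {R = Adj G} (λ {u} {v} → adj-sym G {u} {v}) (λ {u} → adj-irrefl G {u})

  -- The walk consists of the starting points of the darts on the outer face. It closes because
  -- `next` is periodic there, and `AllOnOuterFace` makes it visit the whole component.
  outerWalk : ∀ {r v} → Adj G r v → ∃[ us ] Walk r us r × length (outer r) ≡ suc (length us) ×
                                           (∀ {w} → w ∈ component G r → w ∈ r ∷ us)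
  outerWalk {r} b with outer-spec b
  ... | x , a , eq , all with orbit-shape (∈-darts⁺ G a)
  ...   | p , shape , per = applyUpTo (g ∘ suc) p ,
            subst (Walk r (applyUpTo (g ∘ suc) p)) (cong proj₁ per) (sequence g p adjacent) ,
            trans (cong length (trans eq shape))
              (trans (List.length-applyUpTo (λ i → iter next i (r , x)) (suc p))
                     (cong suc (sym (List.length-applyUpTo (g ∘ suc) p)))) ,
            visited
    where
    g : ℕ → Fin n
    g i = proj₁ (iter next i (r , x))
    adjacent : ∀ i → Adj G (g i) (g (suc i))
    adjacent i = ∈-darts⁻ G (iter-∈ i (∈-darts⁺ G a))
    sequence : ∀ (g : ℕ → Fin n) m → (∀ i → Adj G (g i) (g (suc i))) →
               Walk (g 0) (applyUpTo (g ∘ suc) m) (g (suc m))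
    sequence g zero    adj = edge (adj 0)
    sequence g (suc m) adj = adj 0 ∷ sequence (g ∘ suc) m (adj ∘ suc)
    visited : ∀ {w} → w ∈ component G r → w ∈ r ∷ applyUpTo (g ∘ suc) p
    visited {w} m with all w (proj₂ (∈-filter⁻ (connected? G r) {xs = allFin n} m))
    ... | y , _ , s = subst (w ∈_)
      (trans (cong (map proj₁) shape) (List.map-applyUpTo (λ i → iter next i (r , x)) proj₁ (suc p)))
      (∈-map⁺ proj₁ (∈-orbit⁺ (∈-darts⁺ G a) s))

-- Graphs with a large component

linked-lookup : ∀ {A : Set} {R : Rel A 0ℓ} {xs} → Linked R xs → ∀ i j → toℕ j ≡ suc (toℕ i) →
                R (lookup xs i) (lookup xs j)
linked-lookup (r ∷ l) zero    (suc zero) refl = r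
linked-lookup (r ∷ l) (suc i) (suc j)    eq   = linked-lookup l i j (ℕ.suc-injective eq)

unique-lookup : ∀ {A : Set} {xs : List A} → Unique xs → ∀ i j → lookup xs i ≡ lookup xs j → i ≡ j
unique-lookup (p ∷ u) zero    zero    _  = refl
unique-lookup (p ∷ u) (suc i) (suc j) eq = cong suc (unique-lookup u i j eq)
unique-lookup {xs = x ∷ xs} (p ∷ u) zero    (suc j) eq = contradiction eq (All.lookup p (∈-lookup j))
unique-lookup {xs = x ∷ xs} (p ∷ u) (suc i) zero    eq = contradiction (sym eq) (All.lookup p (∈-lookup i))

pathFree-short : ∀ {n k} {G : Graph n} → P k -Free G → ∀ {xs} → Linked (Adj G) xs → Unique xs → length xs < k
pathFree-short {n} {k} {G} free {xs} l u with k ≤? length xs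
... | no k≰ = ℕ.≰⇒> k≰
... | yes k≤ = contradiction (f , (λ {i} {j} → inj {i} {j}) , hom) free
  where
  position : Fin k → Fin (length xs)
  position i = Fin.inject≤ i k≤
  f : Fin k → Fin n
  f i = lookup xs (position i)
  inj : Injective _≡_ _≡_ f
  inj {i} {j} eq = Fin.inject≤-injective k≤ k≤ i j (unique-lookup u (position i) (position j) eq)
  step : ∀ i j → toℕ j ≡ suc (toℕ i) → Adj G (f i) (f j)
  step i j eq = linked-lookup l (position i) (position j)
    (trans (Fin.toℕ-inject≤ j k≤) (trans eq (cong suc (sym (Fin.toℕ-inject≤ i k≤)))))
  hom : ∀ i j → Adj (P k) i j → Adj G (f i) (f j)
  hom i j a with P-adj⁻ i j a
  ... | inj₁ eq = step i j eq
  ... | inj₂ eq = adj-sym G (step j i eq)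

module LargeComponent {n : ℕ} (G : Graph n) (outerplanar : Outerplanar G)
  (d e : ℕ) (e≤1+d : e ≤ suc d) (free : P (2 + d + e) -Free G)
  (u : Fin n) (large : 2 + d + e ≤ length (component G u)) where

  open Euler G (proj₁ outerplanar) (proj₁ (proj₂ outerplanar))
    (proj₁ (proj₂ (proj₂ outerplanar))) (proj₂ (proj₂ (proj₂ outerplanar)))
  open Faces.Outer G (proj₁ outerplanar) (proj₁ (proj₂ outerplanar))
    (proj₁ (proj₂ (proj₂ outerplanar))) (proj₂ (proj₂ (proj₂ outerplanar))) using (outer)
  open Walks (Fin._≟_ {n}) {R = Adj G} (λ {u} {v} → adj-sym G {u} {v}) (λ {u} → adj-irrefl G {u})
  open PathFree (Fin._≟_ {n}) {R = Adj G} (λ {u} {v} → adj-sym G {u} {v}) (λ {u} → adj-irrefl G {u})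
    d e e≤1+d (λ l u → ℕ.≤-pred (pathFree-short {G = G} free l u))

  private
    component-unique : ∀ r → Unique (component G r)
    component-unique r = Unique.filter⁺ (connected? G r) (Unique.allFin⁺ n)

    component⁻ : ∀ {r w} → w ∈ component G r → Connected G r w
    component⁻ {r} m = proj₂ (∈-filter⁻ (connected? G r) {xs = allFin n} m)

  -- A lone vertex has `l = 0` and needs a case of its own. The outer walk of a component with at
  -- least `k` vertices must repeat a vertex, since otherwise it would contain a path on `k`
  -- vertices; so `closedWalk≤` applies.
  component-bounds : ∀ r → let a = length (component G r); l = length (outer r) in
    (a ≤ 1) ⊎ (a ≤ 1 + d + e × a ≤ l) ⊎ (2 + d + e ≤ a × suc d * a ≤ d * l + suc e)
  component-bounds r = cases (Subset.nonempty? (Graph.N G r))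
    where
    a = length (component G r)
    l = length (outer r)
    cases : Dec (∃[ v ] Adj G r v) → (a ≤ 1) ⊎ (a ≤ 1 + d + e × a ≤ l) ⊎ (2 + d + e ≤ a × suc d * a ≤ d * l + suc e)
    cases (no none) = inj₁ (unique-length-≤ (component-unique r) single)
      where
      single : ∀ {w} → w ∈ component G r → w ∈ r ∷ []
      single m with component⁻ m
      ... | ε     = here refl
      ... | a ◅ _ = contradiction (_ , a) none
    cases (yes (v , b)) with outerWalk b | 2 + d + e ≤? a
    ... | us , wk , len , visited | no k≰ = inj₂ (inj₁ (ℕ.≤-pred (ℕ.≰⇒> k≰) ,
      subst (a ≤_) (sym len) (unique-length-≤ (component-unique r) visited)))
    ... | us , wk , len , visited | yes k≤ = inj₂ (inj₂ (k≤ ,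
      subst (λ l → suc d * a ≤ d * l + suc e) (sym len)
        (closedWalk≤ (suc (length us)) ℕ.≤-refl wk repeats (component-unique r) visited)))
      where
      repeats : ¬ Unique (r ∷ us)
      repeats u = ℕ.<⇒≱ (pathFree-short {G = G} free (linked wk) u)
        (ℕ.≤-trans k≤ (unique-length-≤ (component-unique r) visited))

  private
    rep : ∃[ s ] s ∈ reps × Connected G s u
    rep = representative u

    s : Fin n
    s = proj₁ rep

    s-large : 2 + d + e ≤ length (component G s)
    s-large = ℕ.≤-trans large (unique-length-≤ (component-unique u)
      λ {w} m → ∈-filter⁺ (connected? G s) (∈-allFin w) (proj₂ (proj₂ rep) ◅◅ component⁻ m))

    s-bound : suc d * length (component G s) ≤ d * length (outer s) + suc e
    s-bound with component-bounds s
    ... | inj₁ a≤1              = contradiction (ℕ.≤-trans s-large a≤1) λ { (s≤s ()) }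
    ... | inj₂ (inj₁ (a≤ , _))  = contradiction (ℕ.≤-trans s-large a≤) ℕ.1+n≰n
    ... | inj₂ (inj₂ (_ , b))   = b

  -- The weights `d + 1` and `d` come from the walk inequality, which a large component satisfies
  -- with constant `e + 1` where `3 d` is allowed; `δ` is the difference. The condition
  -- `1 + d + e ≤ 3 d` makes room for the largest components with fewer than `k` vertices.
  size≤ : ∀ δ → δ + suc e ≡ 3 * d → 1 + d + e ≤ 3 * d → d * size G + (suc d * n + δ) ≤ d * (3 * n)
  size≤ δ δ≡ 3d≥ = size-bound (suc d) d δ (proj₁ (proj₂ rep)) (λ {r} _ → bound r) gap
    where
    open ℕ.≤-Reasoning
    bound : ∀ r → suc d * length (component G r) ≤ 3 * d + d * length (outer r)
    bound r with component-bounds r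
    ... | inj₁ a≤1 = begin
      suc d * length (component G r)     ≤⟨ ℕ.*-monoʳ-≤ (suc d) a≤1 ⟩
      suc d * 1                          ≡⟨ ℕ.*-identityʳ (suc d) ⟩
      suc d                              ≤⟨ ℕ.≤-trans (ℕ.m≤m+n (suc d) e) 3d≥ ⟩
      3 * d                              ≤⟨ ℕ.m≤m+n (3 * d) _ ⟩
      3 * d + d * length (outer r)       ∎
    ... | inj₂ (inj₁ (a≤ , a≤l)) = ℕ.+-mono-≤ (ℕ.≤-trans a≤ 3d≥) (ℕ.*-monoʳ-≤ d a≤l)
    ... | inj₂ (inj₂ (_ , b)) = begin
      suc d * length (component G r)     ≤⟨ b ⟩
      d * length (outer r) + suc e       ≤⟨ ℕ.+-monoʳ-≤ _ (ℕ.≤-trans (s≤s (ℕ.m≤n+m e d)) 3d≥) ⟩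
      d * length (outer r) + 3 * d       ≡⟨ ℕ.+-comm _ (3 * d) ⟩
      3 * d + d * length (outer r)       ∎
    gap : suc d * length (component G s) + δ ≤ 3 * d + d * length (outer s)
    gap = begin
      suc d * length (component G s) + δ       ≤⟨ ℕ.+-monoˡ-≤ δ s-bound ⟩
      (d * length (outer s) + suc e) + δ       ≡⟨ ℕ.+-assoc _ (suc e) δ ⟩
      d * length (outer s) + (suc e + δ)       ≡⟨ cong (d * length (outer s) +_) (trans (ℕ.+-comm (suc e) δ) δ≡) ⟩
      d * length (outer s) + 3 * d             ≡⟨ ℕ.+-comm _ (3 * d) ⟩
      3 * d + d * length (outer s)             ∎

  -- The weights 7 and 4 make `7 a ≤ 12 + 4 l` an equality for `a = l = 4`, the case of K₄ minus an
  -- edge. A large component has `2 a ≤ l + 3`, hence `8 a ≤ 12 + 4 l`, which saves `a ≥ 5`.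
  size≤-P₅ : d ≡ 1 → e ≡ 2 → 4 * size G + (7 * n + 5) ≤ 4 * (3 * n)
  size≤-P₅ refl refl = size-bound 7 4 5 (proj₁ (proj₂ rep)) (λ {r} _ → bound r) (large-bound s-large s-bound)
    where
    open ℕ.≤-Reasoning
    large-bound : ∀ {a l} → 5 ≤ a → 2 * a ≤ 1 * l + 3 → 7 * a + 5 ≤ 12 + 4 * l
    large-bound {a} {l} 5≤a b = begin
      7 * a + 5         ≤⟨ ℕ.+-monoʳ-≤ (7 * a) 5≤a ⟩
      7 * a + a         ≡⟨ rearrange a ⟩
      4 * (2 * a)       ≤⟨ ℕ.*-monoʳ-≤ 4 b ⟩
      4 * (1 * l + 3)   ≡⟨ rearrange′ l ⟩
      12 + 4 * l        ∎
      where
      rearrange : ∀ a → 7 * a + a ≡ 4 * (2 * a)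
      rearrange = solve-∀
      rearrange′ : ∀ l → 4 * (1 * l + 3) ≡ 12 + 4 * l
      rearrange′ = solve-∀
    bound : ∀ r → 7 * length (component G r) ≤ 12 + 4 * length (outer r)
    bound r with component-bounds r
    ... | inj₁ a≤1 = ℕ.≤-trans (ℕ.*-monoʳ-≤ 7 a≤1)
                       (ℕ.≤-trans (ℕ.m≤m+n 7 5) (ℕ.m≤m+n 12 _))
    ... | inj₂ (inj₁ (a≤4 , a≤l)) = ℕ.≤-trans (ℕ.≤-reflexive (ℕ.*-distribʳ-+ (length (component G r)) 3 4))
                                      (ℕ.+-mono-≤ (ℕ.*-monoʳ-≤ 3 a≤4) (ℕ.*-monoʳ-≤ 4 a≤l))
    ... | inj₂ (inj₂ (5≤a , b)) = ℕ.≤-trans (ℕ.m≤m+n _ 5) (large-bound 5≤a b)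

-- Counting equivalence classes

unique-length-≡ : ∀ {A : Set} {xs ys : List A} → Unique xs → Unique ys →
  (∀ {x} → x ∈ xs → x ∈ ys) → (∀ {x} → x ∈ ys → x ∈ xs) → length xs ≡ length ys
unique-length-≡ u u′ sub sup = ℕ.≤-antisym (unique-length-≤ u sub) (unique-length-≤ u′ sup)

-- On `xs` the label is a complete invariant of the classes and its values are exactly `ys`;
-- matchings in both directions give the equality. Components and faces of the fan forests are
-- counted in this way.
deduplicate-count : ∀ {A B : Set} {R : Rel A 0ℓ} (R? : Decidable R) →
  (∀ {x} → R x x) → (∀ {x y z} → R x y → R y z → R x z) →
  (label : A → B) (xs : List A) {ys : List B} → Unique ys →
  (∀ {x} → x ∈ xs → label x ∈ ys) → (∀ {y} → y ∈ ys → ∃[ x ] x ∈ xs × label x ≡ y) →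
  (∀ {x y} → x ∈ xs → y ∈ xs → R x y → label x ≡ label y) →
  (∀ {x y} → x ∈ xs → y ∈ xs → label x ≡ label y → R x y) →
  length (deduplicate R? xs) ≡ length ys
deduplicate-count {R = R} R? r t label xs {ys} u into onto sound complete =
  ℕ.≤-antisym
    (matching-length-≤ (λ x y → label x ≡ y)
      (AllPairs-map-∈ (λ x∈ x′∈ ¬Rxx′ y e e′ →
          ¬Rxx′ (complete (deduplicate-⊆ R? xs x∈) (deduplicate-⊆ R? xs x′∈) (trans e (sym e′))))
        (deduplicate-apart R? xs))
      (λ {x} x∈ → label x , into (deduplicate-⊆ R? xs x∈) , refl))
    (matching-length-≤ (λ y x → label x ≡ y)
      (AllPairs.map (λ y≢y′ x e e′ → y≢y′ (trans (sym e) e′)) u)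
      represent)
  where
  represent : ∀ {y} → y ∈ ys → ∃[ x ] x ∈ deduplicate R? xs × label x ≡ y
  represent y∈ with onto y∈
  ... | x , x∈ , refl with deduplicate-represents R? r t xs x∈
  ...   | x′ , x′∈ , Rx′x = x′ , x′∈ , sound (deduplicate-⊆ R? xs x′∈) x∈ Rx′x

module FromRelation {n : ℕ} {R : Rel (Fin n) 0ℓ} (R? : Decidable R)
  (R-sym : ∀ {u v} → R u v → R v u) (R-irrefl : ∀ {u} → ¬ R u u) where

  private
    row : Fin n → Subset.Subset n
    row u = tabulate (λ v → does (R? u v))

    lookup-row : ∀ u v → Vec.lookup (Vec.lookup (tabulate row) u) v ≡ does (R? u v)
    lookup-row u v = trans (cong (λ s → Vec.lookup s v) (Vec.lookup∘tabulate row u))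
                           (Vec.lookup∘tabulate (λ v → does (R? u v)) v)

    row⁻ : ∀ u v → v Subset.∈ Vec.lookup (tabulate row) u → R u v
    row⁻ u v m with R? u v | trans (sym (lookup-row u v)) (Vec.[]=⇒lookup m)
    ... | yes r | _  = r
    ... | no  _ | ()

    row⁺ : ∀ u v → R u v → v Subset.∈ Vec.lookup (tabulate row) u
    row⁺ u v r = Vec.lookup⇒[]= v _ (trans (lookup-row u v) (dec-true (R? u v) r))

  graph : Graph n
  graph = record
    { neighbours  = tabulate row
    ; symmetric   = λ u v m → row⁺ v u (R-sym (row⁻ u v m))
    ; irreflexive = λ u m → R-irrefl (row⁻ u u m)
    }

  adj⁻ : ∀ {u v} → Adj graph u v → R u v
  adj⁻ = row⁻ _ _

  adj⁺ : ∀ {u v} → R u v → Adj graph u v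
  adj⁺ = row⁺ _ _

-- Forests of fans

data Kind : Set where
  centre first cont : Kind

_≟ᴷ_ : DecidableEquality Kind
centre ≟ᴷ centre = yes refl
centre ≟ᴷ first  = no λ ()
centre ≟ᴷ cont   = no λ ()
first  ≟ᴷ centre = no λ ()
first  ≟ᴷ first  = yes refl
first  ≟ᴷ cont   = no λ ()
cont   ≟ᴷ centre = no λ ()
cont   ≟ᴷ first  = no λ ()
cont   ≟ᴷ cont   = yes refl

kindCase : {A : Set} → Kind → A → A → A → A
kindCase centre x y z = x
kindCase first  x y z = y
kindCase cont   x y z = z

-- Vertex j is joined to the last centre before it and, if its kind is cont, to
-- j - 1.  So each centre is followed by the paths of its fan, each path
-- consisting of a vertex of kind first and vertices of kind cont.  All numbers
-- from n on count as centres, which ends the last path.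
module Fans (m : ℕ) (kind : ℕ → Kind) (kind-0 : kind 0 ≡ centre)
  (legal : ∀ i → kind i ≡ centre → kind (suc i) ≢ cont)
  (bounded : ∀ i → kind i ≢ centre → i < suc m) where

  n : ℕ
  n = suc m

  cen : ℕ → ℕ
  cen zero    = zero
  cen (suc i) = kindCase (kind (suc i)) (suc i) (cen i) (cen i)

  centre≢first : ∀ {i} → kind i ≡ first → kind i ≢ centre
  centre≢first e e′ with trans (sym e) e′
  ... | ()

  centre≢cont : ∀ {i} → kind i ≡ cont → kind i ≢ centre
  centre≢cont e e′ with trans (sym e) e′
  ... | ()

  first≢cont : ∀ {i} → kind i ≡ first → kind i ≢ cont
  first≢cont e e′ with trans (sym e) e′
  ... | ()

  kinds : ∀ i → kind i ≡ centre ⊎ kind i ≡ first ⊎ kind i ≡ cont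
  kinds i with kind i
  ... | centre = inj₁ refl
  ... | first  = inj₂ (inj₁ refl)
  ... | cont   = inj₂ (inj₂ refl)

  cen≤ : ∀ i → cen i ≤ i
  cen≤ zero = z≤n
  cen≤ (suc i) with kind (suc i)
  ... | centre = ℕ.≤-refl
  ... | first  = ℕ.m≤n⇒m≤1+n (cen≤ i)
  ... | cont   = ℕ.m≤n⇒m≤1+n (cen≤ i)

  cen-centre : ∀ {i} → kind i ≡ centre → cen i ≡ i
  cen-centre {zero}  _ = refl
  cen-centre {suc i} e rewrite e = refl

  cen-suc : ∀ {i} → kind (suc i) ≢ centre → cen (suc i) ≡ cen i
  cen-suc {i} nc with kind (suc i)
  ... | centre = contradiction refl nc
  ... | first  = refl
  ... | cont   = refl

  centre-cen : ∀ i → kind (cen i) ≡ centre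
  centre-cen zero = kind-0
  centre-cen (suc i) with kind (suc i) in e
  ... | centre = e
  ... | first  = centre-cen i
  ... | cont   = centre-cen i

  cen< : ∀ {i} → kind i ≢ centre → cen i < i
  cen< {zero}  nc = contradiction kind-0 nc
  cen< {suc i} nc = s≤s (subst (_≤ i) (sym (cen-suc nc)) (cen≤ i))

  noncentre-pred : ∀ {i} → kind (suc i) ≡ cont → kind i ≢ centre
  noncentre-pred {i} e c = legal i c e

  first-after-centre : ∀ {i} → kind i ≡ centre → kind (suc i) ≢ centre → kind (suc i) ≡ first
  first-after-centre {i} c nc with kinds (suc i)
  ... | inj₁ e        = contradiction e nc
  ... | inj₂ (inj₁ e) = e
  ... | inj₂ (inj₂ e) = contradiction e (legal i c)

  first-of-fan : ∀ {i} → kind i ≢ centre → kind (suc (cen i)) ≡ first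
  first-of-fan {zero}  nc = contradiction kind-0 nc
  first-of-fan {suc i} nc rewrite cen-suc nc with kind i ≟ᴷ centre
  ... | no  nc′ = first-of-fan nc′
  ... | yes c   = subst (λ j → kind (suc j) ≡ first) (sym (cen-centre c)) (first-after-centre c nc)

  cen-first-of-fan : ∀ {i} → kind i ≢ centre → cen (suc (cen i)) ≡ cen i
  cen-first-of-fan {i} nc = trans (cen-suc (centre≢first (first-of-fan nc))) (cen-centre (centre-cen i))

  -- The continuation of the outer walk at a path vertex: to its right neighbour, or back to the
  -- centre at the end of the path.
  onward : ℕ → ℕ
  onward u = kindCase (kind (suc u)) (cen u) (cen u) (suc u)

  -- Around a centre the spokes follow in numerical order, and the last is followed by the first,
  -- `suc u`. Around a path vertex the order is centre, left neighbour, right neighbour, where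
  -- missing neighbours are skipped.
  ρ : ℕ → ℕ → ℕ
  ρ u v = kindCase (kind u)
    (kindCase (kind (suc v)) (suc u) (suc v) (suc v))
    (if does (v ℕ.≟ cen u) then onward u else cen u)
    (if does (v ℕ.≟ cen u) then pred u else if does (v ℕ.≟ pred u) then onward u else cen u)

  -- The faces are labelled by the centres (outer faces) and the vertices of
  -- kind cont (the triangle of i, i - 1 and their centre).
  label : ℕ → ℕ → ℕ
  label u v = kindCase (kind u) (kindCase (kind v) u u v) side side
    where
    side = if does (v ℕ.≟ cen u) then kindCase (kind (suc u)) (cen u) (cen u) (suc u)
           else if does (v ℕ.≟ suc u) then cen u else u

  onward-cont : ∀ {u} → kind (suc u) ≡ cont → onward u ≡ suc u
  onward-cont e rewrite e = refl

  onward-last : ∀ {u} → kind (suc u) ≢ cont → onward u ≡ cen u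
  onward-last {u} ne with kind (suc u)
  ... | centre = refl
  ... | first  = refl
  ... | cont   = contradiction refl ne

  private
    if-≡ : ∀ {A : Set} {i j : ℕ} {x y : A} → i ≡ j → (if does (i ℕ.≟ j) then x else y) ≡ x
    if-≡ {i = i} {j} {x} {y} e = cong (λ b → if b then x else y) (dec-true (i ℕ.≟ j) e)

    if-≢ : ∀ {A : Set} {i j : ℕ} {x y : A} → i ≢ j → (if does (i ℕ.≟ j) then x else y) ≡ y
    if-≢ {i = i} {j} {x} {y} ne = cong (λ b → if b then x else y) (dec-false (i ℕ.≟ j) ne)

    suc≢cen : ∀ u → suc u ≢ cen u
    suc≢cen u e = ℕ.1+n≰n (subst (_≤ u) (sym e) (cen≤ u))

    pred≢cen : ∀ {i} → kind (suc i) ≡ cont → i ≢ cen (suc i)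
    pred≢cen {i} e eq = ℕ.<⇒≢ (cen< (noncentre-pred e)) (trans (sym (cen-suc (centre≢cont e))) (sym eq))

  ρ-next : ∀ {u v} → kind u ≡ centre → kind (suc v) ≢ centre → ρ u v ≡ suc v
  ρ-next {u} {v} c nc rewrite c with kind (suc v)
  ... | centre = contradiction refl nc
  ... | first  = refl
  ... | cont   = refl

  ρ-wrap : ∀ {u v} → kind u ≡ centre → kind (suc v) ≡ centre → ρ u v ≡ suc u
  ρ-wrap c c′ rewrite c | c′ = refl

  ρ-first : ∀ {u} → kind u ≡ first → ρ u (cen u) ≡ onward u
  ρ-first {u} e rewrite e = if-≡ {i = cen u} refl

  private
    kindCase-cont : ∀ {A : Set} {k} {x y z : A} → k ≡ cont → kindCase k x y z ≡ z
    kindCase-cont refl = refl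

  ρ-cont : ∀ {i} → kind (suc i) ≡ cont → ρ (suc i) (cen (suc i)) ≡ i
  ρ-cont {i} e = trans (kindCase-cont e) (if-≡ {i = cen (suc i)} refl)

  ρ-left : ∀ {i} → kind (suc i) ≡ cont → ρ (suc i) i ≡ onward (suc i)
  ρ-left {i} e = trans (kindCase-cont e) (trans (if-≢ (pred≢cen e)) (if-≡ {i = i} refl))

  ρ-right : ∀ {i} → kind (suc i) ≡ cont → ρ i (suc i) ≡ cen i
  ρ-right {i} e with kinds i
  ... | inj₁ c                = contradiction c (noncentre-pred e)
  ... | inj₂ (inj₁ k) rewrite k = if-≢ (suc≢cen i)
  ... | inj₂ (inj₂ k) rewrite k = trans (if-≢ (suc≢cen i))
          (if-≢ (λ eq → ℕ.1+n≰n (subst (_≤ i) (sym eq) (ℕ.pred[n]≤n {i}))))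

  label-first : ∀ {i} → kind i ≡ first → label (cen i) i ≡ cen i
  label-first {i} e rewrite centre-cen i | e = refl

  label-cont : ∀ {i} → kind i ≡ cont → label (cen i) i ≡ i
  label-cont {i} e rewrite centre-cen i | e = refl

  private
    label-side : ∀ {u v} → kind u ≢ centre → label u v ≡
      (if does (v ℕ.≟ cen u) then kindCase (kind (suc u)) (cen u) (cen u) (suc u)
       else if does (v ℕ.≟ suc u) then cen u else u)
    label-side {u} {v} nc with kind u
    ... | centre = contradiction refl nc
    ... | first  = refl
    ... | cont   = refl

  label-right : ∀ {i} → kind (suc i) ≡ cont → label i (suc i) ≡ cen i
  label-right {i} e = trans (label-side (noncentre-pred e))
    (trans (if-≢ (suc≢cen i)) (if-≡ {i = suc i} refl))

  label-last : ∀ {u} → kind u ≢ centre → kind (suc u) ≢ cont → label u (cen u) ≡ cen u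
  label-last {u} nc ne = trans (label-side nc) (trans (if-≡ {i = cen u} refl) (onward-last ne))

  label-in : ∀ {i} → kind (suc i) ≡ cont → label i (cen i) ≡ suc i
  label-in {i} e = trans (label-side (noncentre-pred e)) (trans (if-≡ {i = cen i} refl) (onward-cont e))

  label-left : ∀ {i} → kind (suc i) ≡ cont → label (suc i) i ≡ suc i
  label-left {i} e = trans (label-side (centre≢cont e)) (trans (if-≢ (pred≢cen e))
    (if-≢ λ eq → ℕ.1+n≰n (ℕ.≤-trans (ℕ.n≤1+n (suc i)) (ℕ.≤-reflexive (sym eq)))))

  label-onward : ∀ {u} → kind u ≢ centre → label u (onward u) ≡ cen u
  label-onward {u} nc with kind (suc u) ≟ᴷ cont
  ... | yes e  = trans (cong (label u) (onward-cont e)) (label-right e)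
  ... | no  ne = trans (cong (label u) (onward-last ne)) (label-last nc ne)

  data Edge : ℕ → ℕ → Set where
    spoke : ∀ {j} → kind j ≢ centre → Edge (cen j) j
    rim   : ∀ {i} → kind (suc i) ≡ cont → Edge i (suc i)

  edge< : ∀ {i j} → Edge i j → i < j
  edge< (spoke nc) = cen< nc
  edge< (rim e)    = ℕ.≤-refl

  edge-bounded : ∀ {i j} → Edge i j → j < n
  edge-bounded (spoke nc) = bounded _ nc
  edge-bounded (rim e)    = bounded _ (centre≢cont e)

  edge-cen : ∀ {i j} → Edge i j → cen i ≡ cen j
  edge-cen (spoke {j} nc) = cen-centre (centre-cen j)
  edge-cen (rim e)        = sym (cen-suc (centre≢cont e))

  edge? : Decidable Edge
  edge? i j = map′ to from
    ((¬? (kind j ≟ᴷ centre) ×-dec (i ℕ.≟ cen j)) ⊎-dec ((kind j ≟ᴷ cont) ×-dec (j ℕ.≟ suc i)))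
    where
    to : (kind j ≢ centre × i ≡ cen j) ⊎ (kind j ≡ cont × j ≡ suc i) → Edge i j
    to (inj₁ (nc , refl)) = spoke nc
    to (inj₂ (e , refl))  = rim e
    from : Edge i j → (kind j ≢ centre × i ≡ cen j) ⊎ (kind j ≡ cont × j ≡ suc i)
    from (spoke nc) = inj₁ (nc , refl)
    from (rim e)    = inj₂ (e , refl)

  Adjacent : Rel ℕ 0ℓ
  Adjacent u v = Edge u v ⊎ Edge v u

  adjacent-bounded : ∀ {u v} → Adjacent u v → u < n × v < n
  adjacent-bounded (inj₁ e) = ℕ.<-trans (edge< e) (edge-bounded e) , edge-bounded e
  adjacent-bounded (inj₂ e) = edge-bounded e , ℕ.<-trans (edge< e) (edge-bounded e)

  adjacent-cen : ∀ {u v} → Adjacent u v → cen u ≡ cen v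
  adjacent-cen (inj₁ e) = edge-cen e
  adjacent-cen (inj₂ e) = sym (edge-cen e)

  adjacent-onward : ∀ {u} → kind u ≢ centre → Adjacent u (onward u)
  adjacent-onward {u} nc with kind (suc u) ≟ᴷ cont
  ... | yes e  = subst (Adjacent u) (sym (onward-cont e)) (inj₁ (rim e))
  ... | no  ne = subst (Adjacent u) (sym (onward-last ne)) (inj₂ (spoke nc))

  private
    spoke′ : ∀ {c j} → kind j ≢ centre → cen j ≡ c → Edge c j
    spoke′ nc refl = spoke nc

  -- This makes the label an invariant of faces: a step either continues the outer walk of its
  -- centre or stays in the triangle of one vertex of kind `cont`.
  label-next : ∀ {u v} → Adjacent u v → label v (ρ v u) ≡ label u v
  label-next (inj₁ (spoke {j} nc)) with kinds j
  ... | inj₁ c = contradiction c nc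
  ... | inj₂ (inj₁ e) = trans (cong (label j) (ρ-first e)) (trans (label-onward nc) (sym (label-first e)))
  label-next (inj₁ (spoke {suc i} nc)) | inj₂ (inj₂ e) =
    trans (cong (label (suc i)) (ρ-cont e)) (trans (label-left e) (sym (label-cont e)))
  label-next (inj₁ (spoke {zero} nc)) | inj₂ (inj₂ e) = contradiction kind-0 nc
  label-next (inj₁ (rim {i} e)) = trans (cong (label (suc i)) (ρ-left e))
    (trans (label-onward (centre≢cont e)) (trans (cen-suc (centre≢cont e)) (sym (label-right e))))
  label-next (inj₂ (rim {i} e)) = trans (cong (label i) (ρ-right e)) (trans (label-in e) (sym (label-left e)))
  label-next (inj₂ (spoke {j} nc)) with kinds (suc j)
  ... | inj₁ c = trans (cong (label (cen j)) (ρ-wrap (centre-cen j) c))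
          (trans (cong (λ i → label i (suc (cen j))) (sym (cen-first-of-fan nc)))
          (trans (label-first (first-of-fan nc))
          (trans (cen-first-of-fan nc) (sym (label-last nc λ e → centre≢cont e c)))))
  ... | inj₂ (inj₁ e) = trans (cong (label (cen j)) (ρ-next (centre-cen j) (centre≢first e)))
          (trans (cong (λ i → label i (suc j)) (sym (cen-suc (centre≢first e))))
          (trans (label-first e)
          (trans (cen-suc (centre≢first e)) (sym (label-last nc (first≢cont e))))))
  ... | inj₂ (inj₂ e) = trans (cong (label (cen j)) (ρ-next (centre-cen j) (centre≢cont e)))
          (trans (cong (λ i → label i (suc j)) (sym (cen-suc (centre≢cont e))))
          (trans (label-cont e) (sym (label-in e))))

  ρ-adjacent : ∀ {u v} → Adjacent u v → Adjacent u (ρ u v)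
  ρ-adjacent (inj₁ (spoke {j} nc)) with kind (suc j) ≟ᴷ centre
  ... | yes c  = subst (Adjacent (cen j)) (sym (ρ-wrap (centre-cen j) c))
                   (inj₁ (spoke′ (centre≢first (first-of-fan nc)) (cen-first-of-fan nc)))
  ... | no nc′ = subst (Adjacent (cen j)) (sym (ρ-next (centre-cen j) nc′)) (inj₁ (spoke′ nc′ (cen-suc nc′)))
  ρ-adjacent (inj₁ (rim {i} e)) = subst (Adjacent i) (sym (ρ-right e)) (inj₂ (spoke (noncentre-pred e)))
  ρ-adjacent (inj₂ (rim {i} e)) = subst (Adjacent (suc i)) (sym (ρ-left e)) (adjacent-onward (centre≢cont e))
  ρ-adjacent (inj₂ (spoke {j} nc)) with kinds j
  ... | inj₁ c = contradiction c nc
  ... | inj₂ (inj₁ e) = subst (Adjacent j) (sym (ρ-first e)) (adjacent-onward nc)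
  ρ-adjacent (inj₂ (spoke {suc i} nc)) | inj₂ (inj₂ e) = subst (Adjacent (suc i)) (sym (ρ-cont e)) (inj₂ (rim e))
  ρ-adjacent (inj₂ (spoke {zero} nc)) | inj₂ (inj₂ e) = contradiction kind-0 nc

-- The plane drawing of a fan forest

length-filter-× : ∀ {A : Set} {P Q : A → Set} (P? : Pred.Decidable P) (Q? : Pred.Decidable Q) xs →
  length (filter (λ x → P? x ×-dec ¬? (Q? x)) xs) + length (filter (λ x → P? x ×-dec Q? x) xs)
  ≡ length (filter P? xs)
length-filter-× P? Q? []       = refl
length-filter-× P? Q? (x ∷ xs) with P? x | Q? x | length-filter-× P? Q? xs
... | no  _ | _     | ih = ih
... | yes _ | yes _ | ih = trans (ℕ.+-suc _ _) (cong suc ih)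
... | yes _ | no  _ | ih = cong suc ih

module FanForest (m : ℕ) (kind : ℕ → Kind) (kind-0 : kind 0 ≡ centre)
  (legal : ∀ i → kind i ≡ centre → kind (suc i) ≢ cont)
  (bounded : ∀ i → kind i ≢ centre → i < suc m) where

  open Fans m kind kind-0 legal bounded public

  -- The rotation is tabulated for all pairs, and between vertices that are not adjacent `ρ` may
  -- leave the range; the default `zero` is harmless there.
  fin : ℕ → Fin n
  fin i with i <? n
  ... | yes i<n = fromℕ< i<n
  ... | no  _   = zero

  toℕ-fin : ∀ {i} → i < n → toℕ (fin i) ≡ i
  toℕ-fin {i} i<n with i <? n
  ... | yes _   = Fin.toℕ-fromℕ< _
  ... | no  i≮n = contradiction i<n i≮n

  fin-toℕ : ∀ u → fin (toℕ u) ≡ u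
  fin-toℕ u = Fin.toℕ-injective (toℕ-fin (Fin.toℕ<n u))

  private
    adjacent-sym : ∀ {u v : Fin n} → Adjacent (toℕ u) (toℕ v) → Adjacent (toℕ v) (toℕ u)
    adjacent-sym (inj₁ e) = inj₂ e
    adjacent-sym (inj₂ e) = inj₁ e

    adjacent-irrefl : ∀ {u : Fin n} → ¬ Adjacent (toℕ u) (toℕ u)
    adjacent-irrefl (inj₁ e) = ℕ.n≮n _ (edge< e)
    adjacent-irrefl (inj₂ e) = ℕ.n≮n _ (edge< e)

  open FromRelation {n} {λ u v → Adjacent (toℕ u) (toℕ v)}
    (λ u v → edge? (toℕ u) (toℕ v) ⊎-dec edge? (toℕ v) (toℕ u))
    (λ {u} {v} → adjacent-sym {u} {v}) (λ {u} → adjacent-irrefl {u}) public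

  adj-fin : ∀ {u v} → Adjacent u v → Adj graph (fin u) (fin v)
  adj-fin a = adj⁺ (subst₂ Adjacent (sym (toℕ-fin (proj₁ (adjacent-bounded a))))
                                    (sym (toℕ-fin (proj₂ (adjacent-bounded a)))) a)

  rotation : Vec (Vec (Fin n) n) n
  rotation = tabulate (λ u → tabulate (λ v → fin (ρ (toℕ u) (toℕ v))))

  open Rotation graph rotation using (next; SameFace; sameFace?; IsRotation; IsPlanar; AllOnOuterFace; walkCount)
    renaming (ρ to ρᶠ)

  ρᶠ≡ : ∀ u v → ρᶠ u v ≡ fin (ρ (toℕ u) (toℕ v))
  ρᶠ≡ u v = trans (cong (λ r → Vec.lookup r v) (Vec.lookup∘tabulate (λ u → tabulate (λ v → fin (ρ (toℕ u) (toℕ v)))) u))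
                  (Vec.lookup∘tabulate (λ v → fin (ρ (toℕ u) (toℕ v))) v)

  ρᶠ-fin : ∀ {u v} → u < n → v < n → ρᶠ (fin u) (fin v) ≡ fin (ρ u v)
  ρᶠ-fin u< v< = trans (ρᶠ≡ _ _) (cong₂ (λ u v → fin (ρ u v)) (toℕ-fin u<) (toℕ-fin v<))

  private
    Turn : ℕ → ℕ → ℕ → Set
    Turn u x y = Adjacent u x × ρ u x ≡ y

    spokes : ∀ {u v} → kind u ≡ centre → Adjacent u v → kind v ≢ centre × cen v ≡ u
    spokes c (inj₁ (spoke nc)) = nc , refl
    spokes c (inj₁ (rim e))    = contradiction e (legal _ c)
    spokes c (inj₂ (spoke nc)) = contradiction c nc
    spokes c (inj₂ (rim e))    = contradiction c (centre≢cont e)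

    spoke⁺ : ∀ {u v} → kind v ≢ centre → cen v ≡ u → Adjacent u v
    spoke⁺ nc refl = inj₁ (spoke nc)

    fromFirstSpoke : ∀ {u} → kind u ≡ centre → ∀ v → kind v ≢ centre → cen v ≡ u → Star (Turn u) (suc u) v
    fromFirstSpoke c zero    nc e = contradiction kind-0 nc
    fromFirstSpoke {u} c (suc v) nc e with kind v ≟ᴷ centre
    ... | yes c′ = subst (λ w → Star (Turn u) (suc u) (suc w))
                     (trans (sym e) (trans (cen-suc nc) (cen-centre c′))) ε
    ... | no nc′ = fromFirstSpoke c v nc′ e′ ◅◅ ((spoke⁺ nc′ e′ , ρ-next c nc) ◅ ε)
      where
      e′ : cen v ≡ u
      e′ = trans (sym (cen-suc nc)) e

    -- The number `t` bounds the remaining steps. All numbers from `n` on count as centres, so the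
    -- fan must end, and the rotation wrap around, before `t` runs out.
    toFirstSpoke : ∀ {u} → kind u ≡ centre → ∀ t v → n ≤ v + t → kind v ≢ centre → cen v ≡ u →
                   Star (Turn u) v (suc u)
    toFirstSpoke c zero    v n≤ nc e = contradiction (subst (n ≤_) (ℕ.+-identityʳ v) n≤) (ℕ.<⇒≱ (bounded v nc))
    toFirstSpoke c (suc t) v n≤ nc e with kind (suc v) ≟ᴷ centre
    ... | yes c′ = (spoke⁺ nc e , ρ-wrap c c′) ◅ ε
    ... | no nc′ = (spoke⁺ nc e , ρ-next c nc′) ◅
                   toFirstSpoke c t (suc v) (subst (n ≤_) (ℕ.+-suc v t) n≤) nc′ (trans (cen-suc nc′) e)

    onwardToCentre : ∀ {u} → kind u ≢ centre → Star (Turn u) (onward u) (cen u)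
    onwardToCentre {u} nc with kind (suc u) ≟ᴷ cont
    ... | yes e = (subst (Adjacent u) (sym (onward-cont e)) (inj₁ (rim e)) ,
                   trans (cong (ρ u) (onward-cont e)) (ρ-right e)) ◅ ε
    ... | no ne = subst (λ w → Star (Turn u) w (cen u)) (sym (onward-last ne)) ε

    toCentre : ∀ {u v} → kind u ≢ centre → Adjacent u v → Star (Turn u) v (cen u)
    toCentre nc (inj₁ (spoke {j} _)) = contradiction (centre-cen j) nc
    toCentre nc (inj₁ (rim e))       = (inj₁ (rim e) , ρ-right e) ◅ ε
    toCentre nc (inj₂ (spoke _))     = ε
    toCentre nc (inj₂ (rim e))       = (inj₂ (rim e) , ρ-left e) ◅ onwardToCentre nc

    toOnward : ∀ u → kind u ≢ centre → Star (Turn u) (cen u) (onward u)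
    toOnward u nc with kinds u
    ... | inj₁ c = contradiction c nc
    ... | inj₂ (inj₁ e) = (inj₂ (spoke nc) , ρ-first e) ◅ ε
    toOnward zero    nc | inj₂ (inj₂ e) = contradiction kind-0 nc
    toOnward (suc i) nc | inj₂ (inj₂ e) = (inj₂ (spoke nc) , ρ-cont e) ◅ (inj₂ (rim e) , ρ-left e) ◅ ε

    fromCentre : ∀ {u v} → kind u ≢ centre → Adjacent u v → Star (Turn u) (cen u) v
    fromCentre nc (inj₁ (spoke {j} _)) = contradiction (centre-cen j) nc
    fromCentre nc (inj₁ (rim {i} e))   = subst (Star (Turn i) (cen i)) (onward-cont e) (toOnward i nc)
    fromCentre nc (inj₂ (spoke _))     = ε
    fromCentre nc (inj₂ (rim e))       = (inj₂ (spoke nc) , ρ-cont e) ◅ ε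

    -- One fixed neighbour serves as an intermediate stop: the centre for a path vertex, the first
    -- spoke `suc u` for a centre.
    turns : ∀ {u v w} → Adjacent u v → Adjacent u w → Star (Turn u) v w
    turns {u} {v} {w} a b with kind u ≟ᴷ centre
    ... | no nc = toCentre nc a ◅◅ fromCentre nc b
    ... | yes c = toFirstSpoke c n v (ℕ.m≤n+m n v) (proj₁ (spokes c a)) (proj₂ (spokes c a))
               ◅◅ fromFirstSpoke c w (proj₁ (spokes c b)) (proj₂ (spokes c b))

    turns-fin : ∀ {u v w} → Star (Turn u) v w → Star (λ x y → ρᶠ (fin u) x ≡ y) (fin v) (fin w)
    turns-fin ε                = ε
    turns-fin ((a , refl) ◅ s) = ρᶠ-fin (proj₁ (adjacent-bounded a)) (proj₂ (adjacent-bounded a)) ◅ turns-fin s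

  isRotation : IsRotation
  isRotation = closed , single
    where
    closed : ∀ u v → Adj graph u v → Adj graph u (ρᶠ u v)
    closed u v a = subst₂ (Adj graph) (fin-toℕ u) (sym (ρᶠ≡ u v)) (adj-fin (ρ-adjacent (adj⁻ a)))
    single : ∀ u v w → Adj graph u v → Adj graph u w → Star (λ x y → ρᶠ u x ≡ y) v w
    single u v w a b = subst (λ z → Star (λ x y → ρᶠ z x ≡ y) v w) (fin-toℕ u)
      (subst₂ (Star (λ x y → ρᶠ (fin (toℕ u)) x ≡ y)) (fin-toℕ v) (fin-toℕ w) (turns-fin (turns (adj⁻ {u} {v} a) (adj⁻ {u} {w} b))))

  open Faces graph rotation isRotation using (orbit-sym)

  private
    Dart : Set
    Dart = Fin n × Fin n

    dart : ℕ → ℕ → Dart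
    dart u v = fin u , fin v

    next-dart : ∀ {u v} → Adjacent u v → next (dart u v) ≡ dart v (ρ v u)
    next-dart a = cong (_ ,_) (ρᶠ-fin (proj₂ (adjacent-bounded a)) (proj₁ (adjacent-bounded a)))

    dart-step : ∀ {u v w} → Adjacent u v → ρ v u ≡ w → SameFace (dart u v) (dart v w)
    dart-step a refl = next-dart a ◅ ε

    -- The darts by their position on their face: `firstSpoke` and `ahead` make up the outer walk of
    -- a fan, the other three the triangle of a vertex of kind `cont`.
    data View : ℕ → ℕ → ℕ → Set where
      firstSpoke    : ∀ {j} → kind j ≡ first → View (cen j) j (cen j)
      ahead   : ∀ {j} → kind j ≢ centre → View j (onward j) (cen j)
      contSpoke     : ∀ {i} → kind (suc i) ≡ cont → View (cen (suc i)) (suc i) (suc i)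
      back     : ∀ {i} → kind (suc i) ≡ cont → View (suc i) i (suc i)
      home  : ∀ {i} → kind (suc i) ≡ cont → View i (cen i) (suc i)

    view : ∀ {u v} → Adjacent u v → View u v (label u v)
    view (inj₁ (spoke {j} nc)) with kinds j
    ... | inj₁ c = contradiction c nc
    ... | inj₂ (inj₁ e) = subst (View (cen j) j) (sym (label-first e)) (firstSpoke e)
    view (inj₁ (spoke {zero} nc))  | inj₂ (inj₂ e) = contradiction kind-0 nc
    view (inj₁ (spoke {suc i} nc)) | inj₂ (inj₂ e) = subst (View _ _) (sym (label-cont e)) (contSpoke e)
    view (inj₁ (rim {i} e)) = subst (λ v → View i v (label i v)) (onward-cont e)
      (subst (View i (onward i)) (sym (label-onward (noncentre-pred e))) (ahead (noncentre-pred e)))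
    view (inj₂ (rim e)) = subst (View _ _) (sym (label-left e)) (back e)
    view (inj₂ (spoke {j} nc)) with kind (suc j) ≟ᴷ cont
    ... | yes e = subst (View _ _) (sym (label-in e)) (home e)
    ... | no ne = subst (λ v → View j v (label j v)) (onward-last ne)
      (subst (View j (onward j)) (sym (label-onward nc)) (ahead nc))

    -- The dart by which the outer walk reaches a path vertex: from the centre at the start of a
    -- path, from the left neighbour otherwise. The value at a centre is a placeholder.
    arrival : ℕ → Dart
    arrival j = dart (kindCase (kind j) 0 (cen j) (pred j)) j

    arrival-first : ∀ {j} → kind j ≡ first → arrival j ≡ dart (cen j) j
    arrival-first e rewrite e = refl

    arrival-cont : ∀ {i} → kind (suc i) ≡ cont → arrival (suc i) ≡ dart i (suc i)
    arrival-cont e rewrite e = refl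

    arrival-next : ∀ j → kind j ≢ centre → SameFace (arrival j) (dart j (onward j))
    arrival-next j nc with kinds j
    ... | inj₁ c = contradiction c nc
    ... | inj₂ (inj₁ e) = subst (λ d → SameFace d (dart j (onward j))) (sym (arrival-first e))
                            (dart-step (inj₁ (spoke nc)) (ρ-first e))
    arrival-next zero    nc | inj₂ (inj₂ e) = contradiction kind-0 nc
    arrival-next (suc i) nc | inj₂ (inj₂ e) = subst (λ d → SameFace d (dart (suc i) (onward (suc i))))
      (sym (arrival-cont e)) (dart-step (inj₁ (rim e)) (ρ-left e))

    outerStart : ℕ → Dart
    outerStart c = dart c (suc c)

    -- The outer walk of a fan traverses its paths in order, returning to the
    -- centre after each of them.
    outer-arrival : ∀ j → kind j ≢ centre → SameFace (outerStart (cen j)) (arrival j)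
    outer-arrival zero    nc = contradiction kind-0 nc
    outer-arrival (suc i) nc = subst (λ c → SameFace (outerStart c) (arrival (suc i))) (sym (cen-suc nc))
                                 (cases (kind i ≟ᴷ centre) (kinds (suc i)))
      where
      cases : Dec (kind i ≡ centre) → kind (suc i) ≡ centre ⊎ kind (suc i) ≡ first ⊎ kind (suc i) ≡ cont →
              SameFace (outerStart (cen i)) (arrival (suc i))
      cases _        (inj₁ c)        = contradiction c nc
      cases (yes c)  (inj₂ (inj₂ e)) = contradiction e (legal i c)
      cases (yes c)  (inj₂ (inj₁ e)) = subst (SameFace (outerStart (cen i)))
        (trans (cong (dart (cen i)) (cong suc (cen-centre c)))
          (trans (cong (λ c → dart c (suc i)) (sym (cen-suc nc))) (sym (arrival-first e)))) ε
      cases (no nc′) (inj₂ (inj₂ e)) = outer-arrival i nc′ ◅◅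
        subst (SameFace (arrival i)) (trans (cong (dart i) (onward-cont e)) (sym (arrival-cont e))) (arrival-next i nc′)
      cases (no nc′) (inj₂ (inj₁ e)) = outer-arrival i nc′
        ◅◅ subst (λ v → SameFace (arrival i) (dart i v)) (onward-last (first≢cont e)) (arrival-next i nc′)
        ◅◅ subst (SameFace (dart i (cen i)))
             (trans (cong (λ c → dart c (suc i)) (sym (cen-suc nc))) (sym (arrival-first e)))
             (dart-step (inj₂ (spoke nc′)) (ρ-next (centre-cen i) (centre≢first e)))

    -- The dart from which `reach` follows the face labelled `ℓ`. A label is a centre or a vertex of
    -- kind `cont`, so the entry for `first` is a placeholder.
    canonical : ℕ → Dart
    canonical ℓ = dart ℓ (kindCase (kind ℓ) (suc ℓ) 0 (pred ℓ))

    canonical-centre : ∀ j → canonical (cen j) ≡ outerStart (cen j)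
    canonical-centre j rewrite centre-cen j = refl

    canonical-cont : ∀ {i} → kind (suc i) ≡ cont → canonical (suc i) ≡ dart (suc i) i
    canonical-cont e rewrite e = refl

    start-adj : ∀ j → kind j ≢ centre → Adjacent (cen j) (suc (cen j))
    start-adj j nc = spoke⁺ (centre≢first (first-of-fan nc)) (cen-first-of-fan nc)

    hub-step : ∀ {i} → kind (suc i) ≡ cont → SameFace (dart i (cen i)) (dart (cen (suc i)) (suc i))
    hub-step {i} e = subst (λ c → SameFace (dart i (cen i)) (dart c (suc i))) (sym (cen-suc (centre≢cont e)))
      (dart-step (inj₂ (spoke (noncentre-pred e))) (ρ-next (centre-cen i) (centre≢cont e)))

    reach-back : ∀ {i} → kind (suc i) ≡ cont → SameFace (canonical (suc i)) (dart (suc i) i)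
    reach-back {i} e = subst (SameFace (canonical (suc i))) (canonical-cont e) ε

    reach-home : ∀ {i} → kind (suc i) ≡ cont → SameFace (canonical (suc i)) (dart i (cen i))
    reach-home e = reach-back e ◅◅ dart-step (inj₂ (rim e)) (ρ-right e)

    reach : ∀ {u v ℓ} → View u v ℓ → SameFace (canonical ℓ) (dart u v)
    reach (firstSpoke {j} e)   = subst₂ SameFace (sym (canonical-centre j)) (arrival-first e)
                                (outer-arrival j (centre≢first e))
    reach (ahead {j} nc) = subst (λ d → SameFace d (dart j (onward j))) (sym (canonical-centre j))
                                (outer-arrival j nc ◅◅ arrival-next j nc)
    reach (back e)          = reach-back e
    reach (home e)          = reach-home e
    reach (contSpoke e)     = reach-home e ◅◅ hub-step e

    start∈ : ∀ j → kind j ≢ centre → canonical (cen j) ∈ Graph.darts graph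
    start∈ j nc = subst (_∈ Graph.darts graph) (sym (canonical-centre j)) (∈-darts⁺ graph (adj-fin (start-adj j nc)))

    rim∈ : ∀ {i} → kind (suc i) ≡ cont → canonical (suc i) ∈ Graph.darts graph
    rim∈ e = subst (_∈ Graph.darts graph) (sym (canonical-cont e)) (∈-darts⁺ graph (adj-fin (inj₂ (rim e))))

    canonical∈ : ∀ {u v ℓ} → View u v ℓ → canonical ℓ ∈ Graph.darts graph
    canonical∈ (firstSpoke {j} e) = start∈ j (centre≢first e)
    canonical∈ (ahead {j} nc)     = start∈ j nc
    canonical∈ (contSpoke e)      = rim∈ e
    canonical∈ (back e)           = rim∈ e
    canonical∈ (home e)           = rim∈ e

    labelᶠ : Dart → ℕ
    labelᶠ (u , v) = label (toℕ u) (toℕ v)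

    viewᶠ : ∀ {x} → x ∈ Graph.darts graph → View (toℕ (proj₁ x)) (toℕ (proj₂ x)) (labelᶠ x)
    viewᶠ m = view (adj⁻ (∈-darts⁻ graph m))

    reachᶠ : ∀ {x} → x ∈ Graph.darts graph → SameFace (canonical (labelᶠ x)) x
    reachᶠ {u , v} m = subst (SameFace _) (cong₂ _,_ (fin-toℕ u) (fin-toℕ v)) (reach (viewᶠ m))

  label⇒sameFace : ∀ {u v x y} → Adj graph u v → Adj graph x y →
    label (toℕ u) (toℕ v) ≡ label (toℕ x) (toℕ y) → SameFace (u , v) (x , y)
  label⇒sameFace a b e = orbit-sym (canonical∈ (viewᶠ (∈-darts⁺ graph a))) (reachᶠ (∈-darts⁺ graph a))
    ◅◅ subst (λ ℓ → SameFace (canonical ℓ) _) (sym e) (reachᶠ (∈-darts⁺ graph b))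

  private
    sameFace⇒label : ∀ {x y} → x ∈ Graph.darts graph → SameFace x y → labelᶠ x ≡ labelᶠ y
    sameFace⇒label m ε = refl
    sameFace⇒label {u , v} m (refl ◅ s) = trans (sym step)
      (sameFace⇒label (∈-darts⁺ graph (proj₁ isRotation v u (adj-sym graph a))) s)
      where
      a : Adj graph u v
      a = ∈-darts⁻ graph m
      step : label (toℕ v) (toℕ (ρᶠ v u)) ≡ label (toℕ u) (toℕ v)
      step = trans (cong (λ w → label (toℕ v) w) (trans (cong toℕ (ρᶠ≡ v u))
               (toℕ-fin (proj₂ (adjacent-bounded (ρ-adjacent (adj⁻ (adj-sym graph a))))))))
             (label-next (adj⁻ a))

  count : {Q : ℕ → Set} → Pred.Decidable Q → ℕ
  count Q? = length (filter Q? (upTo n))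

  centre? : Pred.Decidable (λ i → kind i ≡ centre)
  centre? i = kind i ≟ᴷ centre

  cont? : Pred.Decidable (λ i → kind i ≡ cont)
  cont? i = kind i ≟ᴷ cont

  private
    -- A centre followed by a centre is an isolated vertex; this covers the last vertex too, as `n`
    -- counts as a centre. So every centre yields one boundary walk, an outer face or an isolated
    -- vertex, which is what balances Euler's formula.
    fan? : Pred.Decidable (λ i → kind i ≡ centre × kind (suc i) ≢ centre)
    fan? i = centre? i ×-dec ¬? (centre? (suc i))

    lone? : Pred.Decidable (λ i → kind i ≡ centre × kind (suc i) ≡ centre)
    lone? i = centre? i ×-dec centre? (suc i)

    filter-unique : {Q : ℕ → Set} (Q? : Pred.Decidable Q) → Unique (filter Q? (upTo n))
    filter-unique Q? = Unique.filter⁺ Q? (Unique.upTo⁺ n)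

    ∈-count⁺ : {Q : ℕ → Set} (Q? : Pred.Decidable Q) → ∀ {i} → i < n → Q i → i ∈ filter Q? (upTo n)
    ∈-count⁺ Q? i<n q = ∈-filter⁺ Q? (∈-upTo⁺ i<n) q

    ∈-count⁻ : {Q : ℕ → Set} (Q? : Pred.Decidable Q) → ∀ {i} → i ∈ filter Q? (upTo n) → i < n × Q i
    ∈-count⁻ Q? m with ∈-filter⁻ Q? {xs = upTo n} m
    ... | m′ , q = ∈-upTo⁻ m′ , q

  connected⇒cen : ∀ {u v} → Connected graph u v → cen (toℕ u) ≡ cen (toℕ v)
  connected⇒cen ε       = refl
  connected⇒cen {u} (_◅_ {j = w} a s) = trans (adjacent-cen (adj⁻ {u} {w} a)) (connected⇒cen {w} s)

  cen<n : ∀ (u : Fin n) → cen (toℕ u) < n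
  cen<n u = ℕ.≤-<-trans (cen≤ (toℕ u)) (Fin.toℕ<n u)

  connected-cen : ∀ u → Connected graph u (fin (cen (toℕ u)))
  connected-cen u with kind (toℕ u) ≟ᴷ centre
  ... | yes c = subst (Connected graph u) (trans (sym (fin-toℕ u)) (cong fin (sym (cen-centre c)))) ε
  ... | no nc = subst (λ v → Adj graph v (fin (cen (toℕ u)))) (fin-toℕ u) (adj-fin (inj₂ (spoke nc))) ◅ ε

  cen⇒connected : ∀ {u v} → cen (toℕ u) ≡ cen (toℕ v) → Connected graph u v
  cen⇒connected {u} {v} e = connected-cen u ◅◅
    subst (λ c → Connected graph (fin c) v) (sym e) (connected-sym graph (connected-cen v))

  componentCount≡ : Graph.componentCount graph ≡ count centre?
  componentCount≡ = deduplicate-count (connected? graph) ε _◅◅_ (cen ∘ toℕ) (allFin n)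
    (filter-unique centre?)
    (λ {u} _ → ∈-count⁺ centre? (cen<n u) (centre-cen (toℕ u)))
    (λ {i} m → let (i<n , c) = ∈-count⁻ centre? m in
       fin i , ∈-allFin (fin i) , trans (cong cen (toℕ-fin i<n)) (cen-centre c))
    (λ _ _ → connected⇒cen) (λ _ _ → cen⇒connected)

  faceCount≡ : length (deduplicate sameFace? (Graph.darts graph)) ≡ count cont? + count fan?
  faceCount≡ = trans
    (deduplicate-count sameFace? ε _◅◅_ labelᶠ (Graph.darts graph)
      (Unique.++⁺ (filter-unique cont?) (filter-unique fan?)
        λ { (m , m′) → centre≢cont (proj₂ (∈-count⁻ cont? m)) (proj₁ (proj₂ (∈-count⁻ fan? m′))) })
      (λ m → into (viewᶠ m)) onto
      (λ m _ → sameFace⇒label m)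
      (λ m m′ → label⇒sameFace (∈-darts⁻ graph m) (∈-darts⁻ graph m′)))
    (List.length-++ (filter cont? (upTo n)))
    where
    labels : List ℕ
    labels = filter cont? (upTo n) ++ filter fan? (upTo n)
    centreLabel : ∀ j → kind j ≢ centre → cen j ∈ labels
    centreLabel j nc = ∈-++⁺ʳ (filter cont? (upTo n)) (∈-count⁺ fan? (ℕ.<-trans (cen< nc) (bounded j nc))
      (centre-cen j , centre≢first (first-of-fan nc)))
    contLabel : ∀ {i} → kind i ≡ cont → i ∈ labels
    contLabel e = ∈-++⁺ˡ (∈-count⁺ cont? (bounded _ (centre≢cont e)) e)
    into : ∀ {u v ℓ} → View u v ℓ → ℓ ∈ labels
    into (firstSpoke {j} e)   = centreLabel j (centre≢first e)
    into (ahead {j} nc) = centreLabel j nc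
    into (contSpoke e)        = contLabel e
    into (back e)        = contLabel e
    into (home e)     = contLabel e
    witness : ∀ {u v ℓ} → Adjacent u v → label u v ≡ ℓ → ∃[ x ] x ∈ Graph.darts graph × labelᶠ x ≡ ℓ
    witness {u} {v} a e = dart u v , ∈-darts⁺ graph (adj-fin a) ,
      trans (cong₂ label (toℕ-fin (proj₁ (adjacent-bounded a))) (toℕ-fin (proj₂ (adjacent-bounded a)))) e
    onto : ∀ {ℓ} → ℓ ∈ labels → ∃[ x ] x ∈ Graph.darts graph × labelᶠ x ≡ ℓ
    onto {ℓ} m with ∈-++⁻ (filter cont? (upTo n)) m
    onto {zero}  m | inj₁ m′ = contradiction kind-0 (centre≢cont (proj₂ (∈-count⁻ cont? m′)))
    onto {suc i} m | inj₁ m′ = witness (inj₂ (rim e)) (label-left e)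
      where
      e : kind (suc i) ≡ cont
      e = proj₂ (∈-count⁻ cont? m′)
    onto {c} m | inj₂ m′ = witness (spoke⁺ nc c′) (trans (cong (λ i → label i (suc c)) (sym c′)) (trans (label-first e) c′))
      where
      k : kind c ≡ centre
      k = proj₁ (proj₂ (∈-count⁻ fan? m′))
      nc : kind (suc c) ≢ centre
      nc = proj₂ (proj₂ (∈-count⁻ fan? m′))
      e : kind (suc c) ≡ first
      e = first-after-centre k nc
      c′ : cen (suc c) ≡ c
      c′ = trans (cen-suc nc) (cen-centre k)

  isolatedCount≡ : Graph.isolatedCount graph ≡ count lone?
  isolatedCount≡ = trans (sym (List.length-map toℕ (filter isolated? (allFin n))))
    (unique-length-≡ (Unique.map⁺ Fin.toℕ-injective (Unique.filter⁺ isolated? (Unique.allFin⁺ n)))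
      (filter-unique lone?) sub sup)
    where
    isolated? : Pred.Decidable (λ u → Subset.∣ Graph.N graph u ∣ ≡ 0)
    isolated? u = Subset.∣ Graph.N graph u ∣ ℕ.≟ 0
    alone : ∀ u → (∀ v → ¬ Adj graph u v) → kind (toℕ u) ≡ centre × kind (suc (toℕ u)) ≡ centre
    alone u none with kind (toℕ u) ≟ᴷ centre
    ... | no nc = ⊥-elim (none (fin (cen (toℕ u))) (subst (λ v → Adj graph v (fin (cen (toℕ u)))) (fin-toℕ u)
                    (adj-fin (inj₂ (spoke nc)))))
    ... | yes c with kind (suc (toℕ u)) ≟ᴷ centre
    ...   | yes c′ = c , c′
    ...   | no nc  = ⊥-elim (none (fin (suc (toℕ u))) (subst (λ v → Adj graph v (fin (suc (toℕ u)))) (fin-toℕ u)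
                       (adj-fin (spoke⁺ nc (trans (cen-suc nc) (cen-centre c))))))
    sub : ∀ {i} → i ∈ map toℕ (filter isolated? (allFin n)) → i ∈ filter lone? (upTo n)
    sub m with ∈-map⁻ toℕ m
    ... | u , u∈ , refl = ∈-count⁺ lone? (Fin.toℕ<n u)
      (alone u (∣∣≡0⇒noNeighbours _ (proj₂ (∈-filter⁻ isolated? {xs = allFin n} u∈))))
    sup : ∀ {i} → i ∈ filter lone? (upTo n) → i ∈ map toℕ (filter isolated? (allFin n))
    sup {i} m with ∈-count⁻ lone? m
    ... | i<n , c , c′ = subst (_∈ map toℕ (filter isolated? (allFin n))) (toℕ-fin i<n)
      (∈-map⁺ toℕ (∈-filter⁺ isolated? (∈-allFin (fin i)) (noNeighbours⇒∣∣≡0 _ none)))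
      where
      none : ∀ v → ¬ Adj graph (fin i) v
      none v a with spokes c (subst (λ u → Adjacent u (toℕ v)) (toℕ-fin i<n) (adj⁻ a))
      ... | nc , e = centre≢first (first-of-fan nc) (subst (λ j → kind (suc j) ≡ centre) (sym e) c′)

  size≡ : size graph ≡ count (¬? ∘ centre?) + count cont?
  size≡ = trans (sym (List.length-map toℕ² forward))
    (trans (unique-length-≡ (Unique.map⁺ toℕ²-injective (Unique.filter⁺ forward? (pairs-unique graph))) edges-unique sub sup)
    (trans (List.length-++ spokeEdges)
      (cong₂ _+_ (List.length-map _ (filter (¬? ∘ centre?) (upTo n))) (List.length-map _ (filter cont? (upTo n))))))
    where
    toℕ² : Fin n × Fin n → ℕ × ℕ
    toℕ² (u , v) = toℕ u , toℕ v
    toℕ²-injective : ∀ {x y} → toℕ² x ≡ toℕ² y → x ≡ y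
    toℕ²-injective e = cong₂ _,_ (Fin.toℕ-injective (cong proj₁ e)) (Fin.toℕ-injective (cong proj₂ e))
    forward? : Pred.Decidable (λ ((u , v) : Fin n × Fin n) → u Fin.< v × Adj graph u v)
    forward? (u , v) = (u Fin.<? v) ×-dec adj? graph u v
    forward : List (Fin n × Fin n)
    forward = filter forward? (Graph.pairs graph)
    spokeEdges rimEdges : List (ℕ × ℕ)
    spokeEdges = map (λ j → cen j , j) (filter (¬? ∘ centre?) (upTo n))
    rimEdges   = map (λ j → pred j , j) (filter cont? (upTo n))
    edges-unique : Unique (spokeEdges ++ rimEdges)
    edges-unique = Unique.++⁺ (Unique.map⁺ (cong proj₂) (filter-unique (¬? ∘ centre?)))
                              (Unique.map⁺ (cong proj₂) (filter-unique cont?)) λ { (m , m′) → apart m m′ }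
      where
      apart : ∀ {x} → x ∈ spokeEdges → x ∉ rimEdges
      apart m m′ with ∈-map⁻ _ m | ∈-map⁻ _ m′
      ... | j , _ , refl | i , i∈ , e with cong proj₂ e | cong proj₁ e | proj₂ (∈-count⁻ cont? i∈)
      apart m m′ | zero , _ , refl | _ , i∈ , e | refl | _ | k = centre≢cont k kind-0
      apart m m′ | suc j , _ , refl | _ , i∈ , e | refl | eq | k =
        ℕ.<⇒≢ (cen< (noncentre-pred k)) (trans (sym (cen-suc (centre≢cont k))) eq)
    edge∈ : ∀ {i j} → Edge i j → (i , j) ∈ spokeEdges ++ rimEdges
    edge∈ (spoke nc) = ∈-++⁺ˡ (∈-map⁺ (λ j → cen j , j) (∈-count⁺ (¬? ∘ centre?) (bounded _ nc) nc))
    edge∈ (rim e)    = ∈-++⁺ʳ spokeEdges (∈-map⁺ (λ j → pred j , j) (∈-count⁺ cont? (bounded _ (centre≢cont e)) e))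
    sub : ∀ {x} → x ∈ map toℕ² forward → x ∈ spokeEdges ++ rimEdges
    sub m with ∈-map⁻ toℕ² m
    ... | (u , v) , m′ , refl with ∈-filter⁻ forward? {xs = Graph.pairs graph} m′
    ...   | _ , u<v , a with adj⁻ a
    ...     | inj₁ e = edge∈ e
    ...     | inj₂ e = contradiction (edge< e) (ℕ.<⇒≯ u<v)
    fromEdge : ∀ {i j} → Edge i j → (i , j) ∈ map toℕ² forward
    fromEdge {i} {j} e = subst (_∈ map toℕ² forward) (cong₂ _,_ (toℕ-fin i<n) (toℕ-fin j<n))
      (∈-map⁺ toℕ² (∈-filter⁺ forward? (∈-pairs graph (fin i) (fin j))
        (subst₂ _<_ (sym (toℕ-fin i<n)) (sym (toℕ-fin j<n)) (edge< e) , adj-fin (inj₁ e))))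
      where
      i<n : i < n
      i<n = proj₁ (adjacent-bounded (inj₁ e))
      j<n : j < n
      j<n = edge-bounded e
    sup : ∀ {x} → x ∈ spokeEdges ++ rimEdges → x ∈ map toℕ² forward
    sup m with ∈-++⁻ spokeEdges m
    sup m | inj₁ m′ with ∈-map⁻ _ m′
    ... | j , j∈ , refl = fromEdge (spoke (proj₂ (∈-count⁻ (¬? ∘ centre?) j∈)))
    sup m | inj₂ m′ with ∈-map⁻ _ m′
    ... | zero  , j∈ , refl = contradiction kind-0 (centre≢cont (proj₂ (∈-count⁻ cont? j∈)))
    ... | suc j , j∈ , refl = fromEdge (rim (proj₂ (∈-count⁻ cont? j∈)))

  outerplanar : Outerplanar graph
  outerplanar = rotation , isRotation , isPlanar , allOnOuterFace
    where
    isPlanar : IsPlanar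
    isPlanar = begin
      n + walkCount                                         ≡⟨ cong₂ (λ f i → n + (f + i)) faceCount≡ isolatedCount≡ ⟩
      n + ((count cont? + count fan?) + count lone?)        ≡⟨ cong (n +_) (ℕ.+-assoc (count cont?) (count fan?) (count lone?)) ⟩
      n + (count cont? + (count fan? + count lone?))        ≡⟨ cong (λ c → n + (count cont? + c)) (length-filter-× centre? (centre? ∘ suc) (upTo n)) ⟩
      n + (count cont? + c)                                 ≡⟨ cong (_+ (count cont? + c)) (sym c+nc≡n) ⟩
      (c + nc) + (count cont? + c)                          ≡⟨ rearrange c nc (count cont?) ⟩
      (nc + count cont?) + 2 * c                            ≡⟨ cong₂ (λ s c → s + 2 * c) (sym size≡) (sym componentCount≡) ⟩
      size graph + 2 * Graph.componentCount graph           ∎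
      where
      open ≡-Reasoning
      c nc : ℕ
      c  = count centre?
      nc = count (¬? ∘ centre?)
      c+nc≡n : c + nc ≡ n
      c+nc≡n = trans (length-filter-¬ centre? (upTo n)) (List.length-upTo n)
      rearrange : ∀ c nc t → (c + nc) + (t + c) ≡ (nc + t) + 2 * c
      rearrange = solve-∀
    -- Together with its value, every vertex of a fan forms a dart on the outer walk; for the centre
    -- this is the first spoke.
    onwardᶠ : ℕ → ℕ
    onwardᶠ u = kindCase (kind u) (suc u) (onward u) (onward u)
    nonisolated : ∀ {u v} → Adjacent u v → ∃[ j ] kind j ≢ centre × cen j ≡ cen u
    nonisolated (inj₁ (spoke {j} nc)) = j , nc , sym (cen-centre (centre-cen j))
    nonisolated (inj₁ (rim {i} e))    = i , noncentre-pred e , refl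
    nonisolated (inj₂ (spoke {j} nc)) = j , nc , refl
    nonisolated (inj₂ (rim {i} e))    = suc i , centre≢cont e , refl
    outerDart : ∀ w {j} → kind j ≢ centre → cen j ≡ cen w →
                Adjacent w (onwardᶠ w) × label w (onwardᶠ w) ≡ cen w
    outerDart w {j} nc e with kind w ≟ᴷ centre
    ... | no nc′ = subst Good (sym (elsewhere nc′)) (adjacent-onward nc′ , label-onward nc′)
      where
      Good : ℕ → Set
      Good y = Adjacent w y × label w y ≡ cen w
      elsewhere : kind w ≢ centre → onwardᶠ w ≡ onward w
      elsewhere nc with kind w
      ... | centre = contradiction refl nc
      ... | first  = refl
      ... | cont   = refl
    ... | yes c = subst Good (sym (at-centre c)) (spoke⁺ nc₁ cen₁ ,
          trans (cong (λ i → label i (suc w)) (sym cen₁))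
            (trans (label-first (first-after-centre c nc₁)) (trans cen₁ (sym (cen-centre c)))))
      where
      Good : ℕ → Set
      Good y = Adjacent w y × label w y ≡ cen w
      at-centre : kind w ≡ centre → onwardᶠ w ≡ suc w
      at-centre c rewrite c = refl
      nc₁ : kind (suc w) ≢ centre
      nc₁ = centre≢first (subst (λ i → kind (suc i) ≡ first) (trans e (cen-centre c)) (first-of-fan nc))
      cen₁ : cen (suc w) ≡ w
      cen₁ = trans (cen-suc nc₁) (cen-centre c)
    allOnOuterFace : AllOnOuterFace
    allOnOuterFace u v a = x u , adj-x u refl , λ w s →
      let e = connected⇒cen {u} {w} s in
      x w , adj-x w e , label⇒sameFace (adj-x u refl) (adj-x w e) (trans (label-x u refl) (trans e (sym (label-x w e))))
      where
      j = nonisolated (adj⁻ {u} {v} a)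
      x : Fin n → Fin n
      x w = fin (onwardᶠ (toℕ w))
      out : ∀ w → cen (toℕ u) ≡ cen (toℕ w) → _
      out w e = outerDart (toℕ w) (proj₁ (proj₂ j)) (trans (proj₂ (proj₂ j)) e)
      adj-x : ∀ w → cen (toℕ u) ≡ cen (toℕ w) → Adj graph w (x w)
      adj-x w e = subst (λ z → Adj graph z (x w)) (fin-toℕ w) (adj-fin (proj₁ (out w e)))
      label-x : ∀ w → cen (toℕ u) ≡ cen (toℕ w) → label (toℕ w) (toℕ (x w)) ≡ cen (toℕ w)
      label-x w e = trans (cong (label (toℕ w)) (toℕ-fin (proj₂ (adjacent-bounded (proj₁ (out w e))))))
                          (proj₂ (out w e))

-- Path-freeness and edge counts of fan forests

linked-tabulate : ∀ {A : Set} {R : Rel A 0ℓ} k (f : Fin k → A) →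
  (∀ i j → toℕ j ≡ suc (toℕ i) → R (f i) (f j)) → Linked R (List.tabulate f)
linked-tabulate zero          f step = []
linked-tabulate (suc zero)    f step = [-]
linked-tabulate (suc (suc k)) f step = step zero (suc zero) refl ∷
  linked-tabulate (suc k) (f ∘ suc) (λ i j e → step (suc i) (suc j) (cong suc e))

short⇒pathFree : ∀ {n k} {G : Graph n} →
  (∀ {xs} → Linked (Adj G) xs → Unique xs → length xs < k) → P k -Free G
short⇒pathFree {k = k} short (f , inj , hom) = ℕ.n≮n k (subst (_< k) (List.length-tabulate f)
  (short (linked-tabulate k f (λ i j e → hom i j (P-adj⁺ i j (inj₁ e)))) (Unique.tabulate⁺ (λ {i} {j} → inj {i} {j}))))

module _ {A : Set} {R : Rel A 0ℓ} where

  linked-++⁻ˡ : ∀ (xs : List A) {ys} → Linked R (xs ++ ys) → Linked R xs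
  linked-++⁻ˡ []           l       = []
  linked-++⁻ˡ (x ∷ [])     l       = [-]
  linked-++⁻ˡ (x ∷ y ∷ xs) (r ∷ l) = r ∷ linked-++⁻ˡ (y ∷ xs) l

  linked-++⁻ʳ : ∀ (xs : List A) {ys} → Linked R (xs ++ ys) → Linked R ys
  linked-++⁻ʳ []       l = l
  linked-++⁻ʳ (x ∷ xs) l = linked-++⁻ʳ xs (Linked.tail l)

-- The number of edges which a vertex of the given kind adds to a fan forest.
weight : Kind → ℕ
weight k = kindCase k 0 1 2

module ForestSize (m : ℕ) (kind : ℕ → Kind) (kind-0 : kind 0 ≡ centre)
  (legal : ∀ i → kind i ≡ centre → kind (suc i) ≢ cont)
  (bounded : ∀ i → kind i ≢ centre → i < suc m) where

  open FanForest m kind kind-0 legal bounded using (graph; centre?; cont?; size≡)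

  private
    counts : List ℕ → ℕ
    counts xs = length (filter (¬? ∘ centre?) xs) + length (filter cont? xs)

    counts-++ : ∀ xs ys → counts (xs ++ ys) ≡ counts xs + counts ys
    counts-++ xs ys = trans
      (cong₂ _+_ (trans (cong length (List.filter-++ (¬? ∘ centre?) xs ys)) (List.length-++ (filter (¬? ∘ centre?) xs)))
                 (trans (cong length (List.filter-++ cont? xs ys)) (List.length-++ (filter cont? xs))))
      (rearrange (length (filter (¬? ∘ centre?) xs)) (length (filter (¬? ∘ centre?) ys))
                 (length (filter cont? xs)) (length (filter cont? ys)))
      where
      rearrange : ∀ a b c d → (a + b) + (c + d) ≡ (a + c) + (b + d)
      rearrange = solve-∀

    counts-[_] : ∀ i → counts [ i ] ≡ weight (kind i)
    counts-[ i ] with kind i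
    ... | centre = refl
    ... | first  = refl
    ... | cont   = refl

  -- The number of edges among the first `j` vertices, each edge being charged to its larger end.
  sizeUpTo : ℕ → ℕ
  sizeUpTo j = counts (upTo j)

  sizeUpTo-suc : ∀ j → sizeUpTo (suc j) ≡ sizeUpTo j + weight (kind j)
  sizeUpTo-suc j = trans (cong counts (sym (List.upTo-∷ʳ j)))
    (trans (counts-++ (upTo j) [ j ]) (cong (sizeUpTo j +_) counts-[ j ]))

  size≡sizeUpTo : size graph ≡ sizeUpTo (suc m)
  size≡sizeUpTo = size≡

-- A single fan

-- The path vertex t + 1 of the fan belongs to the path number run t: the first
-- path has s + d vertices and all others have d.
module SingleFan (m s d : ℕ) .{{_ : NonZero d}} where

  run : ℕ → ℕ
  run t = (t ∸ s) / d

  run-mono : ∀ t → run t ≤ run (suc t)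
  run-mono t = ℕ./-monoˡ-≤ d (ℕ.∸-monoˡ-≤ s (ℕ.n≤1+n t))

  runKind : ℕ → Kind
  runKind zero    = first
  runKind (suc t) = if does (run (suc t) ℕ.≟ run t) then cont else first

  kind : ℕ → Kind
  kind zero    = centre
  kind (suc t) = if does (suc t <? suc m) then runKind t else centre

  runKind-suc : ∀ t → (runKind (suc t) ≡ cont × run (suc t) ≡ run t) ⊎
                      (runKind (suc t) ≡ first × run (suc t) ≢ run t)
  runKind-suc t = cases (run (suc t) ℕ.≟ run t)
    where
    cases : (e? : Dec (run (suc t) ≡ run t)) →
            ((if does e? then cont else first) ≡ cont × run (suc t) ≡ run t) ⊎
            ((if does e? then cont else first) ≡ first × run (suc t) ≢ run t)
    cases (yes e) = inj₁ (refl , e)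
    cases (no ne) = inj₂ (refl , ne)

  runKind-cont : ∀ t → runKind (suc t) ≡ cont → run (suc t) ≡ run t
  runKind-cont t e with runKind-suc t
  ... | inj₁ (_ , eq) = eq
  ... | inj₂ (f , _) with trans (sym e) f
  ...   | ()

  runKind≢centre : ∀ t → runKind t ≢ centre
  runKind≢centre zero    ()
  runKind≢centre (suc t) c with runKind-suc t
  ... | inj₁ (e , _) with trans (sym c) e
  ...   | ()
  runKind≢centre (suc t) c | inj₂ (f , _) with trans (sym c) f
  ... | ()

  kind-inside : ∀ {t} → suc t < suc m → kind (suc t) ≡ runKind t
  kind-inside {t} t< = cong (λ b → if b then runKind t else centre) (dec-true (suc t <? suc m) t<)

  kind-outside : ∀ {t} → ¬ suc t < suc m → kind (suc t) ≡ centre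
  kind-outside {t} t≮ = cong (λ b → if b then runKind t else centre) (dec-false (suc t <? suc m) t≮)

  bounded : ∀ i → kind i ≢ centre → i < suc m
  bounded zero    nc = contradiction refl nc
  bounded (suc t) nc with suc t <? suc m
  ... | yes t< = t<
  ... | no  t≮ = contradiction (kind-outside t≮) nc

  inside-kind : ∀ {i} → i < suc m → kind i ≡ centre → i ≡ 0
  inside-kind {zero}  _  _ = refl
  inside-kind {suc t} t< c = contradiction (trans (sym (kind-inside t<)) c) (runKind≢centre t)

  legal : ∀ i → kind i ≡ centre → kind (suc i) ≢ cont
  legal i c e with suc i <? suc m
  ... | no i≮ with trans (sym e) (kind-outside i≮)
  ...   | ()
  legal i c e | yes i< with inside-kind (ℕ.<-trans ℕ.≤-refl i<) c
  ... | refl with trans (sym e) (kind-inside i<)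
  ...   | ()

  open FanForest m kind refl legal bounded public
  open ForestSize m kind refl legal bounded
  open import Data.List.Membership.DecPropositional (Fin._≟_ {n}) using (_∈?_)

  cen≡0 : ∀ i → i < n → cen i ≡ 0
  cen≡0 zero    _  = refl
  cen≡0 (suc t) t< = trans (cen-suc λ c → ℕ.1+n≢0 (inside-kind t< c)) (cen≡0 t (ℕ.<-trans ℕ.≤-refl t<))

  connected : IsConnected graph
  connected u v = cen⇒connected (trans (cen≡0 (toℕ u) (Fin.toℕ<n u)) (sym (cen≡0 (toℕ v) (Fin.toℕ<n v))))

  private
    edge-run : ∀ {i j} → Edge i j → i ≢ 0 → run (pred i) ≡ run (pred j)
    edge-run (spoke {j} nc) i≢0 = contradiction (cen≡0 j (bounded j nc)) i≢0
    edge-run (rim {zero} e) i≢0 = contradiction refl i≢0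
    edge-run (rim {suc t} e) i≢0 = sym (runKind-cont t
      (trans (sym (kind-inside (bounded (suc (suc t)) (centre≢cont e)))) e))

    runᶠ : Fin n → ℕ
    runᶠ u = run (pred (toℕ u))

    adj-run : ∀ {u v} → Adj graph u v → u ≢ zero → v ≢ zero → runᶠ u ≡ runᶠ v
    adj-run {u} {v} a u≢0 v≢0 with adj⁻ {u} {v} a
    ... | inj₁ e = edge-run e (λ eq → u≢0 (Fin.toℕ-injective eq))
    ... | inj₂ e = sym (edge-run e (λ eq → v≢0 (Fin.toℕ-injective eq)))

    path-run : ∀ {x xs} → Linked (Adj graph) (x ∷ xs) → zero ∉ x ∷ xs → ∀ {y} → y ∈ x ∷ xs → runᶠ y ≡ runᶠ x
    path-run l             0∉ (here refl) = refl
    path-run {x} (_∷_ {y = z} a l) 0∉ (there m)   = trans (path-run l (0∉ ∘ there) m)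
      (sym (adj-run {x} {z} a (λ e → 0∉ (here (sym e))) (λ e → 0∉ (there (here (sym e))))))

    window : ℕ → List ℕ
    window b = map (λ r → suc (s + (r + b * d))) (upTo d)

    -- The centre and the paths number a and b; the s extra vertices of the
    -- first path are always included.
    cover : ℕ → ℕ → List ℕ
    cover a b = 0 ∷ map suc (upTo s) ++ window a ++ window b

    length-cover : ∀ a b → length (cover a b) ≡ suc (s + (d + d))
    length-cover a b = cong suc (trans (List.length-++ (map suc (upTo s)))
      (cong₂ _+_ (trans (List.length-map suc (upTo s)) (List.length-upTo s))
        (trans (List.length-++ (window a)) (cong₂ _+_ (length-window a) (length-window b)))))
      where
      length-window : ∀ b → length (window b) ≡ d
      length-window b = trans (List.length-map _ (upTo d)) (List.length-upTo d)

    located : ∀ t → suc t ∈ map suc (upTo s) ⊎ suc t ∈ window (run t)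
    located t with t <? s
    ... | yes t<s = inj₁ (∈-map⁺ suc (∈-upTo⁺ t<s))
    ... | no  t≮s = inj₂ (subst (_∈ window (run t))
      (cong suc (trans (cong (s +_) (sym (ℕ.m≡m%n+[m/n]*n (t ∸ s) d))) (ℕ.m+[n∸m]≡n (ℕ.≮⇒≥ t≮s))))
      (∈-map⁺ (λ r → suc (s + (r + run t * d))) (∈-upTo⁺ (ℕ.m%n<n (t ∸ s) d))))

    covered : ∀ {a b} (u : Fin n) → u ≡ zero ⊎ runᶠ u ≡ a ⊎ runᶠ u ≡ b → toℕ u ∈ cover a b
    covered zero    _ = here refl
    covered {a} {b} (suc u) c with located (toℕ u)
    ... | inj₁ m = there (∈-++⁺ˡ m)
    covered (suc u) (inj₂ (inj₁ refl)) | inj₂ m = there (∈-++⁺ʳ (map suc (upTo s)) (∈-++⁺ˡ m))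
    covered {a} (suc u) (inj₂ (inj₂ refl)) | inj₂ m =
      there (∈-++⁺ʳ (map suc (upTo s)) (∈-++⁺ʳ (window a) m))

    runOf : List (Fin n) → ℕ
    runOf []      = 0
    runOf (x ∷ _) = runᶠ x

    sameRun : ∀ {xs} → Linked (Adj graph) xs → zero ∉ xs → ∀ {x} → x ∈ xs → runᶠ x ≡ runOf xs
    sameRun {x ∷ xs} l 0∉ m = path-run l 0∉ m

    -- Away from the centre a walk cannot change from one path of the fan to another. A path visits
    -- the centre at most once, so it has at most one run before it and one after it. If it avoids
    -- the centre, the second number is arbitrary.
    path-runs : ∀ {xs} → Linked (Adj graph) xs → Unique xs →
                ∃₂ λ a b → ∀ {x} → x ∈ xs → x ≡ zero ⊎ runᶠ x ≡ a ⊎ runᶠ x ≡ b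
    path-runs {xs} l u with zero ∈? xs
    ... | no 0∉ = runOf xs , 0 , λ m → inj₂ (inj₁ (sameRun l 0∉ m))
    ... | yes 0∈ with ∈-∃++ 0∈
    ...   | as , bs , refl = runOf as , runOf bs , λ m → cases (∈-++⁻ as m)
      where
      cases : ∀ {x} → x ∈ as ⊎ x ∈ zero ∷ bs → x ≡ zero ⊎ runᶠ x ≡ runOf as ⊎ runᶠ x ≡ runOf bs
      cases (inj₁ m)         = inj₂ (inj₁ (sameRun (linked-++⁻ˡ as l) (λ m′ → unique-++-disjoint as u m′ (here refl)) m))
      cases (inj₂ (here e))  = inj₁ e
      cases (inj₂ (there m)) = inj₂ (inj₂ (sameRun (Linked.tail (linked-++⁻ʳ as l)) (unique-∷⁻ (unique-++⁻ʳ as u)) m))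

  -- Even if one of the two runs is the longer first path, they have at most `s + 2 d` vertices
  -- together; with the centre this is one less than `k`.
  pathFree : P (2 + d + (s + d)) -Free graph
  pathFree = short⇒pathFree {G = graph} short
    where
    short : ∀ {xs} → Linked (Adj graph) xs → Unique xs → length xs < 2 + d + (s + d)
    short {xs} l u with path-runs l u
    ... | a , b , inRuns = s≤s (begin
      length xs              ≡⟨ sym (List.length-map toℕ xs) ⟩
      length (map toℕ xs)    ≤⟨ unique-length-≤ (Unique.map⁺ Fin.toℕ-injective u) sub ⟩
      length (cover a b)     ≡⟨ length-cover a b ⟩
      suc (s + (d + d))      ≡⟨ rearrange s d ⟩
      1 + d + (s + d)        ∎)
      where
      open ℕ.≤-Reasoning
      sub : ∀ {i} → i ∈ map toℕ xs → i ∈ cover a b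
      sub m with ∈-map⁻ toℕ m
      ... | x , x∈ , refl = covered x (inRuns x∈)
      rearrange : ∀ s d → suc (s + (d + d)) ≡ 1 + d + (s + d)
      rearrange = solve-∀

  private
    -- Each path vertex adds two edges, except that the start of each path adds only one. Every new
    -- start raises `run`, so up to this vertex there are at most `suc (run t)` starts.
    sizeUpTo≥ : ∀ t → suc t < n → 2 * suc t ≤ sizeUpTo (2 + t) + suc (run t)
    sizeUpTo≥ zero t< = subst (λ w → 2 ≤ w + suc (run 0)) (sym w≡) (s≤s (s≤s z≤n))
      where
      w≡ : sizeUpTo 2 ≡ 1
      w≡ = trans (sizeUpTo-suc 1) (cong weight (kind-inside t<))
    sizeUpTo≥ (suc t) t< = begin
      2 * suc (suc t)                                        ≡⟨ ℕ.*-suc 2 (suc t) ⟩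
      2 + 2 * suc t                                          ≤⟨ ℕ.+-monoʳ-≤ 2 (sizeUpTo≥ t (ℕ.<-trans ℕ.≤-refl t<)) ⟩
      2 + (sizeUpTo (2 + t) + suc (run t))                   ≡⟨ rearrange 2 (sizeUpTo (2 + t)) (suc (run t)) ⟩
      sizeUpTo (2 + t) + (2 + suc (run t))                   ≤⟨ ℕ.+-monoʳ-≤ (sizeUpTo (2 + t)) step ⟩
      sizeUpTo (2 + t) + (weight (runKind (suc t)) + suc (run (suc t)))
                                                             ≡⟨ sym (ℕ.+-assoc (sizeUpTo (2 + t)) _ _) ⟩
      sizeUpTo (2 + t) + weight (runKind (suc t)) + suc (run (suc t))
                                                             ≡⟨ cong (λ k → sizeUpTo (2 + t) + weight k + suc (run (suc t))) (sym (kind-inside t<)) ⟩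
      sizeUpTo (2 + t) + weight (kind (2 + t)) + suc (run (suc t))
                                                             ≡⟨ cong (_+ suc (run (suc t))) (sym (sizeUpTo-suc (2 + t))) ⟩
      sizeUpTo (3 + t) + suc (run (suc t))                   ∎
      where
      open ℕ.≤-Reasoning
      rearrange : ∀ a b c → a + (b + c) ≡ b + (a + c)
      rearrange = solve-∀
      step : 2 + suc (run t) ≤ weight (runKind (suc t)) + suc (run (suc t))
      step with runKind-suc t
      ... | inj₁ (k , e)  = ℕ.≤-reflexive (cong₂ (λ k r → weight k + suc r) (sym k) (sym e))
      ... | inj₂ (k , ne) = subst (λ k → 3 + run t ≤ weight k + suc (run (suc t))) (sym k)
                              (s≤s (s≤s (ℕ.≤∧≢⇒< (run-mono t) (ne ∘ sym))))

  size≥ : ∀ t → suc t ≡ m → s ≤ t → d * (2 * m) + s ≤ d * size graph + d + t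
  size≥ t refl s≤t = begin
    d * (2 * suc t) + s                      ≤⟨ ℕ.+-monoˡ-≤ s (ℕ.*-monoʳ-≤ d (sizeUpTo≥ t ℕ.≤-refl)) ⟩
    d * (sizeUpTo n + suc (run t)) + s       ≡⟨ cong (λ e → d * (e + suc (run t)) + s) (sym size≡sizeUpTo) ⟩
    d * (size graph + suc (run t)) + s       ≡⟨ rearrange d (size graph) (run t) s ⟩
    d * size graph + d + (run t * d + s)     ≤⟨ ℕ.+-monoʳ-≤ (d * size graph + d) (ℕ.+-monoˡ-≤ s (ℕ.m/n*n≤m (t ∸ s) d)) ⟩
    d * size graph + d + (t ∸ s + s)         ≡⟨ cong (d * size graph + d +_) (ℕ.m∸n+n≡m s≤t) ⟩
    d * size graph + d + t                   ∎
    where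
    open ℕ.≤-Reasoning
    rearrange : ∀ d e r s → d * (e + suc r) + s ≡ d * e + d + (r * d + s)
    rearrange = solve-∀

-- Disjoint fans with three path vertices

module DiamondForest (m : ℕ) where

  periodic : {A : Set} → A → A → A → A → ℕ → A
  periodic x y z w 0 = x
  periodic x y z w 1 = y
  periodic x y z w 2 = z
  periodic x y z w 3 = w
  periodic x y z w (suc (suc (suc (suc i)))) = periodic x y z w i

  baseKind : ℕ → Kind
  baseKind = periodic centre first cont cont

  offset : ℕ → ℕ
  offset = periodic 0 1 2 3

  -- The difference `5 j - 4 * sizeUpTo j`, that is, how far an incomplete last copy falls behind
  -- the five edges per four vertices of the complete ones. The worst value, 6, belongs to a copy
  -- cut down to one edge.
  deficit : ℕ → ℕ
  deficit = periodic 0 5 6 3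

  kind : ℕ → Kind
  kind i = if does (i <? suc m) then baseKind i else centre

  kind-inside : ∀ {i} → i < suc m → kind i ≡ baseKind i
  kind-inside {i} i< = cong (λ b → if b then baseKind i else centre) (dec-true (i <? suc m) i<)

  kind-outside : ∀ {i} → ¬ i < suc m → kind i ≡ centre
  kind-outside {i} i≮ = cong (λ b → if b then baseKind i else centre) (dec-false (i <? suc m) i≮)

  bounded : ∀ i → kind i ≢ centre → i < suc m
  bounded i nc with i <? suc m
  ... | yes i< = i<
  ... | no  i≮ = contradiction (kind-outside i≮) nc

  baseKind-legal : ∀ i → baseKind i ≡ centre → baseKind (suc i) ≢ cont
  baseKind-legal 0 _ ()
  baseKind-legal 1 ()
  baseKind-legal 2 ()
  baseKind-legal 3 ()
  baseKind-legal (suc (suc (suc (suc i)))) = baseKind-legal i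

  legal : ∀ i → kind i ≡ centre → kind (suc i) ≢ cont
  legal i c e with suc i <? suc m
  ... | yes i< = baseKind-legal i (trans (sym (kind-inside (ℕ.<-trans ℕ.≤-refl i<))) c)
                                  (trans (sym (kind-inside i<)) e)
  ... | no  i≮ with trans (sym e) (kind-outside i≮)
  ...   | ()

  open FanForest m kind refl legal bounded public
  open ForestSize m kind refl legal bounded

  private
    offset-suc : ∀ i → (baseKind (suc i) ≡ centre × offset (suc i) ≡ 0) ⊎
                       (baseKind (suc i) ≢ centre × offset (suc i) ≡ suc (offset i))
    offset-suc 0 = inj₂ ((λ ()) , refl)
    offset-suc 1 = inj₂ ((λ ()) , refl)
    offset-suc 2 = inj₂ ((λ ()) , refl)
    offset-suc 3 = inj₁ (refl , refl)
    offset-suc (suc (suc (suc (suc i)))) = offset-suc i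

    offset≤3 : ∀ i → offset i < 4
    offset≤3 0 = s≤s z≤n
    offset≤3 1 = s≤s (s≤s z≤n)
    offset≤3 2 = s≤s (s≤s (s≤s z≤n))
    offset≤3 3 = ℕ.≤-refl
    offset≤3 (suc (suc (suc (suc i)))) = offset≤3 i

    cen+offset : ∀ i → i < n → cen i + offset i ≡ i
    cen+offset zero    _  = refl
    cen+offset (suc i) i< with offset-suc i
    ... | inj₁ (c , o)  = trans (cong₂ _+_ (cen-centre (trans (kind-inside i<) c)) o) (ℕ.+-identityʳ (suc i))
    ... | inj₂ (nc , o) = trans (cong₂ _+_ (cen-suc (λ c → nc (trans (sym (kind-inside i<)) c))) o)
                            (trans (ℕ.+-suc (cen i) (offset i)) (cong suc (cen+offset i (ℕ.<-trans ℕ.≤-refl i<))))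

    sameFan≤4 : ∀ {xs} c → Unique xs → (∀ {x : Fin n} → x ∈ xs → cen (toℕ x) ≡ c) → length xs ≤ 4
    sameFan≤4 {xs} c u same = begin
      length xs                       ≡⟨ sym (List.length-map toℕ xs) ⟩
      length (map toℕ xs)             ≤⟨ unique-length-≤ (Unique.map⁺ Fin.toℕ-injective u) sub ⟩
      length (map (c +_) (upTo 4))    ≡⟨⟩
      4                               ∎
      where
      open ℕ.≤-Reasoning
      sub : ∀ {i} → i ∈ map toℕ xs → i ∈ map (c +_) (upTo 4)
      sub m with ∈-map⁻ toℕ m
      ... | x , x∈ , refl = subst (_∈ map (c +_) (upTo 4))
        (trans (cong (_+ offset (toℕ x)) (sym (same x∈))) (cen+offset (toℕ x) (Fin.toℕ<n x)))
        (∈-map⁺ (c +_) (∈-upTo⁺ (offset≤3 (toℕ x))))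

    path-cen : ∀ {x xs} → Linked (Adj graph) (x ∷ xs) → ∀ {y} → y ∈ x ∷ xs → cen (toℕ y) ≡ cen (toℕ x)
    path-cen l             (here refl) = refl
    path-cen {x} (_∷_ {y = z} a l) (there m) = trans (path-cen l m) (sym (adjacent-cen (adj⁻ {x} {z} a)))

  pathFree : P 5 -Free graph
  pathFree = short⇒pathFree {G = graph} short
    where
    short : ∀ {xs} → Linked (Adj graph) xs → Unique xs → length xs < 5
    short {[]}     l u = s≤s z≤n
    short {x ∷ xs} l u = s≤s (sameFan≤4 (cen (toℕ x)) u (path-cen l))

  small : SmallComponents 5 graph
  small u = sameFan≤4 (cen (toℕ u)) (Unique.filter⁺ (connected? graph u) (Unique.allFin⁺ n))
    λ {x} m → sym (connected⇒cen {u} {x} (proj₂ (∈-filter⁻ (connected? graph u) {xs = allFin n} m)))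

  private
    deficit-suc : ∀ i → 4 * weight (baseKind i) + deficit (suc i) ≡ 5 + deficit i
    deficit-suc 0 = refl
    deficit-suc 1 = refl
    deficit-suc 2 = refl
    deficit-suc 3 = refl
    deficit-suc (suc (suc (suc (suc i)))) = deficit-suc i

    deficit≤6 : ∀ i → deficit i ≤ 6
    deficit≤6 0 = z≤n
    deficit≤6 1 = ℕ.n≤1+n 5
    deficit≤6 2 = ℕ.≤-refl
    deficit≤6 3 = s≤s (s≤s (s≤s z≤n))
    deficit≤6 (suc (suc (suc (suc i)))) = deficit≤6 i

    sizeUpTo≡ : ∀ j → j ≤ n → 4 * sizeUpTo j + deficit j ≡ 5 * j
    sizeUpTo≡ zero    _  = refl
    sizeUpTo≡ (suc j) j< = begin
      4 * sizeUpTo (suc j) + deficit (suc j)                        ≡⟨ cong (λ w → 4 * w + deficit (suc j)) (trans (sizeUpTo-suc j) (cong (λ k → sizeUpTo j + weight k) (kind-inside j<))) ⟩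
      4 * (sizeUpTo j + weight (baseKind j)) + deficit (suc j)      ≡⟨ rearrange (sizeUpTo j) (weight (baseKind j)) (deficit (suc j)) ⟩
      4 * sizeUpTo j + (4 * weight (baseKind j) + deficit (suc j))  ≡⟨ cong (4 * sizeUpTo j +_) (deficit-suc j) ⟩
      4 * sizeUpTo j + (5 + deficit j)                              ≡⟨ rearrange′ (4 * sizeUpTo j) (deficit j) ⟩
      5 + (4 * sizeUpTo j + deficit j)                              ≡⟨ cong (5 +_) (sizeUpTo≡ j (ℕ.<⇒≤ j<)) ⟩
      5 + 5 * j                                                     ≡⟨ sym (ℕ.*-suc 5 j) ⟩
      5 * suc j                                                     ∎
      where
      open ≡-Reasoning
      rearrange : ∀ a b c → 4 * (a + b) + c ≡ 4 * a + (4 * b + c)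
      rearrange = solve-∀
      rearrange′ : ∀ a b → a + (5 + b) ≡ 5 + (a + b)
      rearrange′ = solve-∀

  size≥ : 5 * n ≤ 4 * size graph + 6
  size≥ = begin
    5 * n                             ≡⟨ sym (sizeUpTo≡ n ℕ.≤-refl) ⟩
    4 * sizeUpTo n + deficit n        ≤⟨ ℕ.+-monoʳ-≤ (4 * sizeUpTo n) (deficit≤6 n) ⟩
    4 * sizeUpTo n + 6                ≡⟨ cong (λ e → 4 * e + 6) (sym size≡sizeUpTo) ⟩
    4 * size graph + 6                ∎
    where open ℕ.≤-Reasoning

-- Comparison of the maxima

maxSize≤ : ∀ {n} {Q : Graph n → Set} (Q? : Pred.Decidable Q) {b} → (∀ G → Q G → size G ≤ b) → maxSize Q? ≤ b
maxSize≤ {n} Q? bound = max≤v⁺ {xs = map size (filter Q? (allGraphs n))} z≤n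
  (All.map⁺ (All.tabulate λ {G} m → bound G (proj₂ (∈-filter⁻ Q? {xs = allGraphs n} m))))

size≤ex′ : ∀ {n k} (G : Graph n) → PathFreeOuterplanar k G → IsConnected G → size G ≤ ex′ n k
size≤ex′ {n} {k} G p c = size≤maxSize {n} {λ G → PathFreeOuterplanar k G × IsConnected G}
  (λ G → pathFreeOuterplanar? k G ×-dec isConnected? G) G (p , c)

size≤ex″ : ∀ {n k} (G : Graph n) → PathFreeOuterplanar k G → SmallComponents k G → size G ≤ ex″ n k
size≤ex″ {n} {k} G p s = size≤maxSize {n} {λ G → PathFreeOuterplanar k G × SmallComponents k G}
  (λ G → pathFreeOuterplanar? k G ×-dec smallComponents? k G) G (p , s)

ex′⊔ex″≤ex : ∀ n k → ex′ n k ⊔ ex″ n k ≤ ex n k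
ex′⊔ex″≤ex n k = ℕ.⊔-lub
  (maxSize≤ {n} {λ G → PathFreeOuterplanar k G × IsConnected G}
    (λ G → pathFreeOuterplanar? k G ×-dec isConnected? G) λ G p → size≤ex G (proj₁ p))
  (maxSize≤ {n} {λ G → PathFreeOuterplanar k G × SmallComponents k G}
    (λ G → pathFreeOuterplanar? k G ×-dec smallComponents? k G) λ G p → size≤ex G (proj₁ p))
  where
  size≤ex : ∀ (G : Graph n) → PathFreeOuterplanar k G → size G ≤ ex n k
  size≤ex = size≤maxSize {n} {PathFreeOuterplanar k} (pathFreeOuterplanar? k)

ex≤ : ∀ {n k b} → (∀ (G : Graph n) → PathFreeOuterplanar k G → size G ≤ b) → ex n k ≤ b
ex≤ {n} {k} = maxSize≤ {n} {PathFreeOuterplanar k} (pathFreeOuterplanar? k)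

halve : ∀ j → ∃₂ λ d s → s ≤ 1 × j ≡ d + (s + d)
halve zero    = 0 , 0 , z≤n , refl
halve (suc j) with halve j
... | d , 0 , _ , e = d , 1 , ℕ.≤-refl , trans (cong suc e) (sym (ℕ.+-suc d d))
... | d , 1 , _ , e = suc d , 0 , z≤n , cong suc e
... | d , suc (suc s) , s≤s () , _

-- The bounds give `d E ≤ d S + (d - 1)`, hence `E ≤ S` for integers. In the proof,
-- `d (S + 1) ≤ d E` is added to both of them, and the two sides of the result differ by 1 in the
-- wrong direction.
single-fan-optimal : ∀ {d s t E S δ} → δ + suc s ≡ 2 * d →
  d * E + (suc d * (2 + t) + δ) ≤ d * (3 * (2 + t)) → d * (2 * suc t) + s ≤ d * S + d + t → E ≤ S
single-fan-optimal {d} {s} {t} {E} {S} {δ} δ≡ upper lower = ℕ.≮⇒≥ λ S<E → ℕ.1+n≰n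
  (subst (_≤ y) x≡1+y (ℕ.+-mono-≤ (ℕ.+-mono-≤ lower (ℕ.*-monoʳ-≤ d S<E)) upper))
  where
  x y : ℕ
  x = (d * (2 * suc t) + s) + d * suc S + (d * E + (suc d * (2 + t) + δ))
  y = (d * S + d + t) + d * E + d * (3 * (2 + t))
  identity : ∀ d s t E S δ →
    (d * (2 * suc t) + s) + d * suc S + (d * E + (suc d * (2 + t) + δ)) + 2 * d ≡
    suc ((d * S + d + t) + d * E + d * (3 * (2 + t))) + (δ + suc s)
  identity = solve-∀
  x≡1+y : x ≡ suc y
  x≡1+y = ℕ.+-cancelʳ-≡ (2 * d) x (suc y) (trans (identity d s t E S δ) (cong (suc y +_) δ≡))

-- Here `4 E ≤ 5 n - 5` and `5 n - 6 ≤ 4 S`, so `4 E` exceeds `4 S` by at most 1, which is less than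
-- one edge.
diamond-forest-optimal : ∀ {n E S} → 4 * E + (7 * n + 5) ≤ 4 * (3 * n) → 5 * n ≤ 4 * S + 6 → E ≤ S
diamond-forest-optimal {n} {E} {S} upper lower = ℕ.≮⇒≥ λ S<E → ℕ.m+1+n≰m y
  (subst (_≤ y) (identity n E S) (ℕ.+-mono-≤ (ℕ.+-mono-≤ upper lower) (ℕ.*-monoʳ-≤ 4 S<E)))
  where
  y : ℕ
  y = 4 * (3 * n) + (4 * S + 6) + 4 * E
  identity : ∀ n E S → 4 * E + (7 * n + 5) + 5 * n + 4 * suc S ≡ 4 * (3 * n) + (4 * S + 6) + 4 * E + 3
  identity = solve-∀

largeComponent : ∀ {n k} (G : Graph n) → ¬ SmallComponents (suc k) G → ∃[ u ] suc k ≤ length (component G u)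
largeComponent {n} {k} G ¬small with Fin.¬∀⟶∃¬ n _ (λ u → length (component G u) ≤? k) ¬small
... | u , ≰k = u , ℕ.≰⇒> ≰k

Dominated : ∀ {n} → ℕ → Graph n → Set
Dominated {n} k G = ∃[ H ] PathFreeOuterplanar {n} k H × (IsConnected H ⊎ SmallComponents k H) × size G ≤ size H

dominated⇒size≤ : ∀ {n k} (G : Graph n) → Dominated k G → size G ≤ ex′ n k ⊔ ex″ n k
dominated⇒size≤ {n} {k} G (H , p , inj₁ connected , ≤H) =
  ℕ.≤-trans ≤H (ℕ.≤-trans (size≤ex′ H p connected) (ℕ.m≤m⊔n (ex′ n k) (ex″ n k)))
dominated⇒size≤ {n} {k} G (H , p , inj₂ small , ≤H) =
  ℕ.≤-trans ≤H (ℕ.≤-trans (size≤ex″ H p small) (ℕ.m≤n⊔m (ex′ n k) (ex″ n k)))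

-- With `e = s + d`, the hypothesis `suc s ≤ d` is the condition `1 + d + e ≤ 3 d` of `size≤`. Among
-- `d > 0` and `s ≤ 1` it fails only for `d = s = 1`, that is `k = 5`.
singleFan-dominates : ∀ {d s t} → 0 < d → s ≤ 1 → suc s ≤ d → s ≤ t → (G : Graph (2 + t)) →
  PathFreeOuterplanar (2 + d + (s + d)) G → ∃[ u ] 2 + d + (s + d) ≤ length (component G u) →
  Dominated (2 + d + (s + d)) G
singleFan-dominates {d} {s} {t} d>0 s≤1 s<d s≤t G (free , op) (u , large) =
  Fan.graph , (Fan.pathFree , Fan.outerplanar) , inj₁ Fan.connected ,
  single-fan-optimal {d} {s} {t} δ≡ upper (Fan.size≥ t refl s≤t)
  where
  module Fan = SingleFan (suc t) s d {{>-nonZero d>0}}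
  δ : ℕ
  δ = 2 * d ∸ suc s
  δ≡ : δ + suc s ≡ 2 * d
  δ≡ = ℕ.m∸n+n≡m (ℕ.≤-trans s<d (ℕ.m≤n*m d 2))
  identity : ∀ δ s d → δ + suc (s + d) ≡ δ + suc s + d
  identity = solve-∀
  three : ∀ d → 2 * d + d ≡ 3 * d
  three = solve-∀
  rearrange : ∀ s d → 1 + d + (s + d) ≡ suc s + 2 * d
  rearrange = solve-∀
  upper : d * size G + (suc d * (2 + t) + δ) ≤ d * (3 * (2 + t))
  upper = LargeComponent.size≤ G op d (s + d) (ℕ.+-monoˡ-≤ d s≤1) free u large δ
    (trans (identity δ s d) (trans (cong (_+ d) δ≡) (three d)))
    (ℕ.≤-trans (ℕ.≤-reflexive (rearrange s d)) (ℕ.+-monoˡ-≤ (2 * d) s<d))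

diamondForest-dominates : ∀ {m} (G : Graph (suc m)) → PathFreeOuterplanar 5 G →
  ∃[ u ] 5 ≤ length (component G u) → Dominated 5 G
diamondForest-dominates {m} G (free , op) (u , large) =
  Forest.graph , (Forest.pathFree , Forest.outerplanar) , inj₂ Forest.small ,
  diamond-forest-optimal {suc m} (LargeComponent.size≤-P₅ G op 1 2 ℕ.≤-refl free u large refl refl) Forest.size≥
  where
  module Forest = DiamondForest m

dominated : ∀ {d s t} → 0 < d → s ≤ 1 → s ≤ t → (G : Graph (2 + t)) →
  PathFreeOuterplanar (2 + d + (s + d)) G → ∃[ u ] 2 + d + (s + d) ≤ length (component G u) →
  Dominated (2 + d + (s + d)) G
dominated {s = zero}                d>0 s≤1 = singleFan-dominates d>0 s≤1 d>0
dominated {suc (suc d)} {suc zero}  d>0 s≤1 = singleFan-dominates d>0 s≤1 (s≤s (s≤s z≤n))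
dominated {suc zero} {suc zero}     d>0 s≤1 _ = diamondForest-dominates
dominated {s = suc (suc s)} _ (s≤s ())

theorem3p1 : (n k : ℕ) → n ≥ k → k ≥ 4 → ex n k ≡ ex′ n k ⊔ ex″ n k
theorem3p1 (suc (suc t)) (suc (suc j)) (s≤s (s≤s j≤t)) (s≤s (s≤s 2≤j)) =
  ℕ.≤-antisym (ex≤ {n} {k} λ G p → dominated⇒size≤ G (dominate G p (smallComponents? k G))) (ex′⊔ex″≤ex n k)
  where
  n k : ℕ
  n = 2 + t
  k = 2 + j
  largeCase : ∃₂ (λ d s → s ≤ 1 × j ≡ d + (s + d)) → (G : Graph n) → PathFreeOuterplanar k G →
              ∃[ u ] k ≤ length (component G u) → Dominated k G
  largeCase (zero  , s , s≤1 , refl) =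
    -- For `d = 0` one would have `j = s ≤ 1`, that is `k ≤ 3`.
    contradiction (ℕ.≤-trans 2≤j (ℕ.≤-reflexive (ℕ.+-identityʳ s))) (ℕ.<⇒≱ (s≤s s≤1))
  largeCase (suc d , s , s≤1 , refl) = dominated {suc d} {s} (s≤s z≤n) s≤1
    (ℕ.≤-trans (ℕ.m≤m+n s (suc d)) (ℕ.m+n≤o⇒n≤o (suc d) j≤t))
  dominate : ∀ (G : Graph n) → PathFreeOuterplanar k G → Dec (SmallComponents k G) → Dominated k G
  -- A graph with small components only is itself a competitor for `ex″`.
  dominate G p (yes small) = G , p , inj₂ small , ℕ.≤-refl
  dominate G p (no ¬small) = largeCase (halve j) G p (largeComponent G ¬small)
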